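{- Let $s,t\ge 1$ be coprime integers. Then $$\frac{\sum_{\lambda\in \mathcal{C}_s\cap \mathcal{C}_t} |\mathrm{Stab}_{G_{s,t}}(\lambda)|^{ -1}\cdot |\lambda|}{\sum_{\lambda\in \mathcal{C}_s\cap \mathcal{C}_t} |\mathrm{Stab}_{G_{s,t}}(\lambda)|^{ -1}} = \frac{1}{24}(s-1)(t^2-1),$$ where the (finite) sums run over all partitions that are simultaneously $s$-cores and $t$-cores, and the (finite) stabilizers are taken with respect to the action of the group $G_{s,t}$ on $\mathcal{C}_s$.
   Context: A partition is an infinite weakly decreasing sequence $\lambda=(\lambda_1,\lambda_2,\ldots)$ of nonnegative integers with finite size $|\lambda|=\lambda_1+\lambda_2+\cdots$. Its Young diagram is $[\lambda]=\{(r,c)\in\mathbb{Z}_{>0}^2 : c\le\lambda_r\}$, its conjugate $\overline{\lambda}$ is given by $\overline{\lambda}_r=\#\{c\in\mathbb{Z}_{>0}: r\le\lambda_c\}$, and the hook length at $(r,c)\in[\lambda]$ is $1+(\lambda_r-r)+(\overline{\lambda}_c-c)$. A partition is an $s$-core if it has no hook of length $s$; $\mathcal{C}_s$ is the set of $s$-cores. For coprime $s,t$, the set $\mathcal{C}_s\cap\mathcal{C}_t$ is finite. Beta-sets and $s$-sets: the beta-set of $\lambda$ is $B^\lambda=\{\lambda_i-i : i\ge1\}\subset\mathbb{Z}$; $\lambda$ is an $s$-core iff $B^\lambda-s\subseteq B^\lambda$. For an $s$-core $\lambda$, its $s$-set is $\mathcal{S}_s(\lambda)=(B^\lambda+s)\setminus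 B^\lambda$. It consists of $s$ integers $a_{s,i}(\lambda)$ ($i\in\mathbb{Z}/s\mathbb{Z}$) with $a_{s,i}(\lambda)\equiv i\pmod s$ and $\sum_i a_{s,i}(\lambda)=\binom{s}{2}$, and $\lambda\mapsto\mathcal{S}_s(\lambda)$ is a bijection from $\mathcal{C}_s$ to the collection of all sets of $s$ integers that are pairwise incongruent modulo $s$ and have sum $\binom{s}{2}$. The group $G_{s,t}$: the group (under composition) of permutations $f:\mathbb{Z}\to\mathbb{Z}$ such that $f(m+s)=f(m)+s$ for all $m$; $\sum_{i=0}^{s-1}f(i)=\binom{s}{2}$; and $f(m)\equiv m\pmod t$ for all $m$. It acts on $\mathcal{C}_s$ by letting $f\lambda$ be the $s$-core with $\mathcal{S}_s(f\lambda)=f(\mathcal{S}_s(\lambda))$ (equivalently $B^{f\lambda}=f(B^\lambda)$). -}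

module Defs where

open import Algebra.Properties.Monoid.Sum using (sum-init-last)
open import Data.Fin.Base using (Fin; zero; suc; toℕ; fromℕ; inject₁)
open import Data.Fin.Properties using (toℕ-inject₁; toℕ-fromℕ; nonZeroIndex)
open import Data.Integer.Base as ℤ using (ℤ; +_)
open import Data.Integer.Divisibility using (_∣_)
import Data.Integer.Properties as ℤ
open import Data.List.Base using (length; filter; upTo)
open import Data.Nat.Base as ℕ using (ℕ; zero; suc; z≤n)
open import Data.Nat.Combinatorics using (_C_; nC1≡n; nCk+nC[k+1]≡[n+1]C[k+1])
import Data.Nat.Divisibility as ℕ
import Data.Nat.Properties as ℕ
open import Data.Product.Base using (∃; ∃-syntax; Σ-syntax; _×_; _,_; proj₁; proj₂)
open import Data.Rational.Base as ℚ using (ℚ; _/_)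
import Data.Rational.Properties as ℚ
open import Function.Base using (_∘_)
open import Function.Bundles using (Inverse; _↔_)
open import Function.Construct.Identity using (↔-id)
open import Level using (0ℓ)
open import Relation.Binary.Bundles using (Setoid)
import Relation.Binary.Construct.On as On
open import Relation.Binary.PropositionalEquality
  using (_≡_; _≢_; refl; sym; trans; cong; cong₂; subst; setoid; _→-setoid_;
         module ≡-Reasoning)
open import Relation.Unary using (Pred; _∈_; _∩_; _∖_; _≐_)

module Sumℕ = Algebra.Properties.Monoid.Sum ℕ.+-0-monoid
module Sumℤ = Algebra.Properties.Monoid.Sum ℤ.+-0-monoid
module Sumℚ = Algebra.Properties.Monoid.Sum ℚ.+-0-monoid

-- Rows and columns are indexed from 0: part i is λ_{i+1}.  The sequence has a
-- finite sum iff it is eventually zero; the witness `bound` is not part of the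
-- identity of a partition (see Partition-setoid).
record Partition : Set where
  field
    part       : ℕ → ℕ
    decreasing : ∀ i → part (suc i) ℕ.≤ part i
    bound      : ℕ
    vanishing  : ∀ i → bound ℕ.≤ i → part i ≡ 0

open Partition public

Partition-setoid : Setoid 0ℓ 0ℓ
Partition-setoid = On.setoid (ℕ →-setoid ℕ) part

size : Partition → ℕ
size p = ∑[ i < bound p ] part p (toℕ i)
  where open Sumℕ using (sum-syntax)

YoungDiagram : Partition → Pred (ℕ × ℕ) 0ℓ
YoungDiagram p (r , c) = c ℕ.< part p r

-- Only columns below `bound` can contribute, since every counted c has a
-- nonzero part.
conjugate : Partition → ℕ → ℕ
conjugate p r = length (filter (λ c → r ℕ.<? part p c) (upTo (bound p)))

hookLength : Partition → ℕ × ℕ → ℤ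
hookLength p (r , c) =
  + 1 ℤ.+ (+ part p r ℤ.- + suc r) ℤ.+ (+ conjugate p c ℤ.- + suc c)

Core : ℕ → Pred Partition 0ℓ
Core s p = ∀ b → b ∈ YoungDiagram p → hookLength p b ≢ + s

betaSet : Partition → Pred ℤ 0ℓ
betaSet p m = ∃[ i ] m ≡ + part p i ℤ.- + suc i

image : (ℤ → ℤ) → Pred ℤ 0ℓ → Pred ℤ 0ℓ
image f P n = ∃[ m ] m ∈ P × f m ≡ n

sSet : ℕ → Partition → Pred ℤ 0ℓ
sSet s p = image (ℤ._+ + s) (betaSet p) ∖ betaSet p

record G (s t : ℕ) : Set where
  field
    perm      : ℤ ↔ ℤ
  open Inverse perm public using (to; from)
  field
    shift     : ∀ m → to (m ℤ.+ + s) ≡ to m ℤ.+ + s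
    balanced  : Sumℤ.sum {s} (λ i → to (+ toℕ i)) ≡ + (s C 2)
    congruent : ∀ m → + t ∣ to m ℤ.- m

G-setoid : ℕ → ℕ → Setoid 0ℓ 0ℓ
G-setoid s t = On.setoid (ℤ →-setoid ℤ) (G.to {s} {t})

-- The action of G s t on s-cores, given by its graph: f · p ↦ q says that q is
-- f p, the unique s-core whose s-set is the image under f of the s-set of p.
_·_↦_ : ∀ {s t} → G s t → ∃ (Core s) → ∃ (Core s) → Set
_·_↦_ {s} f (p , _) (q , _) = sSet s q ≐ image (G.to f) (sSet s p)

Stab : ∀ s t → ∃ (Core s) → Setoid 0ℓ 0ℓ
Stab s t x = On.setoid {B = Σ[ f ∈ G s t ] f · x ↦ x} (G-setoid s t) proj₁

BiCore : ℕ → ℕ → Set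
BiCore s t = ∃ (Core s ∩ Core t)

BiCore-setoid : ℕ → ℕ → Setoid 0ℓ 0ℓ
BiCore-setoid s t = On.setoid {B = BiCore s t} Partition-setoid proj₁

asCore : ∀ {s t} → BiCore s t → ∃ (Core s)
asCore (p , ps , _) = p , ps

record Finite (S : Setoid 0ℓ 0ℓ) : Set where
  field
    card        : ℕ
    enumeration : Inverse (setoid (Fin card)) S

  element : Fin card → Setoid.Carrier S
  element = Inverse.to enumeration

  inhabited⇒nonZero : Setoid.Carrier S → ℕ.NonZero card
  inhabited⇒nonZero x = nonZeroIndex (Inverse.from enumeration x)

∑toℕ : ∀ n → Sumℤ.sum {n} (λ i → + toℕ i) ≡ + (n C 2)
∑toℕ zero    = refl
∑toℕ (suc n) = begin
  Sumℤ.sum {suc n} (λ i → + toℕ i)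
    ≡⟨ sum-init-last ℤ.+-0-monoid {n} (λ i → + toℕ i) ⟩
  Sumℤ.sum {n} (λ i → + toℕ (inject₁ i)) ℤ.+ + toℕ (fromℕ n)
    ≡⟨ cong₂ ℤ._+_ (Sumℤ.sum-cong-≗ {n} (λ i → cong +_ (toℕ-inject₁ i))) (cong +_ (toℕ-fromℕ n)) ⟩
  Sumℤ.sum {n} (λ i → + toℕ i) ℤ.+ + n
    ≡⟨ cong (ℤ._+ + n) (∑toℕ n) ⟩
  + (n C 2 ℕ.+ n)
    ≡⟨ cong +_ (trans (ℕ.+-comm (n C 2) n) (cong (ℕ._+ n C 2) (sym (nC1≡n n)))) ⟩
  + (n C 1 ℕ.+ n C 2)
    ≡⟨ cong +_ (nCk+nC[k+1]≡[n+1]C[k+1] n 1) ⟩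
  + (suc n C 2) ∎
  where open ≡-Reasoning

G-id : ∀ {s t} → G s t
G-id {s} {t} = record
  { perm      = ↔-id ℤ
  ; shift     = λ _ → refl
  ; balanced  = ∑toℕ s
  ; congruent = λ m → subst (+ t ∣_) (sym (ℤ.+-inverseʳ m)) (t ℕ.∣0)
  }

id∈Stab : ∀ {s t} (x : ∃ (Core s)) → Setoid.Carrier (Stab s t x)
id∈Stab x = G-id , (λ m∈S → _ , m∈S , refl) , λ { (_ , m∈S , refl) → m∈S }

∅ : Partition
∅ = record { part = λ _ → 0 ; decreasing = λ _ → z≤n ; bound = 0 ; vanishing = λ _ _ → refl }

∅-biCore : ∀ {s t} → BiCore s t
∅-biCore = ∅ , (λ _ ()) , (λ _ ())

sum-positive : ∀ n .{{_ : ℕ.NonZero n}} (w : Fin n → ℚ) →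
               (∀ i → ℚ.Positive (w i)) → ℚ.Positive (Sumℚ.sum w)
sum-positive 1 w w>0 =
  subst ℚ.Positive (sym (ℚ.+-identityʳ (w zero))) (w>0 zero)
sum-positive (suc (suc n)) w w>0 =
  ℚ.pos+pos⇒pos (w zero) {{w>0 zero}} (Sumℚ.sum (w ∘ suc))
    {{sum-positive (suc n) (w ∘ suc) (w>0 ∘ suc)}}

module _ {s t : ℕ}
         (cores : Finite (BiCore-setoid s t))
         (stabs : (x : BiCore s t) → Finite (Stab s t (asCore x))) where

  open Finite

  weight : BiCore s t → ℚ
  weight x = (+ 1 / card (stabs x))
    {{inhabited⇒nonZero (stabs x) (id∈Stab (asCore x))}}

  totalWeight : ℚ
  totalWeight = ∑[ i < card cores ] weight (element cores i)
    where open Sumℚ using (sum-syntax)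

  totalWeightedSize : ℚ
  totalWeightedSize =
    ∑[ i < card cores ]
      (weight (element cores i) ℚ.* (+ size (proj₁ (element cores i)) / 1))
    where open Sumℚ using (sum-syntax)

  totalWeight≢0 : ℚ.NonZero totalWeight
  totalWeight≢0 = ℚ.pos⇒nonZero totalWeight {{sum-positive (card cores)
      {{inhabited⇒nonZero cores ∅-biCore}} (weight ∘ element cores)
      (λ i → let x = element cores i in
             ℚ.normalize-pos 1 (card (stabs x))
               {{inhabited⇒nonZero (stabs x) (id∈Stab (asCore x))}})}}

{-# OPTIONS --safe #-}

-- Let b_k be the first gap congruent to k s modulo t of the beta-set of an (s,t)-core λ.
-- Reading the s-set modulo t gives a word of s letters in ℤ/t, and
-- b_k + s − b_{k+1} = t · #{letters equal to k}.  Hence the content of the word determines λ;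
-- conversely every word yields a bead set closed under subtracting s and t, which becomes
-- the beta-set of an (s,t)-core after a translation, and translations rotate the letters.
-- The stabilizer of λ is the group of permutations of the positions preserving its word, so λ
-- arises from t · s! / |Stab λ| of the t^s words: the weighted average in question is the
-- average of |λ| over uniformly random words.  Finally 2t²|λ| equals t Σ b_k² − (Σ b_k)² up to
-- a constant, and each b_k is a sum of contributions of the independent letters, so that only
-- the second moments of single letters are needed.

module Submission where

open import Defs
import Algebra.Properties.AbelianGroup as AbelianGroup
import Algebra.Properties.Semiring.Sum as SemiringSum
open import Algebra.Bundles using (CommutativeRing)
open import Data.Empty using (⊥)
open import Data.Fin.Base using
  (Fin; zero; suc; toℕ; fromℕ<; combine; remQuot; _↑ˡ_; _↑ʳ_; punchOut)
open import Data.Fin.Permutation using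
  (Permutation′; permutation; _⟨$⟩ʳ_; _⟨$⟩ˡ_; inverseˡ; inverseʳ)
open import Data.Fin.Properties as Fin using
  (_≟_; any?; all?; suc-injective; remQuot-combine; combine-remQuot; pigeonhole; punchOut-injective;
   toℕ-injective; toℕ-inject₁; toℕ-fromℕ; toℕ-fromℕ<; toℕ<n; toℕ-combine)
open import Data.Integer.Base using
  (ℤ; +_; -[1+_]; _+_; _*_; _-_; -_; _^_; 0ℤ; 1ℤ; _%ℕ_; _/ℕ_; _<_; _≤_; ∣_∣; +≤+; +<+; -<+; -≤+; -≤-)
  renaming (NonZero to ℤNonZero)
import Data.Integer.Divisibility as ∣
import Data.Integer.Divisibility.Signed as Signed
open import Data.Integer.DivMod using (n%ℕd<d; a≡a%ℕn+[a/ℕn]*n)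
import Data.Integer.Properties as ℤ
open import Data.Integer.Tactic.RingSolver using (solve-∀)
open import Data.List.Base using (length; filter; applyUpTo)
open import Data.List.Properties using (filter-accept; filter-reject)
open import Data.Nat.Base as ℕ using (ℕ; zero; suc; z≤n; s≤s; NonZero)
open import Data.Nat.Combinatorics using (_C_)
open import Data.Nat.Coprimality using (Coprime; coprime-Bézout)
open import Data.Nat.GCD using (module Bézout)
open import Data.Nat.Induction using (<-rec)
import Data.Nat.Properties as ℕ
open import Data.Product.Base using (Σ-syntax; ∃; _×_; _,_; proj₁; proj₂)
open import Data.Rational.Base as ℚ using (ℚ; _/_; _÷_; toℚᵘ; 1ℚ)
import Data.Rational.Properties as ℚ
import Data.Rational.Unnormalised.Base as ℚᵘ
import Data.Rational.Unnormalised.Properties as ℚᵘ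
open import Data.Sum.Base using (_⊎_; inj₁; inj₂)
open import Data.Vec.Base using (Vec; []; _∷_; lookup; map; tabulate)
open import Data.Vec.Properties using
  (lookup∘tabulate; tabulate∘lookup; tabulate-cong; lookup-map; ≡-dec)
open import Function.Base using (_∘_; _$_)
open import Function.Bundles using (Inverse; mk↔ₛ′)
open import Level using (0ℓ)
open import Relation.Binary.Bundles using (Setoid)
open import Relation.Binary.Definitions using (Tri; tri<; tri≈; tri>)
open import Relation.Binary.PropositionalEquality
open import Relation.Nullary using (Dec; yes; no; ¬_; contradiction; _×-dec_)
open import Relation.Nullary.Decidable using (_→-dec_)

open AbelianGroup ℤ.+-0-abelianGroup using (∙-cancelˡ; ∙-cancelʳ)
open SemiringSum ℤ.+-*-semiring using
  (sum; sum-cong-≗; ∑-distrib-+; ∑-comm; sum-permute; *-distribˡ-sum; *-distribʳ-sum;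
   sum-replicate-zero; sum-init-last)


-- The weights are handled without dividing by orbit sizes, by counting pairs. Matchings between two
-- words of length s are the permutations of positions that preserve letters; their number is a
-- product of differences of contents, so it depends on the contents only. Summed over the t
-- rotations of the word of λ and over all words, matchings number t · s! when sorted by the
-- permutation, and |Stab λ| times the number of words yielding λ when sorted by the word. The
-- second count needs the t rotations to have different contents. This holds because rotations come
-- from translations of bead sets, and no nontrivial translate of a beta-set is a beta-set.
--
-- The expression t Σ b_k² - (Σ b_k)² is unchanged when all b_k move by the same amount, so it may
-- be computed on the bead set of a word before its translation into a beta-set. There b_k = k s + t
-- · (number of letters ≥ k), so a letter l contributes k + t [k ≤ l], which has mean t. Centring
-- the letters is one more translation.

private variable
  P P′ : Set
  m n N : ℕ

-- Indicators and finite sums of integers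

⟦_⟧ : Dec P → ℤ
⟦ yes _ ⟧ = 1ℤ
⟦ no  _ ⟧ = 0ℤ

⟦⟧-yes : (d : Dec P) → P → ⟦ d ⟧ ≡ 1ℤ
⟦⟧-yes (yes _) _ = refl
⟦⟧-yes (no ¬p) p = contradiction p ¬p

⟦⟧-no : (d : Dec P) → ¬ P → ⟦ d ⟧ ≡ 0ℤ
⟦⟧-no (yes p) ¬p = contradiction p ¬p
⟦⟧-no (no _)  _  = refl

⟦⟧-cong : (d : Dec P) (e : Dec P′) → (P → P′) → (P′ → P) → ⟦ d ⟧ ≡ ⟦ e ⟧
⟦⟧-cong (yes p) e f _ = sym (⟦⟧-yes e (f p))
⟦⟧-cong (no ¬p) e _ g = sym (⟦⟧-no e (¬p ∘ g))

sum-zero : (f : Fin n → ℤ) → (∀ i → f i ≡ 0ℤ) → sum f ≡ 0ℤ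
sum-zero {n} f f≡0 = trans (sum-cong-≗ f≡0) (sum-replicate-zero n)

sum-const : ∀ n x → sum {n} (λ _ → x) ≡ + n * x
sum-const zero    x = refl
sum-const (suc n) x = trans (cong (_+_ x) (sum-const n x)) (sym (ℤ.suc-* (+ n) x))

sum-single : (f : Fin n → ℤ) (i : Fin n) → (∀ j → j ≢ i → f j ≡ 0ℤ) → sum f ≡ f i
sum-single {suc n} f zero    off = begin
  f zero + sum (f ∘ suc)  ≡⟨ cong (_+_ (f zero)) (sum-zero (f ∘ suc) (λ j → off (suc j) λ ())) ⟩
  f zero + 0ℤ             ≡⟨ ℤ.+-identityʳ (f zero) ⟩
  f zero                  ∎
  where open ≡-Reasoning
sum-single {suc n} f (suc i) off = begin
  f zero + sum (f ∘ suc)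
    ≡⟨ cong₂ _+_ (off zero λ ()) (sum-single (f ∘ suc) i (λ j j≢i → off (suc j) (j≢i ∘ suc-injective))) ⟩
  0ℤ + f (suc i)          ≡⟨ ℤ.+-identityˡ (f (suc i)) ⟩
  f (suc i)               ∎
  where open ≡-Reasoning

sum-unique : {R : Fin n → Set} (R? : ∀ i → Dec (R i)) (i : Fin n) → R i →
             (∀ j → R j → j ≡ i) → sum (λ j → ⟦ R? j ⟧) ≡ 1ℤ
sum-unique R? i r unique =
  trans (sum-single _ i (λ j j≢i → ⟦⟧-no (R? j) (j≢i ∘ unique j))) (⟦⟧-yes (R? i) r)

sum-- : (f g : Fin n → ℤ) → sum (λ i → f i - g i) ≡ sum f - sum g
sum-- {zero}  f g = refl
sum-- {suc n} f g =
  trans (cong (_+_ (f zero - g zero)) (sum-- (f ∘ suc) (g ∘ suc)))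
        (rearrange (f zero) (g zero) (sum (f ∘ suc)) (sum (g ∘ suc)))
  where
  rearrange : ∀ a b c d → a - b + (c - d) ≡ a + c - (b + d)
  rearrange = solve-∀

-- Double counting of the pairs (k, i) with `φ k ≡ i`: each k lies in exactly one pair, and so does
-- each i satisfying `R`.
count-bij : {R : Fin n → Set} (R? : ∀ i → Dec (R i)) (φ : Fin m → Fin n) →
            (∀ k l → φ k ≡ φ l → k ≡ l) → (∀ k → R (φ k)) → (∀ i → R i → ∃ λ k → φ k ≡ i) →
            sum (λ i → ⟦ R? i ⟧) ≡ + m
count-bij {n} {m} {R} R? φ inj R-φ onto = begin
  sum (λ i → ⟦ R? i ⟧)
    ≡⟨ sum-cong-≗ (λ i → sym (fibre i (R? i))) ⟩
  sum (λ i → sum (λ k → ⟦ φ k ≟ i ⟧))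
    ≡⟨ ∑-comm (λ i k → ⟦ φ k ≟ i ⟧) ⟩
  sum (λ k → sum (λ i → ⟦ φ k ≟ i ⟧))
    ≡⟨ sum-cong-≗ (λ k → sum-unique (φ k ≟_) (φ k) refl (λ _ → sym)) ⟩
  sum {m} (λ _ → 1ℤ)
    ≡⟨ sum-const m 1ℤ ⟩
  + m * 1ℤ
    ≡⟨ ℤ.*-identityʳ (+ m) ⟩
  + m ∎
  where
  open ≡-Reasoning
  fibre : ∀ i (d : Dec (R i)) → sum (λ k → ⟦ φ k ≟ i ⟧) ≡ ⟦ d ⟧
  fibre i (yes r) with onto i r
  ... | k , refl = sum-unique (λ l → φ l ≟ φ k) k refl (λ l → inj l k)
  fibre i (no ¬r) = sum-zero _ (λ k → ⟦⟧-no (φ k ≟ i) (λ { refl → ¬r (R-φ k) }))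

sum-splitAt : ∀ m (f : Fin (m ℕ.+ n) → ℤ) →
              sum f ≡ sum (λ i → f (i ↑ˡ n)) + sum (λ j → f (m ↑ʳ j))
sum-splitAt zero    f = sym (ℤ.+-identityˡ _)
sum-splitAt (suc m) f =
  trans (cong (_+_ (f zero)) (sum-splitAt m (f ∘ suc))) (sym (ℤ.+-assoc (f zero) _ _))

sum-combine : ∀ m n (f : Fin (m ℕ.* n) → ℤ) →
              sum f ≡ sum (λ i → sum (λ j → f (combine {m} {n} i j)))
sum-combine zero    n f = refl
sum-combine (suc m) n f =
  trans (sum-splitAt n f) (cong (_+_ (sum (λ j → f (j ↑ˡ (m ℕ.* n))))) (sum-combine m n (f ∘ (n ↑ʳ_))))

-- Words

-- Words are numbered by `Fin (m ^ n)`, so that a sum over words is a sum over `Fin` and can be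
-- interchanged with other sums by `∑-comm`.
word : ∀ m n → Fin (m ℕ.^ n) → Vec (Fin m) n
word m zero    _ = []
word m (suc n) a = proj₁ (remQuot {m} (m ℕ.^ n) a) ∷ word m n (proj₂ (remQuot {m} (m ℕ.^ n) a))

index : Vec (Fin m) n → Fin (m ℕ.^ n)
index []      = zero
index (j ∷ w) = combine j (index w)

word-index : ∀ (w : Vec (Fin m) n) → word m n (index w) ≡ w
word-index []      = refl
word-index {m} {suc n} (j ∷ w) = trans
  (cong (λ (k , b) → k ∷ word m n b) (remQuot-combine {m} {m ℕ.^ n} j (index w)))
  (cong (j ∷_) (word-index w))

index-word : ∀ m n (a : Fin (m ℕ.^ n)) → index (word m n a) ≡ a
index-word m zero    zero = refl
index-word m (suc n) a =
  trans (cong (combine (proj₁ (remQuot {m} (m ℕ.^ n) a))) (index-word m n _))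
        (combine-remQuot {m} (m ℕ.^ n) a)

∑ʷ : ∀ m n → (Vec (Fin m) n → ℤ) → ℤ
∑ʷ m n F = sum (λ a → F (word m n a))

∑ʷ-suc : ∀ m n F → ∑ʷ m (suc n) F ≡ sum (λ j → ∑ʷ m n (λ w → F (j ∷ w)))
∑ʷ-suc m n F = trans (sum-combine m (m ℕ.^ n) _)
  (sum-cong-≗ λ j → sum-cong-≗ λ a → cong (λ (k , b) → F (k ∷ word m n b)) (remQuot-combine {m} j a))

∑ʷ-single : ∀ F (w : Vec (Fin m) n) → (∀ v → v ≢ w → F v ≡ 0ℤ) → ∑ʷ m n F ≡ F w
∑ʷ-single {m} {n} F w off =
  trans (sum-single _ (index w) (λ a a≢ → off (word m n a)
          (λ eq → a≢ (trans (sym (index-word m n a)) (cong index eq)))))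
        (cong F (word-index w))

∑ʷ-const : ∀ m n x → ∑ʷ m n (λ _ → x) ≡ + (m ℕ.^ n) * x
∑ʷ-const m n x = sum-const (m ℕ.^ n) x

-- Decidable subsets of Fin n

-- Since `rank-select` ranges over all proofs `r`, a rank depends on the element alone, even where
-- `R` has several proofs.
record Selection {R : Fin n → Set} (R? : ∀ i → Dec (R i)) : Set where
  field
    count     : ℕ
    count≡    : + count ≡ sum (λ i → ⟦ R? i ⟧)
    select   : Fin count → Fin n
    selected : ∀ k → R (select k)
    rank     : ∀ i → R i → Fin count
    select-rank : ∀ i r → select (rank i r) ≡ i
    rank-select : ∀ k r → rank (select k) r ≡ k

selection : {R : Fin n → Set} (R? : ∀ i → Dec (R i)) → Selection R?
selection {zero}  R? = record
  { count = 0 ; count≡ = refl ; select = λ () ; selected = λ () ; rank = λ ()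
  ; select-rank = λ () ; rank-select = λ () }
selection {suc n} {R} R? = extend (R? zero)
  where
  module S = Selection (selection (R? ∘ suc))
  count′ : Dec (R zero) → ℕ
  count′ (yes _) = suc S.count
  count′ (no _)  = S.count
  select′ : (d : Dec (R zero)) → Fin (count′ d) → Fin (suc n)
  select′ (yes _) zero    = zero
  select′ (yes _) (suc k) = suc (S.select k)
  select′ (no _)  k       = suc (S.select k)
  rank′ : (d : Dec (R zero)) → ∀ i → R i → Fin (count′ d)
  rank′ (yes _) zero    _ = zero
  rank′ (yes _) (suc i) r = suc (S.rank i r)
  rank′ (no ¬r) zero    r = contradiction r ¬r
  rank′ (no _)  (suc i) r = S.rank i r
  extend : Dec (R zero) → Selection R?
  extend d = record
    { count = count′ d
    ; count≡ = count-eq d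
    ; select = select′ d
    ; selected = sel d
    ; rank = rank′ d
    ; select-rank = s-r d
    ; rank-select = r-s d }
    where
    count-eq : ∀ d → + count′ d ≡ sum (λ i → ⟦ R? i ⟧)
    count-eq (yes r) = cong₂ _+_ (sym (⟦⟧-yes (R? zero) r)) S.count≡
    count-eq (no ¬r) = trans S.count≡
      (trans (sym (ℤ.+-identityˡ _)) (cong (_+ sum (λ i → ⟦ R? (suc i) ⟧)) (sym (⟦⟧-no (R? zero) ¬r))))
    sel : ∀ d k → R (select′ d k)
    sel (yes r) zero    = r
    sel (yes _) (suc k) = S.selected k
    sel (no _)  k       = S.selected k
    s-r : ∀ d i r → select′ d (rank′ d i r) ≡ i
    s-r (yes _) zero    r = refl
    s-r (yes _) (suc i) r = cong suc (S.select-rank i r)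
    s-r (no ¬r) zero    r = contradiction r ¬r
    s-r (no _)  (suc i) r = cong suc (S.select-rank i r)
    r-s : ∀ d k r → rank′ d (select′ d k) r ≡ k
    r-s (yes _) zero    r = refl
    r-s (yes _) (suc k) r = cong suc (S.rank-select k r)
    r-s (no _)  k       r = S.rank-select k r

-- Colour-preserving injections

content : Vec (Fin m) n → Fin m → ℤ
content w j = sum (λ i → ⟦ lookup w i ≟ j ⟧)

Distinct : Vec (Fin m) n → Set
Distinct σ = ∀ k l → lookup σ k ≡ lookup σ l → k ≡ l

-- A matching is an injection of the positions of `c` into those of `d` that preserves letters. It
-- is itself a word, over the alphabet of positions, so that `∑ʷ` counts matchings too.
Matching : Vec (Fin m) n → Vec (Fin m) N → Vec (Fin N) n → Set
Matching c d σ = Distinct σ × (∀ k → lookup d (lookup σ k) ≡ lookup c k)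

abstract
  distinct? : (σ : Vec (Fin m) n) → Dec (Distinct σ)
  distinct? σ = all? λ k → all? λ l → (lookup σ k ≟ lookup σ l) →-dec (k ≟ l)

  matching? : (c : Vec (Fin m) n) (d : Vec (Fin m) N) (σ : Vec (Fin N) n) → Dec (Matching c d σ)
  matching? c d σ = distinct? σ ×-dec all? λ k → lookup d (lookup σ k) ≟ lookup c k

matchings : Vec (Fin m) n → Vec (Fin m) N → ℤ
matchings {n = n} {N} c d = ∑ʷ N n (λ σ → ⟦ matching? c d σ ⟧)

module _ (c : Vec (Fin m) n) (d : Vec (Fin m) N) where
  private
    tail-matching : ∀ {i j σ} → Matching (j ∷ c) d (i ∷ σ) → Matching c d σ
    tail-matching (inj , col) =
      (λ k l eq → suc-injective (inj (suc k) (suc l) eq)) , (λ k → col (suc k))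

    -- Once σ is a matching, position i is available for the new letter iff `d` carries j there and
    -- σ avoids i. As σ is injective, the inner sum has at most one nonzero term, which makes the
    -- factor an indicator.
    matching-∷ : ∀ i j σ → ⟦ matching? (j ∷ c) d (i ∷ σ) ⟧ ≡
      ⟦ matching? c d σ ⟧ * (⟦ lookup d i ≟ j ⟧ - sum (λ k → ⟦ lookup σ k ≟ i ⟧ * ⟦ lookup d i ≟ j ⟧))
    matching-∷ i j σ with matching? c d σ
    ... | no ¬m = trans (⟦⟧-no (matching? (j ∷ c) d (i ∷ σ)) (¬m ∘ tail-matching))
                        (sym (ℤ.*-zeroˡ (⟦ lookup d i ≟ j ⟧ - sum (λ k → ⟦ lookup σ k ≟ i ⟧ * ⟦ lookup d i ≟ j ⟧))))
    ... | yes (inj , col) with any? (λ k → lookup σ k ≟ i)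
    ...   | yes (k , refl) = trans
      (⟦⟧-no (matching? (j ∷ c) d (i ∷ σ)) (λ (inj′ , _) → contradiction (inj′ zero (suc k) refl) λ ()))
      (sym (trans (ℤ.*-identityˡ _) (trans (cong (λ z → ⟦ lookup d i ≟ j ⟧ - z) one) (ℤ.+-inverseʳ ⟦ lookup d i ≟ j ⟧))))
      where
      one : sum (λ l → ⟦ lookup σ l ≟ i ⟧ * ⟦ lookup d i ≟ j ⟧) ≡ ⟦ lookup d i ≟ j ⟧
      one = trans (sym (*-distribʳ-sum ⟦ lookup d i ≟ j ⟧ (λ l → ⟦ lookup σ l ≟ i ⟧)))
        (trans (cong (_* ⟦ lookup d i ≟ j ⟧) (sum-unique (λ l → lookup σ l ≟ i) k refl (λ l → inj l k)))
               (ℤ.*-identityˡ _))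
    ...   | no i∉σ = trans
      (⟦⟧-cong (matching? (j ∷ c) d (i ∷ σ)) (lookup d i ≟ j) (λ (_ , col′) → col′ zero)
        (λ eq → inj″ , λ { zero → eq ; (suc k) → col k }))
      (sym (trans (ℤ.*-identityˡ _) (trans (cong (λ z → ⟦ lookup d i ≟ j ⟧ - z)
        (sum-zero _ λ k → trans (cong (_* ⟦ lookup d i ≟ j ⟧) (⟦⟧-no (lookup σ k ≟ i) (λ eq → i∉σ (k , eq))))
                                (ℤ.*-zeroˡ ⟦ lookup d i ≟ j ⟧)))
        (ℤ.+-identityʳ ⟦ lookup d i ≟ j ⟧))))
      where
      inj″ : Distinct (i ∷ σ)
      inj″ zero    zero    _  = refl
      inj″ zero    (suc l) eq = contradiction (l , sym eq) i∉σ
      inj″ (suc k) zero    eq = contradiction (k , eq) i∉σ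
      inj″ (suc k) (suc l) eq = cong suc (inj k l eq)

    -- This removes the dependence on σ: the letters j of `d` that are already occupied are the
    -- images of the letters j of `c`.
    used : ∀ j σ → ⟦ matching? c d σ ⟧ * sum (λ k → ⟦ lookup d (lookup σ k) ≟ j ⟧) ≡
                   ⟦ matching? c d σ ⟧ * content c j
    used j σ with matching? c d σ
    ... | no _ = trans (ℤ.*-zeroˡ (sum (λ k → ⟦ lookup d (lookup σ k) ≟ j ⟧))) (sym (ℤ.*-zeroˡ (content c j)))
    ... | yes (_ , col) = cong (1ℤ *_) (sum-cong-≗ λ k →
          ⟦⟧-cong (lookup d (lookup σ k) ≟ j) (lookup c k ≟ j) (trans (sym (col k))) (trans (col k)))

  -- Extending a matching by one letter j: the content c j letters of d already
  -- used are excluded.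
  matchings-∷ : ∀ j → matchings (j ∷ c) d ≡ matchings c d * (content d j - content c j)
  matchings-∷ j = begin
    matchings (j ∷ c) d
      ≡⟨ ∑ʷ-suc N n (λ σ → ⟦ matching? (j ∷ c) d σ ⟧) ⟩
    sum (λ i → sum (λ a → ⟦ matching? (j ∷ c) d (i ∷ W a) ⟧))
      ≡⟨ ∑-comm (λ i a → ⟦ matching? (j ∷ c) d (i ∷ W a) ⟧) ⟩
    sum (λ a → sum (λ i → ⟦ matching? (j ∷ c) d (i ∷ W a) ⟧))
      ≡⟨ sum-cong-≗ (λ a → inner (W a)) ⟩
    sum (λ a → ⟦ matching? c d (W a) ⟧ * (content d j - content c j))
      ≡⟨ sym (*-distribʳ-sum (content d j - content c j) (λ a → ⟦ matching? c d (W a) ⟧)) ⟩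
    matchings c d * (content d j - content c j) ∎
    where
    open ≡-Reasoning
    W = word N n
    inner : ∀ σ → sum (λ i → ⟦ matching? (j ∷ c) d (i ∷ σ) ⟧) ≡ ⟦ matching? c d σ ⟧ * (content d j - content c j)
    inner σ = begin
      sum (λ i → ⟦ matching? (j ∷ c) d (i ∷ σ) ⟧)
        ≡⟨ sum-cong-≗ (λ i → matching-∷ i j σ) ⟩
      sum (λ i → M * (D i - sum (λ k → E k i * D i)))
        ≡⟨ sym (*-distribˡ-sum M (λ i → D i - sum (λ k → E k i * D i))) ⟩
      M * sum (λ i → D i - sum (λ k → E k i * D i))
        ≡⟨ cong (M *_) (sum-- D (λ i → sum (λ k → E k i * D i))) ⟩
      M * (content d j - sum (λ i → sum (λ k → E k i * D i)))
        ≡⟨ cong (λ z → M * (content d j - z)) (trans (∑-comm (λ i k → E k i * D i)) (sum-cong-≗ pick)) ⟩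
      M * (content d j - sum (λ k → D (lookup σ k)))
        ≡⟨ distrib M (content d j) _ ⟩
      M * content d j - M * sum (λ k → D (lookup σ k))
        ≡⟨ cong (λ z → M * content d j - z) (used j σ) ⟩
      M * content d j - M * content c j
        ≡⟨ sym (distrib M (content d j) _) ⟩
      M * (content d j - content c j) ∎
      where
      M = ⟦ matching? c d σ ⟧
      D : Fin N → ℤ
      D i = ⟦ lookup d i ≟ j ⟧
      E : Fin n → Fin N → ℤ
      E k i = ⟦ lookup σ k ≟ i ⟧
      pick : ∀ k → sum (λ i → E k i * D i) ≡ D (lookup σ k)
      pick k = trans (sum-single _ (lookup σ k) (λ i i≢ →
          trans (cong (_* D i) (⟦⟧-no (lookup σ k ≟ i) (i≢ ∘ sym))) (ℤ.*-zeroˡ (D i))))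
        (trans (cong (_* D (lookup σ k)) (⟦⟧-yes (lookup σ k ≟ lookup σ k) refl)) (ℤ.*-identityˡ _))
      distrib : ∀ a b c → a * (b - c) ≡ a * b - a * c
      distrib = solve-∀

-- By `matchings-∷` the count is a product of differences of contents; no bijection between the two
-- sets of matchings has to be built.
matchings-content : ∀ (c : Vec (Fin m) n) (d d′ : Vec (Fin m) N) → (∀ j → content d j ≡ content d′ j) →
                    matchings c d ≡ matchings c d′
matchings-content []      d d′ eq = sum-cong-≗ λ a →
  ⟦⟧-cong (matching? [] d (word _ 0 a)) (matching? [] d′ (word _ 0 a))
          (λ (inj , _) → inj , λ ()) (λ (inj , _) → inj , λ ())
matchings-content (j ∷ c) d d′ eq = begin
  matchings (j ∷ c) d                          ≡⟨ matchings-∷ c d j ⟩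
  matchings c d * (content d j - content c j)
    ≡⟨ cong₂ (λ x y → x * (y - content c j)) (matchings-content c d d′ eq) (eq j) ⟩
  matchings c d′ * (content d′ j - content c j) ≡⟨ sym (matchings-∷ c d′ j) ⟩
  matchings (j ∷ c) d′                         ∎
  where open ≡-Reasoning

injective⇒onto : (f : Fin n → Fin n) → (∀ k l → f k ≡ f l → k ≡ l) → ∀ j → ∃ λ i → f i ≡ j
injective⇒onto {suc n} f inj j with any? (λ i → f i ≟ j)
... | yes p = p
... | no j∉f with pigeonhole (ℕ.n<1+n n) (λ i → punchOut {i = j} (λ eq → j∉f (i , sym eq)))
...   | i , k , i<k , eq = contradiction (inj i k (punchOut-injective (λ eq → j∉f (i , sym eq)) (λ eq → j∉f (k , sym eq)) eq)) (Fin.<⇒≢ i<k)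

distinct⇒permutation : (σ : Vec (Fin n) n) → Distinct σ → Permutation′ n
distinct⇒permutation σ inj = permutation (lookup σ) (λ j → proj₁ (onto j))
  (λ j → proj₂ (onto j)) (λ i → inj _ _ (proj₂ (onto (lookup σ i))))
  where onto = injective⇒onto (lookup σ) inj

-- For words of equal length an injective σ is a permutation, along which the count of each letter
-- of `d` is reindexed.
matching⇒content : (c d : Vec (Fin m) n) (σ : Vec (Fin n) n) → Matching c d σ → ∀ j → content c j ≡ content d j
matching⇒content c d σ (inj , col) j = sym (trans
  (sum-permute (λ i → ⟦ lookup d i ≟ j ⟧) (distinct⇒permutation σ inj))
  (sum-cong-≗ λ k → ⟦⟧-cong (lookup d (lookup σ k) ≟ j) (lookup c k ≟ j) (trans (sym (col k))) (trans (col k))))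

matchings-off-content : (c d : Vec (Fin m) n) → ¬ (∀ j → content c j ≡ content d j) → matchings c d ≡ 0ℤ
matchings-off-content c d c≉d = sum-zero _ λ a →
  ⟦⟧-no (matching? c d (word _ _ a)) (c≉d ∘ matching⇒content c d (word _ _ a))

-- The factorial of n. It enters only as a constant common to all cores and is left unevaluated.
permutations : ℕ → ℤ
permutations n = ∑ʷ n n (λ σ → ⟦ distinct? σ ⟧)

-- Counting by σ first: an injective σ is a permutation, and it matches `c` with exactly one word,
-- the transport of `c` along σ.
∑-matchings : (c : Vec (Fin m) n) → ∑ʷ m n (λ d → matchings c d) ≡ permutations n
∑-matchings {m} {n} c = trans (∑-comm (λ a b → ⟦ matching? c (word m n a) (word n n b) ⟧))
  (sum-cong-≗ λ b → pull (word n n b))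
  where
  pull : ∀ σ → ∑ʷ m n (λ d → ⟦ matching? c d σ ⟧) ≡ ⟦ distinct? σ ⟧
  pull σ with distinct? σ
  ... | no ¬inj = sum-zero (λ a → ⟦ matching? c (word m n a) σ ⟧)
                    λ a → ⟦⟧-no (matching? c (word m n a) σ) (¬inj ∘ proj₁)
  ... | yes inj = trans
    (∑ʷ-single (λ d → ⟦ matching? c d σ ⟧) d₀ λ d d≢ → ⟦⟧-no (matching? c d σ) (d≢ ∘ unique d))
    (⟦⟧-yes (matching? c d₀ σ) (inj , λ k →
      trans (lookup∘tabulate (λ i → lookup c (π ⟨$⟩ˡ i)) (lookup σ k)) (cong (lookup c) (inverseˡ π {k}))))
    where
    π = distinct⇒permutation σ inj
    d₀ = tabulate (λ i → lookup c (π ⟨$⟩ˡ i))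
    unique : ∀ d → Matching c d σ → d ≡ d₀
    unique d (_ , col) = trans (sym (tabulate∘lookup d)) (tabulate-cong λ i →
      trans (cong (lookup d) (sym (inverseʳ π))) (col (π ⟨$⟩ˡ i)))

-- Congruences

infix 4 _≈[_]_

-- The quotient is a field so that congruences reduce to ring identities; its sign tells on which
-- side of y the number x lies.
record _≈[_]_ (x : ℤ) (n : ℕ) (y : ℤ) : Set where
  constructor modulo
  field
    quotient : ℤ
    equality : x ≡ y + quotient * + n

module _ {n : ℕ} where

  ≈-reflexive : ∀ {x y} → x ≡ y → x ≈[ n ] y
  ≈-reflexive {x} refl = modulo 0ℤ $ sym (ℤ.+-identityʳ x)

  ≈-refl : ∀ {x} → x ≈[ n ] x
  ≈-refl = ≈-reflexive refl

  ≈-sym : ∀ {x y} → x ≈[ n ] y → y ≈[ n ] x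
  ≈-sym {y = y} (modulo q refl) = modulo (- q) $ ring y q (+ n)
    where
    ring : ∀ y q n → y ≡ y + q * n + - q * n
    ring = solve-∀

  ≈-trans : ∀ {x y z} → x ≈[ n ] y → y ≈[ n ] z → x ≈[ n ] z
  ≈-trans {z = z} (modulo q refl) (modulo r refl) = modulo (r + q) $ ring z r q (+ n)
    where
    ring : ∀ z r q n → z + r * n + q * n ≡ z + (r + q) * n
    ring = solve-∀

  ≈-+ : ∀ {x y a b} → x ≈[ n ] y → a ≈[ n ] b → x + a ≈[ n ] y + b
  ≈-+ {y = y} {b = b} (modulo q refl) (modulo r refl) = modulo (q + r) $ ring y b q r (+ n)
    where
    ring : ∀ y b q r n → y + q * n + (b + r * n) ≡ y + b + (q + r) * n
    ring = solve-∀

  ≈-- : ∀ {x y a b} → x ≈[ n ] y → a ≈[ n ] b → x - a ≈[ n ] y - b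
  ≈-- {y = y} {b = b} (modulo q refl) (modulo r refl) = modulo (q - r) $ ring y b q r (+ n)
    where
    ring : ∀ y b q r n → y + q * n - (b + r * n) ≡ y - b + (q - r) * n
    ring = solve-∀

  ≈-* : ∀ {x y} k → x ≈[ n ] y → x * k ≈[ n ] y * k
  ≈-* {y = y} k (modulo q refl) = modulo (q * k) $ ring y k q (+ n)
    where
    ring : ∀ y k q n → (y + q * n) * k ≡ y * k + q * k * n
    ring = solve-∀

  ≈-∣ : ∀ {x y} → x ≈[ n ] y → + n ∣.∣ x - y
  ≈-∣ {y = y} (modulo q refl) = Signed.∣⇒∣ᵤ (Signed.divides q (ring y q (+ n)))
    where
    ring : ∀ y q n → y + q * n - y ≡ q * n
    ring = solve-∀

  ∣-≈ : ∀ {x y} → + n ∣.∣ x - y → x ≈[ n ] y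
  ∣-≈ {x} {y} d with Signed.∣ᵤ⇒∣ d
  ... | Signed.divides q eq = modulo q $ trans (ring x y) (cong (_+_ y) eq)
    where
    ring : ∀ x y → x ≡ y + (x - y)
    ring = solve-∀

  ≈-split : ∀ {x y} → x ≈[ n ] y →
            (∃ λ k → x ≡ y + + k * + n) ⊎ (∃ λ k → x ≡ y - + suc k * + n)
  ≈-split (modulo (+ k) eq) = inj₁ (k , eq)
  ≈-split {y = y} (modulo -[1+ k ] eq) = inj₂ (k , trans eq (cong (_+_ y) (sym (ℤ.neg-distribˡ-* (+ suc k) (+ n)))))

module _ (n : ℕ) .{{_ : ℕ.NonZero n}} where

  abstract
    residue : ℤ → Fin n
    residue x = fromℕ< (n%ℕd<d x n)

    residue-≈ : ∀ x → x ≈[ n ] + toℕ (residue x)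
    residue-≈ x = modulo (x /ℕ n) $ trans (a≡a%ℕn+[a/ℕn]*n x n)
      (cong (λ r → + r + (x /ℕ n) * + n) (sym (toℕ-fromℕ< (n%ℕd<d x n))))

  private
    too-large : ∀ (i : Fin n) y k → ¬ (+ toℕ i ≡ + y + + suc k * + n)
    too-large i y k eq = ℕ.<⇒≱ (toℕ<n i) (begin
      n                   ≤⟨ ℕ.m≤m+n n (k ℕ.* n) ⟩
      suc k ℕ.* n         ≤⟨ ℕ.m≤n+m _ y ⟩
      y ℕ.+ suc k ℕ.* n   ≡⟨ ℤ.+-injective (trans (cong (_+_ (+ y)) (ℤ.pos-* (suc k) n)) (sym eq)) ⟩
      toℕ i               ∎)
      where open ℕ.≤-Reasoning

  toℕ-≈⇒≡ : ∀ {i j : Fin n} → + toℕ i ≈[ n ] + toℕ j → i ≡ j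
  toℕ-≈⇒≡ {i} {j} i≈j with ≈-split i≈j
  ... | inj₁ (zero , eq)  = toℕ-injective (ℤ.+-injective (trans eq (ℤ.+-identityʳ _)))
  ... | inj₁ (suc k , eq) = contradiction eq (too-large i (toℕ j) k)
  ... | inj₂ (k , eq)     = contradiction (trans (ring (+ toℕ j) (+ suc k * + n)) (cong (_+ + suc k * + n) (sym eq))) (too-large j (toℕ i) k)
    where
    ring : ∀ j m → j ≡ j - m + m
    ring = solve-∀

  residue-cong : ∀ {x y} → x ≈[ n ] y → residue x ≡ residue y
  residue-cong {x} {y} x≈y = toℕ-≈⇒≡ (≈-trans (≈-sym (residue-≈ x)) (≈-trans x≈y (residue-≈ y)))

  residue-≈⁻ : ∀ {x y} → residue x ≡ residue y → x ≈[ n ] y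
  residue-≈⁻ {x} {y} eq =
    ≈-trans (residue-≈ x) (≈-trans (≈-reflexive (cong (+_ ∘ toℕ) eq)) (≈-sym (residue-≈ y)))

  residue-toℕ : ∀ i → residue (+ toℕ i) ≡ i
  residue-toℕ i = toℕ-≈⇒≡ (≈-sym (residue-≈ (+ toℕ i)))

-- Sets of integers closed under subtraction

Closed : ℕ → (ℤ → Set) → Set
Closed n B = ∀ x → B x → B (x - + n)

-- For closed `B`, the residue class of such a g modulo n is filled below g and empty from g on: g
-- is the first gap of its class.
IsGap : ℕ → (ℤ → Set) → ℤ → Set
IsGap n B g = ¬ B g × B (g - + n)

module _ {n : ℕ} {B : ℤ → Set} (closed : Closed n B) where

  closed-* : ∀ k {x} → B x → B (x - + k * + n)
  closed-* zero    {x} b = subst B (sym (ℤ.+-identityʳ x)) b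
  closed-* (suc k) {x} b = subst B (trans (ring x (+ k) (+ n)) (cong (λ z → x - z * + n) (sym (ℤ.pos-+ 1 k))))
                             (closed _ (closed-* k b))
    where
    ring : ∀ x k n → x - k * n - n ≡ x - (1ℤ + k) * n
    ring = solve-∀

  module _ {g : ℤ} (gap : IsGap n B g) where

    above-gap : ∀ {x} k → x ≡ g + + k * + n → ¬ B x
    above-gap k refl b = proj₁ gap (subst B (ring g (+ k * + n)) (closed-* k b))
      where
      ring : ∀ g m → g + m - m ≡ g
      ring = solve-∀

    below-gap : ∀ {x} k → x ≡ g - + suc k * + n → B x
    below-gap k refl = subst B (trans (ring g (+ k) (+ n)) (cong (λ z → g - z * + n) (sym (ℤ.pos-+ 1 k))))
                         (closed-* k (proj₂ gap))
      where
      ring : ∀ g k n → g - n - k * n ≡ g - (1ℤ + k) * n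
      ring = solve-∀

    ∉⇒above-gap : ∀ {x} → x ≈[ n ] g → ¬ B x → ∃ λ k → x ≡ g + + k * + n
    ∉⇒above-gap x≈g x∉B with ≈-split x≈g
    ... | inj₁ above    = above
    ... | inj₂ (k , eq) = contradiction (below-gap k eq) x∉B

    ∈⇒below-gap : ∀ {x} → x ≈[ n ] g → B x → ∃ λ k → x ≡ g - + suc k * + n
    ∈⇒below-gap x≈g x∈B with ≈-split x≈g
    ... | inj₁ (k , eq) = contradiction x∈B (above-gap k eq)
    ... | inj₂ below    = below

  gap-unique : ∀ {g h} → IsGap n B g → IsGap n B h → g ≈[ n ] h → g ≡ h
  gap-unique {g} {h} gap-g gap-h g≈h with ∉⇒above-gap gap-h g≈h (proj₁ gap-g)
  ... | zero , eq  = trans eq (ℤ.+-identityʳ h)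
  ... | suc k , refl = contradiction (proj₂ gap-g)
        (above-gap gap-h k (trans (cong (λ z → h + z * + n - + n) (ℤ.pos-+ 1 k)) (ring h (+ k) (+ n))))
    where
    ring : ∀ h k n → h + (1ℤ + k) * n - n ≡ h + k * n
    ring = solve-∀

-- Walk upward from the bead x in steps of n; the non-bead known to lie k steps above stops the
-- walk.
find-gap : ∀ {n B} → (∀ x → Dec (B x)) → ∀ k x → B x → ¬ B (x + + k * + n) →
           ∃ λ g → g ≈[ n ] x × IsGap n B g
find-gap {n} {B} B? zero    x x∈B end∉B = contradiction (subst B (sym (ℤ.+-identityʳ x)) x∈B) end∉B
find-gap {n} {B} B? (suc k) x x∈B end∉B with B? (x + + n)
... | no ¬b = x + + n , (modulo 1ℤ $ cong (_+_ x) (sym (ℤ.*-identityˡ (+ n)))) , ¬b , subst B (ring x (+ n)) x∈B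
  where
  ring : ∀ x n → x ≡ x + n - n
  ring = solve-∀
... | yes b with find-gap B? k (x + + n) b
                  (λ e → end∉B (subst B (trans (ring x (+ k) (+ n)) (cong (λ z → x + z * + n) (sym (ℤ.pos-+ 1 k)))) e))
  where
  ring : ∀ x k n → x + n + k * n ≡ x + (1ℤ + k) * n
  ring = solve-∀
...   | g , g≈ , gap = g , ≈-trans g≈ (modulo 1ℤ $ cong (_+_ x) (sym (ℤ.*-identityˡ (+ n)))) , gap

-- Beta-sets and hooks

least : {Q : ℕ → Set} (Q? : ∀ k → Dec (Q k)) → ∀ K → Q K → ∃ λ k → Q k × (∀ i → i ℕ.< k → ¬ Q i)
least Q? zero    q = zero , q , λ _ ()
least Q? (suc K) q with Q? zero
... | yes q₀ = zero , q₀ , λ _ ()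
... | no ¬q₀ with least (Q? ∘ suc) K q
...   | k , qk , below = suc k , qk , λ { zero _ → ¬q₀ ; (suc i) (s≤s i<k) → below i i<k }

length-filter-initial : ∀ {Q : ℕ → Set} (Q? : ∀ i → Dec (Q i)) f n k → k ℕ.≤ n →
  (∀ i → i ℕ.< k → Q (f i)) → (∀ i → k ℕ.≤ i → ¬ Q (f i)) → length (filter Q? (applyUpTo f n)) ≡ k
length-filter-initial Q? f zero    zero    _ _ _ = refl
length-filter-initial Q? f (suc n) zero    _ q ¬q =
  trans (cong length (filter-reject Q? (¬q 0 z≤n)))
        (length-filter-initial Q? (f ∘ suc) n zero z≤n (λ _ ()) (λ i _ → ¬q (suc i) z≤n))
length-filter-initial Q? f (suc n) (suc k) (s≤s k≤n) q ¬q =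
  trans (cong length (filter-accept Q? (q 0 (s≤s z≤n))))
        (cong suc (length-filter-initial Q? (f ∘ suc) n k k≤n
          (λ i i<k → q (suc i) (s≤s i<k)) (λ i k≤i → ¬q (suc i) (s≤s k≤i))))

≤⇒diff : ∀ {x y} → x ≤ y → ∃ λ k → y ≡ x + + k
≤⇒diff {x} {y} x≤y = go (y - x) refl (ℤ.i≤j⇒0≤j-i x≤y)
  where
  ring : ∀ x y → y ≡ x + (y - x)
  ring = solve-∀
  go : ∀ d → d ≡ y - x → 0ℤ ≤ d → ∃ λ k → y ≡ x + + k
  go (+ k) e _ = k , trans (ring x y) (cong (_+_ x) (sym e))

<⇒suc-diff : ∀ {x y} → x < y → ∃ λ k → y ≡ x + + suc k
<⇒suc-diff {x} x<y with ≤⇒diff (ℤ.i<j⇒suc[i]≤j x<y)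
... | k , eq = k , trans eq (ring x (+ k))
  where
  ring : ∀ x k → 1ℤ + x + k ≡ x + (1ℤ + k)
  ring = solve-∀

β : Partition → ℕ → ℤ
β p i = + part p i - + suc i

module _ (p : Partition) where

  part-antitone : ∀ {i j} → i ℕ.≤ j → part p j ℕ.≤ part p i
  part-antitone {i} i≤j = go (ℕ.≤⇒≤′ i≤j)
    where
    go : ∀ {j} → i ℕ.≤′ j → part p j ℕ.≤ part p i
    go ℕ.≤′-refl       = ℕ.≤-refl
    go (ℕ.≤′-step i≤j) = ℕ.≤-trans (decreasing p _) (go i≤j)

  β-decreasing : ∀ {i j} → i ℕ.< j → β p j < β p i
  β-decreasing i<j = ℤ.+-mono-≤-< (+≤+ (part-antitone (ℕ.<⇒≤ i<j))) (ℤ.neg-mono-< (+<+ (s≤s i<j)))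

  β-antitone : ∀ {i j} → i ℕ.≤ j → β p j ≤ β p i
  β-antitone {i} {j} i≤j with ℕ.m≤n⇒m<n∨m≡n i≤j
  ... | inj₁ i<j  = ℤ.<⇒≤ (β-decreasing i<j)
  ... | inj₂ refl = ℤ.≤-refl

  β-injective : ∀ {i j} → β p i ≡ β p j → i ≡ j
  β-injective {i} {j} eq with ℕ.<-cmp i j
  ... | tri< i<j _ _ = contradiction (sym eq) (ℤ.<⇒≢ (β-decreasing i<j))
  ... | tri≈ _ i≡j _ = i≡j
  ... | tri> _ _ j<i = contradiction eq (ℤ.<⇒≢ (β-decreasing j<i))

  β-tail : ∀ {i} → bound p ℕ.≤ i → β p i ≡ -[1+ i ]
  β-tail {i} b≤i = cong (λ a → + a - + suc i) (vanishing p i b≤i)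

  low∈betaSet : ∀ {i} → bound p ℕ.≤ i → betaSet p -[1+ i ]
  low∈betaSet {i} b≤i = i , sym (β-tail b≤i)

  high∉betaSet : ∀ {n} → part p 0 ℕ.≤ n → ¬ betaSet p (+ n)
  high∉betaSet {n} p₀≤n (i , eq) = ℤ.<⇒≢ (begin-strict
    β p i        ≤⟨ β-antitone z≤n ⟩
    β p 0        <⟨ ℤ.+-monoʳ-< (+ part p 0) -<+ ⟩
    + part p 0 + 0ℤ ≡⟨ ℤ.+-identityʳ _ ⟩
    + part p 0   ≤⟨ +≤+ p₀≤n ⟩
    + n          ∎) (sym eq)
    where open ℤ.≤-Reasoning

  -- In the tail `β p i` is -1 - i, so the index `bound p + ∣ x ∣` already has its bead at or below
  -- x and bounds the search.
  locate : ∀ x → ∃ λ k → β p k ≤ x × (∀ i → i ℕ.< k → ¬ β p i ≤ x)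
  locate x = least (λ k → β p k ℤ.≤? x) (bound p ℕ.+ ∣ x ∣)
    (subst (_≤ x) (sym (β-tail (ℕ.m≤m+n _ _))) (low x))
    where
    low : ∀ x → -[1+ bound p ℕ.+ ∣ x ∣ ] ≤ x
    low (+ _)    = -≤+
    low -[1+ n ] = -≤- (ℕ.≤-trans (ℕ.n≤1+n n) (ℕ.m≤n+m (suc n) (bound p)))

  betaSet? : ∀ x → Dec (betaSet p x)
  betaSet? x with locate x
  ... | k , βk≤x , above with β p k ℤ.≟ x
  ...   | yes eq = yes (k , sym eq)
  ...   | no βk≢x = no λ (i , eq) → out i eq (ℕ.<-cmp i k)
    where
    out : ∀ i → x ≡ β p i → Tri (i ℕ.< k) (i ≡ k) (k ℕ.< i) → ⊥
    out i eq (tri< i<k _ _)  = above i i<k (ℤ.≤-reflexive (sym eq))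
    out i eq (tri≈ _ refl _) = βk≢x (sym eq)
    out i eq (tri> _ _ k<i)  = ℤ.<⇒≱ (β-decreasing k<i) (subst (β p k ≤_) eq βk≤x)

  conjugate≡ : ∀ {c k} → part p k ℕ.≤ c → (∀ i → i ℕ.< k → c ℕ.< part p i) → conjugate p c ≡ k
  conjugate≡ {c} {k} pk≤c above = length-filter-initial (λ i → c ℕ.<? part p i) (λ i → i) (bound p) k k≤bound
    above (λ i k≤i c<pi → ℕ.<⇒≱ c<pi (ℕ.≤-trans (part-antitone k≤i) pk≤c))
    where
    k≤bound : k ℕ.≤ bound p
    k≤bound with k ℕ.≤? bound p
    ... | yes le = le
    ... | no ¬le = contradiction (subst (c ℕ.<_) (vanishing p _ ℕ.≤-refl) (above (bound p) (ℕ.≰⇒> ¬le))) λ ()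

  -- With k the length of column c, the number c - k is the non-bead that records this column. The
  -- hook lengths in row r are thus the distances from the bead `β p r` down to non-beads.
  hook-β : ∀ {r c k} → conjugate p c ≡ k → hookLength p (r , c) ≡ β p r - (+ c - + k)
  hook-β {r} {c} refl = trans (cong (λ z → 1ℤ + β p r + (+ conjugate p c - z)) (ℤ.pos-+ 1 c))
                              (ring (β p r) (+ c) (+ conjugate p c))
    where
    ring : ∀ b c k → 1ℤ + b + (k - (1ℤ + c)) ≡ b - (c - k)
    ring = solve-∀

  -- If y = `β p r` - s were not a bead, it would lie strictly between the beads with indices k and
  -- k - 1 for some k > r, and the column c = y + k would meet row r in a cell of hook length s.
  core⇒closed : ∀ {s} .{{_ : ℕ.NonZero s}} → Core s p → Closed s (betaSet p)
  core⇒closed {s@(suc s′)} core _ (r , refl) with locate (β p r - + s)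
  ... | k , βk≤y , above with β p k ℤ.≟ β p r - + s
  ...   | yes eq = k , sym eq
  ...   | no βk≢y = contradiction hook≡s (core (r , c) c<part-r)
    where
    y = β p r - + s
    y<βr : y < β p r
    y<βr = subst (y <_) (ℤ.+-identityʳ (β p r)) (ℤ.+-monoʳ-< (β p r) -<+)
    r<k : r ℕ.< k
    r<k with r ℕ.<? k
    ... | yes lt = lt
    ... | no r≮k = contradiction (ℤ.≤-<-trans (ℤ.≤-trans (β-antitone (ℕ.≮⇒≥ r≮k)) βk≤y) y<βr) (ℤ.<-irrefl refl)
    βk<y = <⇒suc-diff (ℤ.≤∧≢⇒< βk≤y βk≢y)
    -- `proj₁ βk<y` is the d with y = `β p k` + 1 + d, so this is y + k written as a natural number.
    c = part p k ℕ.+ proj₁ βk<y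
    c≡ : y ≡ + c - + k
    c≡ = trans (proj₂ βk<y) (trans
      (cong₂ (λ a b → + part p k - a + b) (ℤ.pos-+ 1 k) (ℤ.pos-+ 1 (proj₁ βk<y)))
      (ring (+ part p k) (+ k) (+ proj₁ βk<y)))
      where
      ring : ∀ a k d → a - (1ℤ + k) + (1ℤ + d) ≡ a + d - k
      ring = solve-∀
    c< : ∀ i → i ℕ.< k → c ℕ.< part p i
    c< i i<k = ℕ.≤-trans (ℤ.drop‿+<+ (subst₂ _<_ (cancel (+ c) (+ k)) (cancel (+ part p j) (+ k))
      (ℤ.+-monoˡ-< (+ k) (subst₂ _<_ c≡ (cong (λ z → + part p j - + z) suc-j) (ℤ.≰⇒> (above j j<k)))))) (part-antitone i≤j)
      where
      -- Row k - 1 is the last one whose bead exceeds y; the bound for it carries over to all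
      -- earlier rows because parts decrease.
      j = ℕ.pred k
      suc-j : suc j ≡ k
      suc-j = ℕ.suc-pred k {{ℕ.>-nonZero (ℕ.≤-<-trans z≤n i<k)}}
      j<k : j ℕ.< k
      j<k = ℕ.≤-reflexive suc-j
      cancel : ∀ x k → x - k + k ≡ x
      cancel = solve-∀
      i≤j : i ℕ.≤ j
      i≤j = ℕ.<⇒≤pred i<k
    c<part-r = c< r r<k
    hook≡s : hookLength p (r , c) ≡ + s
    hook≡s = trans (hook-β (conjugate≡ (ℕ.m≤m+n _ _) c<)) (trans (cong (λ z → β p r - z) (sym c≡)) (ring (β p r) (+ s)))
      where
      ring : ∀ b s → b - (b - s) ≡ s
      ring = solve-∀

  -- A hook of length s in row r puts `β p r` - s at c - k. Were this the bead with index i, then c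
  -- + i + 1 = part i + k. This fails for i < k, where part i > c, and for i ≥ k, where part i ≤ c.
  closed⇒core : ∀ {s} → Closed s (betaSet p) → Core s p
  closed⇒core {s} closed (r , c) c<part-r hook≡s
    with least (λ k → part p k ℕ.≤? c) (bound p) (subst (ℕ._≤ c) (sym (vanishing p _ ℕ.≤-refl)) z≤n)
  ... | k , pk≤c , above with closed (β p r) (r , refl)
  ...   | i , eq = impossible (i ℕ.<? k)
    where
    gap : β p r - + s ≡ + c - + k
    gap = trans (cong (λ z → β p r - z) (trans (sym hook≡s) (hook-β (conjugate≡ pk≤c (λ i i<k → ℕ.≰⇒> (above i i<k))))))
                (ring (β p r) (+ c - + k))
      where
      ring : ∀ b s → b - (b - s) ≡ s
      ring = solve-∀
    eq′ : c ℕ.+ suc i ≡ part p i ℕ.+ k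
    eq′ = ℤ.+-injective (ring₁ (+ c) (+ k) (+ part p i) (+ suc i) (trans (sym gap) eq))
      where
      ring₁ : ∀ c k a i → c - k ≡ a - i → c + i ≡ a + k
      ring₁ c k a i e = trans (ring₂ c k i) (trans (cong (λ z → z + k + i) e) (ring₃ a k i))
        where
        ring₂ : ∀ c k i → c + i ≡ c - k + k + i
        ring₂ = solve-∀
        ring₃ : ∀ a k i → a - i + k + i ≡ a + k
        ring₃ = solve-∀
    impossible : Dec (i ℕ.< k) → ⊥
    impossible (yes i<k) = ℕ.<⇒≢ (ℕ.+-mono-<-≤ (ℕ.≰⇒> (above i i<k)) i<k) eq′
    impossible (no i≮k)  = ℕ.<⇒≢ (ℕ.+-mono-≤-< (ℕ.≤-trans (part-antitone (ℕ.≮⇒≥ i≮k)) pk≤c) (s≤s (ℕ.≮⇒≥ i≮k))) (sym eq′)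

-- Two strictly decreasing enumerations of the same set, up to a translation,
-- agree term by term; as both beta-sets contain -1-i in position i eventually,
-- the translation is trivial.
module _ (p q : Partition) (e : ℤ) (p⊆q : ∀ x → betaSet p x → betaSet q (x + e))
         (q⊆p : ∀ y → betaSet q y → betaSet p (y - e)) where
  private
    cancel : ∀ x e → x - e + e ≡ x
    cancel = solve-∀
    cancel′ : ∀ x e → x + e - e ≡ x
    cancel′ = solve-∀

    β-translate : ∀ i → β p i + e ≡ β q i
    β-translate = <-rec _ step
      where
      step : ∀ i → (∀ {j} → j ℕ.< i → β p j + e ≡ β q j) → β p i + e ≡ β q i
      step i ih with p⊆q (β p i) (i , refl) | q⊆p (β q i) (i , refl)
      ... | j , eqj | l , eql with ℕ.<-cmp j i
      ...   | tri≈ _ refl _ = eqj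
      ...   | tri< j<i _ _  = contradiction
        (β-injective p (trans (sym (cancel′ (β p j) e))
          (trans (cong (_- e) (trans (ih j<i) (sym eqj))) (cancel′ (β p i) e)))) (ℕ.<⇒≢ j<i)
      -- If j > i, then `β q i` must come from some `β p l` with l ≥ i, smaller indices being taken.
      -- This gives `β q i ≤ β q j`, against strict decrease.
      ...   | tri> _ _ i<j with l ℕ.<? i
      ...     | yes l<i = contradiction
        (β-injective q (trans (sym (ih l<i)) (trans (cong (_+ e) (sym eql)) (cancel (β q i) e)))) (ℕ.<⇒≢ l<i)
      ...     | no l≮i = contradiction (ℤ.<-≤-trans (β-decreasing q i<j) (begin
        β q i          ≡⟨ cancel (β q i) e ⟨
        β q i - e + e  ≡⟨ cong (_+ e) eql ⟩
        β p l + e      ≤⟨ ℤ.+-monoˡ-≤ e (β-antitone p (ℕ.≮⇒≥ l≮i)) ⟩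
        β p i + e      ≡⟨ eqj ⟩
        β q j          ∎)) (ℤ.<-irrefl refl)
        where open ℤ.≤-Reasoning

  translation-trivial : e ≡ 0ℤ
  translation-trivial = ∙-cancelˡ (β p i) e 0ℤ (begin
    β p i + e    ≡⟨ β-translate i ⟩
    β q i        ≡⟨ β-tail q (ℕ.m≤n+m _ _) ⟩
    -[1+ i ]     ≡⟨ β-tail p (ℕ.m≤m+n _ _) ⟨
    β p i        ≡⟨ ℤ.+-identityʳ _ ⟨
    β p i + 0ℤ   ∎)
    where
    open ≡-Reasoning
    i = bound p ℕ.+ bound q

  translate⇒part≗ : ∀ i → part p i ≡ part q i
  translate⇒part≗ i = ℤ.+-injective (∙-cancelʳ (- + suc i) _ _ (begin
    β p i       ≡⟨ ℤ.+-identityʳ _ ⟨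
    β p i + 0ℤ  ≡⟨ cong (_+_ (β p i)) translation-trivial ⟨
    β p i + e   ≡⟨ β-translate i ⟩
    β q i       ∎))
    where open ≡-Reasoning

+*-cancelʳ : ∀ {t} .{{_ : ℕ.NonZero t}} k l → + k * + t ≡ + l * + t → k ≡ l
+*-cancelʳ {suc t} k l eq = ℤ.+-injective (ℤ.*-cancelʳ-≡ (+ k) (+ l) (+ suc t) eq)

module _ (p : Partition) where

  far-below : ∀ n .{{_ : ℕ.NonZero n}} y → betaSet p (y - + (suc (bound p ℕ.+ ∣ y ∣)) * + n)
  far-below n y with ≤⇒diff far
    where
    K = suc (bound p ℕ.+ ∣ y ∣)
    open ℤ.≤-Reasoning
    y≤∣y∣ : ∀ y → y ≤ + ∣ y ∣
    y≤∣y∣ (+ _)    = ℤ.≤-refl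
    y≤∣y∣ -[1+ _ ] = -≤+
    ring : ∀ b y → y - (1ℤ + (b + y)) ≡ - (1ℤ + b)
    ring = solve-∀
    far : y - + K * + n ≤ -[1+ bound p ]
    far = begin
      y - + K * + n         ≡⟨ cong (λ z → y - z) (ℤ.pos-* K n) ⟨
      y - + (K ℕ.* n)       ≤⟨ ℤ.+-mono-≤ (y≤∣y∣ y) (ℤ.neg-mono-≤ (+≤+ (ℕ.m≤m*n K n))) ⟩
      + ∣ y ∣ - + K         ≡⟨ ring (+ bound p) (+ ∣ y ∣) ⟩
      -[1+ bound p ]        ∎
  ... | d , eq = subst (betaSet p) (trans (neg (bound p) d) (cancel eq)) (low∈betaSet p (ℕ.m≤m+n (bound p) d))
    where
    neg : ∀ b d → -[1+ b ℕ.+ d ] ≡ -[1+ b ] - + d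
    neg b zero    = cong -[1+_] (ℕ.+-identityʳ b)
    neg b (suc d) = cong -[1+_] (ℕ.+-suc b d)
    cancel : ∀ {x y z} → x ≡ y + z → x - z ≡ y
    cancel {y = y} {z} refl = ring y z
      where
      ring : ∀ y z → y + z - z ≡ y
      ring = solve-∀

  far-above : ∀ n .{{_ : ℕ.NonZero n}} y → ¬ betaSet p (y + + (part p 0 ℕ.+ ∣ y ∣) * + n)
  far-above n y with ≤⇒diff far
    where
    K = part p 0 ℕ.+ ∣ y ∣
    open ℤ.≤-Reasoning
    -∣y∣≤y : ∀ y → - + ∣ y ∣ ≤ y
    -∣y∣≤y (+ zero) = ℤ.≤-refl
    -∣y∣≤y (+ suc _) = -≤+
    -∣y∣≤y -[1+ _ ] = ℤ.≤-refl
    ring : ∀ b y → - y + (b + y) ≡ b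
    ring = solve-∀
    far : + part p 0 ≤ y + + K * + n
    far = begin
      + part p 0           ≡⟨ ring (+ part p 0) (+ ∣ y ∣) ⟨
      - + ∣ y ∣ + + K      ≤⟨ ℤ.+-mono-≤ (-∣y∣≤y y) (+≤+ (ℕ.m≤m*n K n)) ⟩
      y + + (K ℕ.* n)      ≡⟨ cong (_+_ y) (ℤ.pos-* K n) ⟩
      y + + K * + n        ∎
  ... | d , eq = λ b → high∉betaSet p (ℕ.m≤m+n (part p 0) d) (subst (betaSet p) eq b)

  abstract
    -- The search runs from a bead K steps below y to a non-bead L steps above it. Closedness then
    -- makes the gap found unique in its class, see `gap≡`.
    first-gap : ∀ n .{{_ : ℕ.NonZero n}} y → ∃ λ g → g ≈[ n ] y × IsGap n (betaSet p) g
    first-gap n y = search (find-gap (betaSet? p) (K ℕ.+ L) (y - + K * + n) (far-below n y)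
                             (λ b → far-above n y (subst (betaSet p) shift b)))
      where
      K L : ℕ
      K = suc (bound p ℕ.+ ∣ y ∣)
      L = part p 0 ℕ.+ ∣ y ∣
      ring : ∀ y k l n → y - k * n + (k + l) * n ≡ y + l * n
      ring = solve-∀
      shift : y - + K * + n + + (K ℕ.+ L) * + n ≡ y + + L * + n
      shift = trans (cong (λ z → y - + K * + n + z * + n) (ℤ.pos-+ K L)) (ring y (+ K) (+ L) (+ n))
      search : (∃ λ g → g ≈[ n ] y - + K * + n × IsGap n (betaSet p) g) → ∃ λ g → g ≈[ n ] y × IsGap n (betaSet p) g
      search (g , g≈ , gap) =
        g , ≈-trans g≈ (modulo (- + K) (cong (_+_ y) (ℤ.neg-distribˡ-* (+ K) (+ n)))) , gap

  gap : ∀ n .{{_ : ℕ.NonZero n}} → ℤ → ℤ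
  gap n y = proj₁ (first-gap n y)

  gap-≈ : ∀ n .{{_ : ℕ.NonZero n}} y → gap n y ≈[ n ] y
  gap-≈ n y = proj₁ (proj₂ (first-gap n y))

  gap-isGap : ∀ n .{{_ : ℕ.NonZero n}} y → IsGap n (betaSet p) (gap n y)
  gap-isGap n y = proj₂ (proj₂ (first-gap n y))

  gap≡ : ∀ {n} .{{_ : ℕ.NonZero n}} → Closed n (betaSet p) → ∀ {y g} →
         g ≈[ n ] y → IsGap n (betaSet p) g → gap n y ≡ g
  gap≡ {n} closed {y} g≈y isGap = gap-unique closed (gap-isGap n y) isGap (≈-trans (gap-≈ n y) (≈-sym g≈y))

betaSet-cong : ∀ {p q} → (∀ i → part p i ≡ part q i) → ∀ {x} → betaSet p x → betaSet q x
betaSet-cong p≗q (i , eq) = i , trans eq (cong (λ a → + a - + suc i) (p≗q i))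

gap-cong : ∀ {p q} n .{{_ : ℕ.NonZero n}} → Closed n (betaSet p) → (∀ i → part p i ≡ part q i) →
           ∀ y → gap p n y ≡ gap q n y
gap-cong {p} {q} n closed p≗q y = gap≡ p closed (gap-≈ q n y)
  ( (λ b → proj₁ (gap-isGap q n y) (betaSet-cong {p} {q} p≗q b))
  , betaSet-cong {q} {p} (λ i → sym (p≗q i)) (proj₂ (gap-isGap q n y)))

-- The word of a core and its content

module Letters (s t : ℕ) .{{_ : ℕ.NonZero s}} .{{_ : ℕ.NonZero t}} (u : ℤ) (us≈1 : u * + s ≈[ t ] 1ℤ) where

  private
    *us : ∀ x → x * u * + s ≈[ t ] x
    *us x = ≈-trans (≈-reflexive (ring x u (+ s))) (≈-trans (≈-* x us≈1) (≈-reflexive (ℤ.*-identityˡ x)))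
      where
      ring : ∀ x u s → x * u * s ≡ u * s * x
      ring = solve-∀

  abstract
    -- The class k with x ≡ k s modulo t. Letters are these k rather than the residues of x, so that
    -- adding s to x raises the letter by one, cyclically.
    κ : ℤ → Fin t
    κ x = residue t (x * u)

    κ-cong : ∀ {x y} → x ≈[ t ] y → κ x ≡ κ y
    κ-cong x≈y = residue-cong t (≈-* u x≈y)

    κ-≈ : ∀ x → x ≈[ t ] + toℕ (κ x) * + s
    κ-≈ x = ≈-trans (≈-sym (*us x)) (≈-* (+ s) (residue-≈ t (x * u)))

    κ-s : ∀ x → κ (x * + s) ≡ residue t x
    κ-s x = residue-cong t (≈-trans (≈-reflexive (ring x (+ s) u)) (*us x))
      where
      ring : ∀ x s u → x * s * u ≡ x * u * s
      ring = solve-∀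

  κ≡⇒≈ : ∀ {x k} → κ x ≡ residue t k → x ≈[ t ] k * + s
  κ≡⇒≈ {x} {k} eq = ≈-trans (κ-≈ x) (≈-* (+ s) (≈-trans (≈-reflexive (cong (+_ ∘ toℕ) eq)) (≈-sym (residue-≈ t k))))

  κ-injective : ∀ {x y} → κ x ≡ κ y → x ≈[ t ] y
  κ-injective {x} {y} eq = ≈-trans (κ-≈ x) (≈-trans (≈-reflexive (cong (λ j → + toℕ j * + s) eq)) (≈-sym (κ-≈ y)))

  -- The elements of the s-set are the first gaps of the beta-set modulo s; the
  -- word of a core lists the classes modulo t of the beads just below them.
  sElement : Partition → Fin s → ℤ
  sElement p i = gap p s (+ toℕ i)

  coreWord : Partition → Vec (Fin t) s
  coreWord p = tabulate λ i → κ (sElement p i - + s)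

  coreWord-cong : ∀ {p q} → Closed s (betaSet p) → (∀ i → part p i ≡ part q i) → coreWord p ≡ coreWord q
  coreWord-cong {p} {q} closed p≗q = tabulate-cong λ i → cong (λ a → κ (a - + s)) (gap-cong s closed p≗q (+ toℕ i))

  sElement≡ : ∀ {p} → Closed s (betaSet p) → ∀ {g} → IsGap s (betaSet p) g → sElement p (residue s g) ≡ g
  sElement≡ {p} closed {g} isGap = gap≡ p closed (residue-≈ s g) isGap

  residue-sElement : ∀ p i → residue s (sElement p i) ≡ i
  residue-sElement p i = trans (residue-cong s (gap-≈ p s (+ toℕ i))) (residue-toℕ s i)

  -- The b_k of the overview, defined for all natural k so that k + 1 needs no reduction modulo t.
  tGap : Partition → ℕ → ℤ
  tGap p k = gap p t (+ k * + s)

  module _ (p : Partition) (closed-s : Closed s (betaSet p)) (closed-t : Closed t (betaSet p)) where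

    -- The non-bead b + s is congruent to b′, hence equals b′ + m t with m ≥ 0. The elements of the
    -- s-set with letter k are exactly the b′ + l t with l < m: as non-beads they lie at or above
    -- b′, and as they become beads after subtracting s they lie below b + s.
    content-coreWord : ∀ k → content (coreWord p) (residue t (+ k)) * + t ≡ tGap p k + + s - tGap p (suc k)
    content-coreWord k = go (∉⇒above-gap closed-t b′gap b+s≈b′ b+s∉B)
      where
      B = betaSet p
      b = tGap p k
      b′ = tGap p (suc k)
      b≈ = gap-≈ p t (+ k * + s)
      b′≈ = gap-≈ p t (+ suc k * + s)
      bgap = gap-isGap p t (+ k * + s)
      b′gap = gap-isGap p t (+ suc k * + s)
      a = sElement p
      suc-s : + suc k * + s ≡ + k * + s + + s
      suc-s = trans (cong (_* + s) (ℤ.pos-+ 1 k)) (ring (+ k) (+ s))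
        where
        ring : ∀ k s → (1ℤ + k) * s ≡ k * s + s
        ring = solve-∀
      b+s≈b′ : b + + s ≈[ t ] b′
      b+s≈b′ = ≈-trans (≈-+ b≈ ≈-refl) (≈-trans (≈-reflexive (sym suc-s)) (≈-sym b′≈))
      -s+s : ∀ x s → x + s - s ≡ x
      -s+s = solve-∀
      b+s∉B : ¬ B (b + + s)
      b+s∉B h = proj₁ bgap (subst B (-s+s b (+ s)) (closed-s _ h))
      go : (∃ λ m → b + + s ≡ b′ + + m * + t) → _
      go (m , eq) = trans (cong (_* + t) count) (trans (ring b′ (+ m * + t)) (cong (_- b′) (sym eq)))
        where
        ring : ∀ b m → m ≡ b + m - b
        ring = solve-∀
        y : ℕ → ℤ
        y l = b′ + + l * + t
        ygap : ∀ l → l ℕ.< m → IsGap s B (y l)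
        ygap l l<m = above-gap closed-t b′gap l refl ,
          -- `y l` - s lies m - l ≥ 1 steps of t below b.
          below-gap closed-t bgap (m ℕ.∸ suc l) (begin
            b′ + + l * + t - + s
              ≡⟨ ring₁ b′ (+ l * + t) (+ s) b (+ m * + t) (trans (cong (_- + s) (sym eq)) (-s+s b (+ s))) ⟩
            b - (+ m * + t - + l * + t)
              ≡⟨ cong (λ z → b - (+ z * + t - + l * + t)) (sym m≡) ⟩
            b - (+ (l ℕ.+ suc d) * + t - + l * + t)
              ≡⟨ cong (λ z → b - (z * + t - + l * + t)) (ℤ.pos-+ l (suc d)) ⟩
            b - ((+ l + + suc d) * + t - + l * + t)
              ≡⟨ ring₂ b (+ l) (+ suc d) (+ t) ⟩
            b - + suc d * + t ∎)
          where
          open ≡-Reasoning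
          d = m ℕ.∸ suc l
          m≡ : l ℕ.+ suc d ≡ m
          m≡ = trans (ℕ.+-suc l d) (ℕ.m+[n∸m]≡n l<m)
          ring₁ : ∀ b′ lt s b mt → b′ + mt - s ≡ b → b′ + lt - s ≡ b - (mt - lt)
          ring₁ b′ lt s b mt refl = shuffle b′ lt s mt
            where
            shuffle : ∀ b′ lt s mt → b′ + lt - s ≡ b′ + mt - s - (mt - lt)
            shuffle = solve-∀
          ring₂ : ∀ b l d t → b - ((l + d) * t - l * t) ≡ b - d * t
          ring₂ = solve-∀
        φ : Fin m → Fin s
        φ l = residue s (y (toℕ l))
        a-φ : ∀ l → a (φ l) ≡ y (toℕ l)
        a-φ l = sElement≡ closed-s (ygap (toℕ l) (toℕ<n l))
        letter : ∀ i → lookup (coreWord p) i ≡ κ (a i - + s)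
        letter = lookup∘tabulate _
        R : Fin s → Set
        R i = lookup (coreWord p) i ≡ residue t (+ k)
        count : content (coreWord p) (residue t (+ k)) ≡ + m
        count = count-bij (λ i → lookup (coreWord p) i ≟ residue t (+ k)) φ inj R-φ onto
          where
          inj : ∀ l l′ → φ l ≡ φ l′ → l ≡ l′
          inj l l′ φ≡ = toℕ-injective (+*-cancelʳ (toℕ l) (toℕ l′) (∙-cancelˡ b′ _ _
            (trans (sym (a-φ l)) (trans (cong a φ≡) (a-φ l′)))))
          R-φ : ∀ l → R (φ l)
          R-φ l = trans (letter (φ l)) (trans (κ-cong (≈-trans (≈-reflexive (cong (_- + s) (a-φ l)))
            (≈-trans (≈-- {y = b + + s} (≈-trans (modulo (+ toℕ l) refl) (≈-sym b+s≈b′)) ≈-refl)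
              (≈-trans (≈-reflexive (-s+s b (+ s))) b≈)))) (κ-s (+ k)))
          onto : ∀ i → R i → ∃ λ l → φ l ≡ i
          onto i r = found (∈⇒below-gap closed-t bgap (≈-trans a-s≈ (≈-sym b≈)) (proj₂ agap))
                           (∉⇒above-gap closed-t b′gap a≈b′ (proj₁ agap))
            where
            agap = gap-isGap p s (+ toℕ i)
            a-s≈ : a i - + s ≈[ t ] + k * + s
            a-s≈ = κ≡⇒≈ {k = + k} (trans (sym (letter i)) r)
            a≈b′ : a i ≈[ t ] b′
            a≈b′ = ≈-trans (≈-reflexive (ring₃ (a i) (+ s))) (≈-trans (≈-+ a-s≈ ≈-refl)
                     (≈-trans (≈-reflexive (sym suc-s)) (≈-sym b′≈)))
              where
              ring₃ : ∀ x s → x ≡ x - s + s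
              ring₃ = solve-∀
            found : (∃ λ l → a i - + s ≡ b - + suc l * + t) → (∃ λ l → a i ≡ b′ + + l * + t) → ∃ λ l → φ l ≡ i
            found (l′ , eq₁) (l , eq₂) = fromℕ< l<m ,
              trans (cong (residue s ∘ y) (toℕ-fromℕ< l<m)) (trans (cong (residue s) (sym eq₂)) (residue-sElement p i))
              where
              -- The l steps from b′ up to `a i`, and the 1 + l′ steps from there up to b + s, make
              -- up the m steps from b′ to b + s. Hence l < m.
              sum≡ : l ℕ.+ suc l′ ≡ m
              sum≡ = +*-cancelʳ (l ℕ.+ suc l′) m (trans (cong (_* + t) (ℤ.pos-+ l (suc l′)))
                (ring₄ (+ l) (+ suc l′) (+ t) (+ m) (a i) (+ s) b b′ eq₁ eq₂ eq))
                where
                ring₄ : ∀ l l′ t m a s b b′ → a - s ≡ b - l′ * t → a ≡ b′ + l * t → b + s ≡ b′ + m * t →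
                        (l + l′) * t ≡ m * t
                ring₄ l l′ t m a s b b′ e₁ e₂ e₃ = trans (r₁ l l′ t b′) (trans (cong (λ z → z - b′ + l′ * t) (sym e₂))
                  (trans (r₂ a s b′ (l′ * t)) (trans (cong (λ z → z + s - b′ + l′ * t) e₁)
                  (trans (r₃ b s b′ (l′ * t)) (trans (cong (_- b′) e₃) (r₄ b′ (m * t)))))))
                  where
                  r₁ : ∀ l l′ t b′ → (l + l′) * t ≡ b′ + l * t - b′ + l′ * t
                  r₁ = solve-∀
                  r₂ : ∀ a s b′ x → a - b′ + x ≡ a - s + s - b′ + x
                  r₂ = solve-∀
                  r₃ : ∀ b s b′ x → b - x + s - b′ + x ≡ b + s - b′
                  r₃ = solve-∀
                  r₄ : ∀ b m → b + m - b ≡ m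
                  r₄ = solve-∀
              l<m : l ℕ.< m
              l<m = subst (l ℕ.<_) sum≡ (ℕ.m<m+n l (s≤s z≤n))

-- Reading a partition off a set of beads

sum-snoc : ∀ n (f : ℕ → ℤ) → sum {suc n} (f ∘ toℕ) ≡ sum {n} (f ∘ toℕ) + f n
sum-snoc n f = trans (sum-init-last {n} (f ∘ toℕ))
  (cong₂ _+_ (sum-cong-≗ {n} (cong f ∘ toℕ-inject₁)) (cong f (toℕ-fromℕ n)))

sum-⟦⟧-bounded : ∀ {n} {R : Fin n → Set} (R? : ∀ i → Dec (R i)) → ∃ λ k → k ℕ.≤ n × sum (λ i → ⟦ R? i ⟧) ≡ + k
sum-⟦⟧-bounded {zero}  R? = 0 , z≤n , refl
sum-⟦⟧-bounded {suc n} R? with R? zero | sum-⟦⟧-bounded (R? ∘ suc)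
... | yes _ | k , k≤n , eq = suc k , s≤s k≤n , cong (_+_ 1ℤ) eq
... | no _  | k , k≤n , eq = k , ℕ.m≤n⇒m≤1+n k≤n , trans (ℤ.+-identityˡ _) eq

prepend : (a : ℕ) (p : Partition) → part p 0 ℕ.≤ a → Partition
prepend a p p₀≤a = record
  { part       = λ { zero → a ; (suc i) → part p i }
  ; decreasing = λ { zero → p₀≤a ; (suc i) → decreasing p i }
  ; bound      = suc (bound p)
  ; vanishing  = λ { (suc i) (s≤s b≤i) → vanishing p i b≤i }
  }

-- The partition whose parts count, for each bead in [0, L) from the top down,
-- the empty positions below it.
module Beads {χ : ℕ → Set} (χ? : ∀ X → Dec (χ X)) where

  Below : ℕ → ℤ → Set
  Below L y = (∃ λ k → y ≡ -[1+ k ]) ⊎ (∃ λ X → y ≡ + X × X ℕ.< L × χ X)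

  -- `part₀≤` allows a bead at L to become a new first row of length `gaps`. In `size≡`, the part of
  -- a bead X is X minus the number of beads in [0, X), so that the size is the sum of the positions
  -- minus 0 + 1 + ... + (n - 1) for n beads; doubling avoids the division.
  record Reading (L : ℕ) : Set where
    field
      partition : Partition
      beads     : ℕ
      gaps      : ℕ
      total     : gaps ℕ.+ beads ≡ L
      part₀≤    : part partition 0 ℕ.≤ gaps
      to-below  : ∀ {x} → betaSet partition x → Below L (x + + beads)
      of-below  : ∀ {y} → Below L y → betaSet partition (y - + beads)
      beads≡    : + beads ≡ sum {L} (λ i → ⟦ χ? (toℕ i) ⟧)
      size≡     : + 2 * + size partition ≡
                  + 2 * sum {L} (λ i → ⟦ χ? (toℕ i) ⟧ * + toℕ i) - + beads * (+ beads - 1ℤ)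

  reading : ∀ L → Reading L
  reading zero = record
    { partition = ∅ ; beads = 0 ; gaps = 0 ; total = refl ; part₀≤ = z≤n
    ; to-below = λ { (i , refl) → inj₁ (i , ℤ.+-identityʳ _) }
    ; of-below = λ { (inj₁ (k , refl)) → k , ℤ.+-identityʳ _ }
    ; beads≡ = refl ; size≡ = refl }
  reading (suc L) = step (reading L) (χ? L)
    where
    weaken : ∀ {y} → Below L y → Below (suc L) y
    weaken (inj₁ neg)                = inj₁ neg
    weaken (inj₂ (X , eq , X<L , χX)) = inj₂ (X , eq , ℕ.m≤n⇒m≤1+n X<L , χX)
    step : Reading L → Dec (χ L) → Reading (suc L)
    step r (no ¬χL) = record
      { partition = partition ; beads = beads ; gaps = suc gaps ; total = cong suc total
      ; part₀≤ = ℕ.m≤n⇒m≤1+n part₀≤ ; to-below = weaken ∘ to-below ; of-below = of-below ∘ strengthen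
      ; beads≡ = trans beads≡ (sym (trans (sum-snoc L (λ X → ⟦ χ? X ⟧))
          (trans (cong (_+_ (sum {L} (λ i → ⟦ χ? (toℕ i) ⟧))) (⟦⟧-no (χ? L) ¬χL)) (ℤ.+-identityʳ _))))
      ; size≡ = trans size≡ (cong (λ z → + 2 * z - + beads * (+ beads - 1ℤ)) (sym moment)) }
      where
      open Reading r
      S = sum {L} (λ i → ⟦ χ? (toℕ i) ⟧ * + toℕ i)
      moment : sum {suc L} (λ i → ⟦ χ? (toℕ i) ⟧ * + toℕ i) ≡ S
      moment = trans (sum-snoc L (λ X → ⟦ χ? X ⟧ * + X))
        (trans (cong (λ z → S + z * + L) (⟦⟧-no (χ? L) ¬χL)) (ℤ.+-identityʳ S))
      strengthen : ∀ {y} → Below (suc L) y → Below L y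
      strengthen (inj₁ neg) = inj₁ neg
      strengthen (inj₂ (X , eq , s≤s X≤L , χX)) with ℕ.m≤n⇒m<n∨m≡n X≤L
      ... | inj₁ X<L  = inj₂ (X , eq , X<L , χX)
      ... | inj₂ refl = contradiction χX ¬χL
    -- All `gaps` empty positions lie below the new top bead, which therefore gives the first row.
    -- The other rows move down by one index, which the additional bead in the translation
    -- compensates.
    step r (yes χL) = record
      { partition = prepend gaps partition part₀≤ ; beads = suc beads ; gaps = gaps
      ; total = trans (ℕ.+-suc gaps beads) (cong suc total) ; part₀≤ = ℕ.≤-refl
      ; to-below = to ; of-below = of
      ; beads≡ = trans (ℤ.+-comm 1ℤ (+ beads)) (trans (cong (_+ 1ℤ) beads≡) (sym
          (trans (sum-snoc L (λ X → ⟦ χ? X ⟧)) (cong (_+_ (sum {L} (λ i → ⟦ χ? (toℕ i) ⟧))) (⟦⟧-yes (χ? L) χL)))))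
      ; size≡ = sizes }
      where
      open Reading r
      p′ = prepend gaps partition part₀≤
      L≡ : + L ≡ + gaps + + beads
      L≡ = trans (cong +_ (sym total)) (ℤ.pos-+ gaps beads)
      β-suc : ∀ i → β p′ (suc i) + + suc beads ≡ β partition i + + beads
      β-suc i = trans (cong₂ (λ a b → + part partition i - a + b) (ℤ.pos-+ 1 (suc i)) (ℤ.pos-+ 1 beads))
                      (ring (+ part partition i) (+ suc i) (+ beads))
        where
        ring : ∀ a i n → a - (1ℤ + i) + (1ℤ + n) ≡ a - i + n
        ring = solve-∀
      β-zero : β p′ 0 + + suc beads ≡ + L
      β-zero = trans (trans (cong (_+_ (+ gaps - 1ℤ)) (ℤ.pos-+ 1 beads)) (ring (+ gaps) (+ beads))) (sym L≡)
        where
        ring : ∀ a n → a - 1ℤ + (1ℤ + n) ≡ a + n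
        ring = solve-∀
      to : ∀ {x} → betaSet p′ x → Below (suc L) (x + + suc beads)
      to (zero , refl)  = inj₂ (L , β-zero , ℕ.≤-refl , χL)
      to (suc i , refl) = subst (Below (suc L)) (sym (β-suc i)) (weaken (to-below (i , refl)))
      undo : ∀ a b {c} → a + b ≡ c → c - b ≡ a
      undo a b refl = ring a b
        where
        ring : ∀ a b → a + b - b ≡ a
        ring = solve-∀
      redo : ∀ c b {a} → c - b ≡ a → a + b ≡ c
      redo c b refl = ring c b
        where
        ring : ∀ c b → c - b + b ≡ c
        ring = solve-∀
      old : ∀ {y} → Below L y → betaSet p′ (y - + suc beads)
      old {y} b with of-below b
      ... | i , eq = suc i , undo (β p′ (suc i)) (+ suc beads) (trans (β-suc i) (redo y (+ beads) eq))
      of : ∀ {y} → Below (suc L) y → betaSet p′ (y - + suc beads)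
      of (inj₁ neg) = old (inj₁ neg)
      of (inj₂ (X , refl , s≤s X≤L , χX)) with ℕ.m≤n⇒m<n∨m≡n X≤L
      ... | inj₁ X<L  = old (inj₂ (X , refl , X<L , χX))
      ... | inj₂ refl = 0 , undo (β p′ 0) (+ suc beads) β-zero
      S = sum {L} (λ i → ⟦ χ? (toℕ i) ⟧ * + toℕ i)
      sizes : + 2 * + size p′ ≡ + 2 * sum {suc L} (λ i → ⟦ χ? (toℕ i) ⟧ * + toℕ i) - + suc beads * (+ suc beads - 1ℤ)
      sizes = begin
        + 2 * + (gaps ℕ.+ size partition)
          ≡⟨ cong (_*_ (+ 2)) (ℤ.pos-+ gaps (size partition)) ⟩
        + 2 * (+ gaps + + size partition)
          ≡⟨ ℤ.*-distribˡ-+ (+ 2) (+ gaps) (+ size partition) ⟩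
        + 2 * + gaps + + 2 * + size partition
          ≡⟨ cong (_+_ (+ 2 * + gaps)) size≡ ⟩
        + 2 * + gaps + (+ 2 * S - + beads * (+ beads - 1ℤ))
          ≡⟨ ring (+ gaps) S (+ beads) ⟩
        + 2 * (S + 1ℤ * (+ gaps + + beads)) - (1ℤ + + beads) * (1ℤ + + beads - 1ℤ)
          ≡⟨ cong₂ (λ l n → + 2 * (S + 1ℤ * l) - n * (n - 1ℤ)) (sym L≡) (sym (ℤ.pos-+ 1 beads)) ⟩
        + 2 * (S + 1ℤ * + L) - + suc beads * (+ suc beads - 1ℤ)
          ≡⟨ cong (λ z → + 2 * (S + z * + L) - + suc beads * (+ suc beads - 1ℤ)) (sym (⟦⟧-yes (χ? L) χL)) ⟩
        + 2 * (S + ⟦ χ? L ⟧ * + L) - + suc beads * (+ suc beads - 1ℤ)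
          ≡⟨ cong (λ z → + 2 * z - + suc beads * (+ suc beads - 1ℤ)) (sym (sum-snoc L (λ X → ⟦ χ? X ⟧ * + X))) ⟩
        + 2 * sum {suc L} (λ i → ⟦ χ? (toℕ i) ⟧ * + toℕ i) - + suc beads * (+ suc beads - 1ℤ) ∎
        where
        open ≡-Reasoning
        ring : ∀ g S n → + 2 * g + (+ 2 * S - n * (n - 1ℤ)) ≡ + 2 * (S + 1ℤ * (g + n)) - (1ℤ + n) * (1ℤ + n - 1ℤ)
        ring = solve-∀

-- The bead set and the core of a word

module Heights (s t : ℕ) .{{_ : ℕ.NonZero s}} .{{_ : ℕ.NonZero t}} (u : ℤ) (us≈1 : u * + s ≈[ t ] 1ℤ) where

  open Letters s t u us≈1

  atLeast : Vec (Fin t) s → ℕ → ℤ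
  atLeast w k = sum (λ i → ⟦ k ℕ.≤? toℕ (lookup w i) ⟧)

  -- The increments of the heights are those of the first gaps in content-coreWord.
  height : Vec (Fin t) s → ℕ → ℤ
  height w k = + k * + s + atLeast w k * + t

  height-suc : ∀ w j → height w (suc (toℕ j)) + content w j * + t ≡ height w (toℕ j) + + s
  height-suc w j = trans
    (cong (λ z → z * + s + atLeast w (suc (toℕ j)) * + t + content w j * + t) (ℤ.pos-+ 1 (toℕ j)))
    (trans (ring (+ toℕ j) (+ s) (atLeast w (suc (toℕ j))) (content w j) (+ t))
    (cong (λ z → + toℕ j * + s + z * + t + + s) merge))
    where
    ring : ∀ j s a c t → (1ℤ + j) * s + a * t + c * t ≡ j * s + (a + c) * t + s
    ring = solve-∀
    split : ∀ l → ⟦ suc (toℕ j) ℕ.≤? toℕ l ⟧ + ⟦ l ≟ j ⟧ ≡ ⟦ toℕ j ℕ.≤? toℕ l ⟧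
    split l with l ≟ j
    ... | yes refl = trans (cong (_+ 1ℤ) (⟦⟧-no (suc (toℕ j) ℕ.≤? toℕ j) ℕ.1+n≰n))
                           (sym (⟦⟧-yes (toℕ j ℕ.≤? toℕ j) ℕ.≤-refl))
    ... | no l≢j = trans (ℤ.+-identityʳ _) (⟦⟧-cong (suc (toℕ j) ℕ.≤? toℕ l) (toℕ j ℕ.≤? toℕ l) ℕ.<⇒≤
                     (λ le → ℕ.≤∧≢⇒< le (λ eq → l≢j (toℕ-injective (sym eq)))))
    merge : atLeast w (suc (toℕ j)) + content w j ≡ atLeast w (toℕ j)
    merge = trans (sym (∑-distrib-+ (λ i → ⟦ suc (toℕ j) ℕ.≤? toℕ (lookup w i) ⟧) (λ i → ⟦ lookup w i ≟ j ⟧)))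
                  (sum-cong-≗ (λ i → split (lookup w i)))

  -- At 0 all s letters are counted and at t none, so the heights there agree (`height-t`). This
  -- closes the cycle and lets heights be indexed by integers modulo t.
  height-0 : ∀ w → height w 0 ≡ + s * + t
  height-0 w = trans (ℤ.+-identityˡ _) (cong (_* + t) (trans
    (sum-cong-≗ {s} (λ i → ⟦⟧-yes (0 ℕ.≤? toℕ (lookup w i)) z≤n)) (trans (sum-const s 1ℤ) (ℤ.*-identityʳ (+ s)))))

  height-t : ∀ w → height w t ≡ + s * + t
  height-t w = trans (cong (λ z → + t * + s + z * + t)
      (sum-zero {s} _ (λ i → ⟦⟧-no (t ℕ.≤? toℕ (lookup w i)) (ℕ.<⇒≱ (toℕ<n (lookup w i))))))
    (trans (ℤ.+-identityʳ _) (ℤ.*-comm (+ t) (+ s)))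

  level : Vec (Fin t) s → ℤ → ℤ
  level w k = height w (toℕ (residue t k))

  level-suc : ∀ w k → level w (k + 1ℤ) + content w (residue t k) * + t ≡ level w k + + s
  level-suc w k = trans (cong (_+ content w j * + t) next) (height-suc w j)
    where
    j = residue t k
    k+1≈ : k + 1ℤ ≈[ t ] + suc (toℕ j)
    k+1≈ = ≈-trans (≈-+ (residue-≈ t k) ≈-refl)
             (≈-reflexive (trans (ℤ.+-comm (+ toℕ j) 1ℤ) (sym (ℤ.pos-+ 1 (toℕ j)))))
    next : level w (k + 1ℤ) ≡ height w (suc (toℕ j))
    next with ℕ.m≤n⇒m<n∨m≡n (toℕ<n j)
    ... | inj₁ lt = cong (height w) (trans (cong toℕ (trans (residue-cong t k+1≈)
                      (trans (cong (residue t ∘ +_) (sym (toℕ-fromℕ< lt))) (residue-toℕ t (fromℕ< lt))))) (toℕ-fromℕ< lt))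
    ... | inj₂ eq = trans (cong (height w) (trans (cong toℕ (trans (residue-cong t (≈-trans k+1≈ wrap))
                      (residue-toℕ t (fromℕ< 0<t)))) (toℕ-fromℕ< 0<t)))
                      (trans (height-0 w) (sym (trans (cong (height w) eq) (height-t w))))
      where
      0<t : 0 ℕ.< t
      0<t = ℕ.>-nonZero⁻¹ t
      wrap : + suc (toℕ j) ≈[ t ] + toℕ (fromℕ< 0<t)
      wrap = modulo 1ℤ (trans (cong +_ eq) (sym (trans (cong (λ z → + z + 1ℤ * + t) (toℕ-fromℕ< 0<t))
               (trans (ℤ.+-identityˡ _) (ℤ.*-identityˡ (+ t))))))

  level-≈ : ∀ w k → level w k ≈[ t ] k * + s
  level-≈ w k = ≈-trans (modulo (atLeast w (toℕ (residue t k))) refl) (≈-* (+ s) (≈-sym (residue-≈ t k)))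

  -- The bead set of the word, not yet translated into a beta-set: each class modulo t is filled up
  -- to its height.
  Under : Vec (Fin t) s → ℤ → Set
  Under w x = x < height w (toℕ (κ x))

  under? : ∀ w x → Dec (Under w x)
  under? w x = x ℤ.<? height w (toℕ (κ x))

  level-κ : ∀ w {x} k → x ≈[ t ] k * + s → height w (toℕ (κ x)) ≡ level w k
  level-κ w {x} k x≈ = cong (height w ∘ toℕ) (trans (κ-cong x≈) (κ-s k))

  private
    -<0 : ∀ x n .{{_ : ℕ.NonZero n}} → x - + n < x
    -<0 x n@(suc _) = subst (x - + n <_) (ℤ.+-identityʳ x) (ℤ.+-monoʳ-< x -<+)

  level-gap : ∀ w k → IsGap t (Under w) (level w k)
  level-gap w k = (λ lt → ℤ.<-irrefl (sym (level-κ w k (level-≈ w k))) lt) ,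
    subst (level w k - + t <_) (sym (level-κ w {level w k - + t} k (≈-trans (modulo (- 1ℤ) (cong (_+_ (level w k)) (sym (ℤ.-1*i≡-i (+ t))))) (level-≈ w k))))
          (-<0 (level w k) t)

  under-closed-t : ∀ w → Closed t (Under w)
  under-closed-t w x x<h = ℤ.<-trans (-<0 x t) (subst (x <_) (cong (height w ∘ toℕ)
    (κ-cong {x} {x - + t} (modulo 1ℤ (ring x (+ t))))) x<h)
    where
    ring : ∀ x t → x ≡ x - t + 1ℤ * t
    ring = solve-∀

  -- The level at k plus s exceeds the level at k + 1 by t times a content, which is nonnegative. So
  -- an x below the level at k + 1 has x - s below the level at k.
  under-closed-s : ∀ w → Closed s (Under w)
  under-closed-s w x x<h with sum-⟦⟧-bounded (λ i → lookup w i ≟ residue t (+ toℕ (κ (x - + s))))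
  ... | m , _ , content≡ = begin-strict
    x - + s                         <⟨ ℤ.+-monoˡ-< (- + s) x<h ⟩
    height w (toℕ (κ x)) - + s      ≡⟨ cong (_- + s) (level-κ w (k + 1ℤ) x≈) ⟩
    level w (k + 1ℤ) - + s          ≤⟨ ℤ.+-monoˡ-≤ (- + s) (ℤ.i≤i+j (level w (k + 1ℤ)) (+ (m ℕ.* t))) ⟩
    level w (k + 1ℤ) + + (m ℕ.* t) - + s
      ≡⟨ cong (λ z → level w (k + 1ℤ) + z - + s) (trans (ℤ.pos-* m t) (cong (_* + t) (sym content≡))) ⟩
    level w (k + 1ℤ) + content w (residue t k) * + t - + s
      ≡⟨ cong (_- + s) (level-suc w k) ⟩
    level w k + + s - + s           ≡⟨ ring (level w k) (+ s) ⟩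
    level w k                       ≡⟨ sym (level-κ w k (κ-≈ (x - + s))) ⟩
    height w (toℕ (κ (x - + s)))    ∎
    where
    open ℤ.≤-Reasoning
    k = + toℕ (κ (x - + s))
    ring : ∀ l s → l + s - s ≡ l
    ring = solve-∀
    ring′ : ∀ x s → x ≡ x - s + s
    ring′ = solve-∀
    ring″ : ∀ k s → k * s + s ≡ (k + 1ℤ) * s
    ring″ = solve-∀
    x≈ : x ≈[ t ] (k + 1ℤ) * + s
    x≈ = ≈-trans (≈-reflexive (ring′ x (+ s))) (≈-trans (≈-+ (κ-≈ (x - + s)) ≈-refl) (≈-reflexive (ring″ k (+ s))))

  module Bead (w : Vec (Fin t) s) = Beads (λ X → under? w (+ X))

  -- Heights are at most t s + s t, because k ≤ t and at most s letters are counted. They are also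
  -- nonnegative, so that the beads outside [0, `window`) are precisely the negative integers.
  window : ℕ
  window = 2 ℕ.* s ℕ.* t

  abstract
    wordReading : ∀ w → Bead.Reading w window
    wordReading w = Bead.reading w window

  module R (w : Vec (Fin t) s) = Beads.Reading (wordReading w)

  wordPartition : Vec (Fin t) s → Partition
  wordPartition w = R.partition w

  charge : Vec (Fin t) s → ℕ
  charge w = R.beads w

  height-bounds : ∀ w (j : Fin t) → ∃ λ h → height w (toℕ j) ≡ + h × h ℕ.≤ window
  height-bounds w j with sum-⟦⟧-bounded (λ i → toℕ j ℕ.≤? toℕ (lookup w i))
  ... | m , m≤s , eq = toℕ j ℕ.* s ℕ.+ m ℕ.* t ,
    trans (cong (λ z → + toℕ j * + s + z * + t) eq)
      (sym (trans (ℤ.pos-+ (toℕ j ℕ.* s) (m ℕ.* t)) (cong₂ _+_ (ℤ.pos-* (toℕ j) s) (ℤ.pos-* m t)))) ,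
    (begin
      toℕ j ℕ.* s ℕ.+ m ℕ.* t    ≤⟨ ℕ.+-mono-≤ (ℕ.*-monoˡ-≤ s (ℕ.<⇒≤ (toℕ<n j))) (ℕ.*-monoˡ-≤ t m≤s) ⟩
      t ℕ.* s ℕ.+ s ℕ.* t        ≡⟨ cong (ℕ._+ s ℕ.* t) (ℕ.*-comm t s) ⟩
      s ℕ.* t ℕ.+ s ℕ.* t        ≡⟨ cong (ℕ._+_ (s ℕ.* t)) (sym (ℕ.+-identityʳ (s ℕ.* t))) ⟩
      2 ℕ.* (s ℕ.* t)            ≡⟨ sym (ℕ.*-assoc 2 s t) ⟩
      window                     ∎)
    where open ℕ.≤-Reasoning

  betaSet⇒under : ∀ w {x} → betaSet (wordPartition w) x → Under w (x + + charge w)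
  betaSet⇒under w b with R.to-below w b
  ... | inj₁ (k , eq) rewrite eq with height-bounds w (κ -[1+ k ])
  ...   | h , h≡ , _ = subst (-[1+ k ] <_) (sym h≡) -<+
  betaSet⇒under w b | inj₂ (X , eq , _ , χX) = subst (Under w) (sym eq) χX

  under⇒betaSet : ∀ w {y} → Under w y → betaSet (wordPartition w) (y - + charge w)
  under⇒betaSet w {y@(-[1+ k ])} _ = R.of-below w (inj₁ (k , refl))
  under⇒betaSet w {y@(+ X)} y<h with height-bounds w (κ y)
  ... | h , h≡ , h≤ = R.of-below w (inj₂ (X , refl , ℕ.<-≤-trans (ℤ.drop‿+<+ (subst (y <_) h≡ y<h)) h≤ , y<h))

  wordPartition-closed : ∀ w {n} → Closed n (Under w) → Closed n (betaSet (wordPartition w))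
  wordPartition-closed w {n} closed x b = subst (betaSet (wordPartition w)) (ring x (+ charge w) (+ n))
    (under⇒betaSet w (closed _ (betaSet⇒under w b)))
    where
    ring : ∀ x c n → x + c - n - c ≡ x - n
    ring = solve-∀

  wordCore : Vec (Fin t) s → BiCore s t
  wordCore w = wordPartition w ,
    closed⇒core (wordPartition w) (wordPartition-closed w (under-closed-s w)) ,
    closed⇒core (wordPartition w) (wordPartition-closed w (under-closed-t w))

  rotate : Fin t → Vec (Fin t) s → Vec (Fin t) s
  rotate r = map (λ j → residue t (+ toℕ j + + toℕ r))

  content-rotate : ∀ r w k → content (rotate r w) (residue t (k + + toℕ r)) ≡ content w (residue t k)
  content-rotate r w k = sum-cong-≗ λ i → trans
    (cong (λ l → ⟦ l ≟ residue t (k + + toℕ r) ⟧) (lookup-map i (λ j → residue t (+ toℕ j + + toℕ r)) w))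
    (⟦⟧-cong (residue t (+ toℕ (lookup w i) + + toℕ r) ≟ residue t (k + + toℕ r)) (lookup w i ≟ residue t k)
      (λ eq → trans (sym (residue-toℕ t (lookup w i))) (residue-cong t (drop {+ toℕ (lookup w i)} {k} (residue-≈⁻ t eq))))
      (λ eq → residue-cong t (≈-+ (≈-trans (≈-reflexive (cong (+_ ∘ toℕ) eq)) (≈-sym (residue-≈ t k))) ≈-refl)))
    where
    ring : ∀ x r → x ≡ x + r - r
    ring = solve-∀
    drop : ∀ {x y} → x + + toℕ r ≈[ t ] y + + toℕ r → x ≈[ t ] y
    drop {x} {y} e = ≈-trans (≈-reflexive (ring x (+ toℕ r))) (≈-trans (≈-- e ≈-refl) (≈-reflexive (sym (ring y (+ toℕ r)))))

-- Rotating a word and translating its bead set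

module Rotations (s t : ℕ) .{{_ : ℕ.NonZero s}} .{{_ : ℕ.NonZero t}} (u : ℤ) (us≈1 : u * + s ≈[ t ] 1ℤ) where

  open Letters s t u us≈1
  open Heights s t u us≈1

  private
    *t-cancel : ∀ {i j} → i * + t ≡ j * + t → i ≡ j
    *t-cancel {i} {j} eq = ℤ.*-cancelʳ-≡ i j (+ t) eq

    unrotate : ∀ (r j : Fin t) → ∃ λ k → residue t (+ k + + toℕ r) ≡ j
    unrotate r j = k , trans (residue-cong t (modulo 1ℤ eq)) (residue-toℕ t j)
      where
      k = toℕ j ℕ.+ (t ℕ.∸ toℕ r)
      eq : + k + + toℕ r ≡ + toℕ j + 1ℤ * + t
      eq = trans (sym (ℤ.pos-+ k (toℕ r))) (trans (cong +_ (trans (ℕ.+-assoc (toℕ j) _ (toℕ r))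
        (cong (ℕ._+_ (toℕ j)) (ℕ.m∸n+n≡m (ℕ.<⇒≤ (toℕ<n r)))))) (trans (ℤ.pos-+ (toℕ j) t)
        (cong (_+_ (+ toℕ j)) (sym (ℤ.*-identityˡ (+ t))))))

    suc-+ : ∀ k r → + suc k + r ≡ + k + r + 1ℤ
    suc-+ k r = trans (cong (_+ r) (ℤ.pos-+ 1 k)) (ring (+ k) r)
      where
      ring : ∀ k r → 1ℤ + k + r ≡ k + r + 1ℤ
      ring = solve-∀

  module _ {p : Partition} (closed-s : Closed s (betaSet p)) (closed-t : Closed t (betaSet p))
           (w : Vec (Fin t) s) where

    private
      ν = + charge w

      diff : ∀ k (r : Fin t) → content w (residue t (+ k + + toℕ r)) * + t ≡
             level w (+ k + + toℕ r) + + s - level w (+ suc k + + toℕ r)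
      diff k r = trans (ring (level w (x + 1ℤ)) (content w (residue t x) * + t))
        (cong₂ _-_ (level-suc w x) (cong (level w) (sym (suc-+ k (+ toℕ r)))))
        where
        x = + k + + toℕ r
        ring : ∀ l c → c ≡ l + c - l
        ring = solve-∀

    -- The beta-set is the bead set of w moved down by ν, and ν ≡ κ(ν) s modulo t. So b_k of p is
    -- the level of w at k + κ(ν), minus ν. Contents are read off differences of consecutive b_k, in
    -- which ν cancels.
    ≗⇒content-rotate : (∀ i → part p i ≡ part (wordPartition w) i) →
                       ∀ j → content (rotate (κ ν) (coreWord p)) j ≡ content w j
    ≗⇒content-rotate p≗w j with unrotate (κ ν) j
    ... | k , refl = trans (content-rotate (κ ν) (coreWord p) (+ k)) (*t-cancel (begin
      content (coreWord p) (residue t (+ k)) * + t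
        ≡⟨ content-coreWord p closed-s closed-t k ⟩
      tGap p k + + s - tGap p (suc k)
        ≡⟨ cong₂ (λ a b → a + + s - b) (tGap≡ k) (tGap≡ (suc k)) ⟩
      level w (+ k + + toℕ r) - ν + + s - (level w (+ suc k + + toℕ r) - ν)
        ≡⟨ ring (level w (+ k + + toℕ r)) ν (+ s) (level w (+ suc k + + toℕ r)) ⟩
      level w (+ k + + toℕ r) + + s - level w (+ suc k + + toℕ r)
        ≡⟨ sym (diff k r) ⟩
      content w (residue t (+ k + + toℕ r)) * + t ∎))
      where
      open ≡-Reasoning
      r = κ ν
      ring : ∀ a ν s b → a - ν + s - (b - ν) ≡ a + s - b
      ring = solve-∀
      ring₁ : ∀ x ν → x - ν + ν ≡ x
      ring₁ = solve-∀
      ring₂ : ∀ x ν t → x - ν - t ≡ x - t - ν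
      ring₂ = solve-∀
      ring₃ : ∀ k r s → (k + r) * s - r * s ≡ k * s
      ring₃ = solve-∀
      tGap≡ : ∀ k → tGap p k ≡ level w (+ k + + toℕ r) - ν
      tGap≡ k = gap≡ p closed-t
        (≈-trans (≈-- (level-≈ w (+ k + + toℕ r)) (κ-≈ ν)) (≈-reflexive (ring₃ (+ k) (+ toℕ r) (+ s))))
        ( (λ b → proj₁ lgap (subst (Under w) (ring₁ (level w (+ k + + toℕ r)) ν)
             (betaSet⇒under w (betaSet-cong {p} {wordPartition w} p≗w b))))
        , subst (betaSet p) (sym (ring₂ (level w (+ k + + toℕ r)) ν (+ t)))
            (betaSet-cong {wordPartition w} {p} (λ i → sym (p≗w i)) (under⇒betaSet w (proj₂ lgap))))
        where lgap = level-gap w (+ k + + toℕ r)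

    module _ (r : Fin t) (same : ∀ j → content (rotate r (coreWord p)) j ≡ content w j) where

      private
        -- Equal contents give first gaps and levels the same increments, so the two sequences
        -- differ by a constant, their difference at k = 0.
        e = level w (+ 0 + + toℕ r) - tGap p 0

        level≡ : ∀ k → level w (+ k + + toℕ r) ≡ tGap p k + e
        level≡ zero    = ring (level w (+ 0 + + toℕ r)) (tGap p 0)
          where
          ring : ∀ l g → l ≡ g + (l - g)
          ring = solve-∀
        level≡ (suc k) = solve-next (tGap p k) (+ s) (tGap p (suc k)) (level w (+ k + + toℕ r)) (level w (+ suc k + + toℕ r)) e
          (level≡ k) (begin
          tGap p k + + s - tGap p (suc k)                ≡⟨ sym (content-coreWord p closed-s closed-t k) ⟩
          content (coreWord p) (residue t (+ k)) * + t
            ≡⟨ cong (_* + t) (trans (sym (content-rotate r (coreWord p) (+ k))) (same _)) ⟩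
          content w (residue t (+ k + + toℕ r)) * + t    ≡⟨ diff k r ⟩
          level w (+ k + + toℕ r) + + s - level w (+ suc k + + toℕ r) ∎)
          where
          open ≡-Reasoning
          solve-next : ∀ g s g′ l l′ e → l ≡ g + e → g + s - g′ ≡ l + s - l′ → l′ ≡ g′ + e
          solve-next g s g′ _ l′ e refl eq = trans (ring₁ g s l′ e) (trans (cong (λ z → g + e + s - z) (sym eq)) (ring₂ g s g′ e))
            where
            ring₁ : ∀ g s l′ e → l′ ≡ g + e + s - (g + e + s - l′)
            ring₁ = solve-∀
            ring₂ : ∀ g s g′ e → g + e + s - (g + s - g′) ≡ g′ + e
            ring₂ = solve-∀

        tGap-≈ : ∀ k → tGap p k ≈[ t ] + k * + s
        tGap-≈ k = gap-≈ p t (+ k * + s)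

        e≈ : e ≈[ t ] + toℕ r * + s
        e≈ = ≈-trans (≈-- (level-≈ w (+ 0 + + toℕ r)) (tGap-≈ 0)) (≈-reflexive (ring (+ toℕ r) (+ s)))
          where
          ring : ∀ r s → (0ℤ + r) * s - 0ℤ * s ≡ r * s
          ring = solve-∀

        to : ∀ {x} → betaSet p x → Under w (x + e)
        to {x} b = shift (∈⇒below-gap closed-t (gap-isGap p t (+ k * + s)) (≈-trans (κ-≈ x) (≈-sym (tGap-≈ k))) b)
          where
          k = toℕ (κ x)
          ring : ∀ g m e → g - m + e ≡ g + e - m
          ring = solve-∀
          shift : (∃ λ l → x ≡ tGap p k - + suc l * + t) → Under w (x + e)
          shift (l , eq) = below-gap (under-closed-t w) (level-gap w (+ k + + toℕ r)) l
            (trans (cong (_+ e) eq) (trans (ring (tGap p k) (+ suc l * + t) e) (cong (_- + suc l * + t) (sym (level≡ k)))))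

        of : ∀ {y} → Under w y → betaSet p (y - e)
        of {y} b = shift (∈⇒below-gap (under-closed-t w) (level-gap w (+ k + + toℕ r)) y≈ b)
          where
          k = toℕ (κ (y - e))
          ring : ∀ y e → y ≡ y - e + e
          ring = solve-∀
          ring′ : ∀ k r s → k * s + r * s ≡ (k + r) * s
          ring′ = solve-∀
          ring″ : ∀ g m e → g + e - m - e ≡ g - m
          ring″ = solve-∀
          y≈ : y ≈[ t ] level w (+ k + + toℕ r)
          y≈ = ≈-trans (≈-reflexive (ring y e)) (≈-trans (≈-+ (κ-≈ (y - e)) e≈)
                 (≈-trans (≈-reflexive (ring′ (+ k) (+ toℕ r) (+ s))) (≈-sym (level-≈ w (+ k + + toℕ r)))))
          shift : (∃ λ l → y ≡ level w (+ k + + toℕ r) - + suc l * + t) → betaSet p (y - e)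
          shift (l , eq) = below-gap closed-t (gap-isGap p t (+ k * + s)) l
            (trans (cong (_- e) eq) (trans (cong (λ z → z - + suc l * + t - e) (level≡ k)) (ring″ (tGap p k) (+ suc l * + t) e)))

        p⊆w : ∀ x → betaSet p x → betaSet (wordPartition w) (x + (e - ν))
        p⊆w x b = subst (betaSet (wordPartition w)) (ring x e ν) (under⇒betaSet w (to b))
          where
          ring : ∀ x e ν → x + e - ν ≡ x + (e - ν)
          ring = solve-∀

        w⊆p : ∀ y → betaSet (wordPartition w) y → betaSet p (y - (e - ν))
        w⊆p y b = subst (betaSet p) (ring y e ν) (of (betaSet⇒under w b))
          where
          ring : ∀ y e ν → y + ν - e ≡ y - (e - ν)
          ring = solve-∀

      content-rotate⇒≗ : ∀ i → part p i ≡ part (wordPartition w) i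
      content-rotate⇒≗ = translate⇒part≗ p (wordPartition w) (e - ν) p⊆w w⊆p

      -- From e ≡ r s modulo t and e = ν. At most one rotation of the word of p therefore has the
      -- content of w, and the t rotations are counted without repetition.
      content-rotate⇒κ : r ≡ κ ν
      content-rotate⇒κ = trans (sym (residue-toℕ t r)) (trans (sym (κ-s (+ toℕ r)))
        (κ-cong (≈-trans (≈-sym e≈) (≈-reflexive (trans (ring e ν)
          (trans (cong (_+ ν) (translation-trivial p (wordPartition w) (e - ν) p⊆w w⊆p)) (ℤ.+-identityˡ ν)))))))
        where
        ring : ∀ e ν → e ≡ e - ν + ν
        ring = solve-∀

-- Power sums and the size of the core of a word

S₁ S₂ : ℕ → ℤ
S₁ n = sum {n} (λ i → + toℕ i)
S₂ n = sum {n} (λ i → + toℕ i * + toℕ i)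

2S₁ : ∀ n → + 2 * S₁ n ≡ + n * (+ n - 1ℤ)
2S₁ zero    = refl
2S₁ (suc n) = begin
  + 2 * S₁ (suc n)              ≡⟨ cong (_*_ (+ 2)) (sum-snoc n (λ k → + k)) ⟩
  + 2 * (S₁ n + + n)            ≡⟨ ℤ.*-distribˡ-+ (+ 2) (S₁ n) (+ n) ⟩
  + 2 * S₁ n + + 2 * + n        ≡⟨ cong (_+ + 2 * + n) (2S₁ n) ⟩
  + n * (+ n - 1ℤ) + + 2 * + n  ≡⟨ ring (+ n) ⟩
  (1ℤ + + n) * (1ℤ + + n - 1ℤ)  ≡⟨ cong (λ z → z * (z - 1ℤ)) (sym (ℤ.pos-+ 1 n)) ⟩
  + suc n * (+ suc n - 1ℤ)      ∎
  where
  open ≡-Reasoning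
  ring : ∀ n → n * (n - 1ℤ) + + 2 * n ≡ (1ℤ + n) * (1ℤ + n - 1ℤ)
  ring = solve-∀

6S₂ : ∀ n → + 6 * S₂ n ≡ + n * (+ n - 1ℤ) * (+ 2 * + n - 1ℤ)
6S₂ zero    = refl
6S₂ (suc n) = begin
  + 6 * S₂ (suc n)              ≡⟨ cong (_*_ (+ 6)) (sum-snoc n (λ k → + k * + k)) ⟩
  + 6 * (S₂ n + + n * + n)      ≡⟨ ℤ.*-distribˡ-+ (+ 6) (S₂ n) (+ n * + n) ⟩
  + 6 * S₂ n + + 6 * (+ n * + n) ≡⟨ cong (_+ + 6 * (+ n * + n)) (6S₂ n) ⟩
  + n * (+ n - 1ℤ) * (+ 2 * + n - 1ℤ) + + 6 * (+ n * + n) ≡⟨ ring (+ n) ⟩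
  (1ℤ + + n) * (1ℤ + + n - 1ℤ) * (+ 2 * (1ℤ + + n) - 1ℤ)
    ≡⟨ cong (λ z → z * (z - 1ℤ) * (+ 2 * z - 1ℤ)) (sym (ℤ.pos-+ 1 n)) ⟩
  + suc n * (+ suc n - 1ℤ) * (+ 2 * + suc n - 1ℤ) ∎
  where
  open ≡-Reasoning
  ring : ∀ n → n * (n - 1ℤ) * (+ 2 * n - 1ℤ) + + 6 * (n * n) ≡
               (1ℤ + n) * (1ℤ + n - 1ℤ) * (+ 2 * (1ℤ + n) - 1ℤ)
  ring = solve-∀

sum-affine : ∀ n a b → sum {n} (λ q → a * + toℕ q + b) ≡ a * S₁ n + + n * b
sum-affine n a b = trans (∑-distrib-+ {n} (λ q → a * + toℕ q) (λ _ → b))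
  (cong₂ _+_ (sym (*-distribˡ-sum {n} a (λ q → + toℕ q))) (sum-const n b))

sum-truncate : ∀ (f : ℕ → ℤ) {Q M} → Q ℕ.≤ M →
               sum {M} (λ i → ⟦ toℕ i ℕ.<? Q ⟧ * f (toℕ i)) ≡ sum {Q} (f ∘ toℕ)
sum-truncate f {Q} Q≤M = go (ℕ.≤⇒≤′ Q≤M)
  where
  open ≡-Reasoning
  go : ∀ {M} → Q ℕ.≤′ M → sum {M} (λ i → ⟦ toℕ i ℕ.<? Q ⟧ * f (toℕ i)) ≡ sum {Q} (f ∘ toℕ)
  go ℕ.≤′-refl = sum-cong-≗ {Q} (λ i → trans (cong (_* f (toℕ i)) (⟦⟧-yes (toℕ i ℕ.<? Q) (toℕ<n i))) (ℤ.*-identityˡ _))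
  go {suc M} (ℕ.≤′-step Q≤M) = begin
    sum {suc M} (λ i → ⟦ toℕ i ℕ.<? Q ⟧ * f (toℕ i))
      ≡⟨ sum-snoc M (λ i → ⟦ i ℕ.<? Q ⟧ * f i) ⟩
    sum {M} (λ i → ⟦ toℕ i ℕ.<? Q ⟧ * f (toℕ i)) + ⟦ M ℕ.<? Q ⟧ * f M
      ≡⟨ cong₂ _+_ (go Q≤M) (cong (_* f M) (⟦⟧-no (M ℕ.<? Q) (ℕ.≤⇒≯ (ℕ.≤′⇒≤ Q≤M)))) ⟩
    sum {Q} (f ∘ toℕ) + 0ℤ
      ≡⟨ ℤ.+-identityʳ _ ⟩
    sum {Q} (f ∘ toℕ) ∎

sum-classes : ∀ m t (f : ℕ → ℤ) →
              sum {m ℕ.* t} (f ∘ toℕ) ≡ sum {t} (λ j → sum {m} (λ q → f (t ℕ.* toℕ q ℕ.+ toℕ j)))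
sum-classes m t f = begin
  sum {m ℕ.* t} (f ∘ toℕ)
    ≡⟨ sum-combine m t (f ∘ toℕ) ⟩
  sum {m} (λ q → sum {t} (λ j → f (toℕ (combine q j))))
    ≡⟨ sum-cong-≗ {m} (λ q → sum-cong-≗ {t} (λ j → cong f (toℕ-combine q j))) ⟩
  sum {m} (λ q → sum {t} (λ j → f (t ℕ.* toℕ q ℕ.+ toℕ j)))
    ≡⟨ ∑-comm {m} {t} (λ q j → f (t ℕ.* toℕ q ℕ.+ toℕ j)) ⟩
  sum {t} (λ j → sum {m} (λ q → f (t ℕ.* toℕ q ℕ.+ toℕ j))) ∎
  where open ≡-Reasoning

module Sizes (s t : ℕ) .{{_ : ℕ.NonZero s}} .{{_ : ℕ.NonZero t}} (u : ℤ) (us≈1 : u * + s ≈[ t ] 1ℤ) where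

  open Letters s t u us≈1
  open Heights s t u us≈1
  open ≡-Reasoning

  private
    T = + t

  -- Multiplication by u modulo t, with multiplication by s as inverse. It turns sums over residues
  -- j, natural for counting beads, into sums over the k with j ≡ k s, natural for heights.
  classPermutation : Permutation′ t
  classPermutation = permutation (λ j → κ (+ toℕ j)) (λ k → residue t (+ toℕ k * + s))
    (λ k → trans (κ-cong (≈-sym (residue-≈ t (+ toℕ k * + s)))) (trans (κ-s (+ toℕ k)) (residue-toℕ t k)))
    (λ j → trans (residue-cong t (≈-sym (κ-≈ (+ toℕ j)))) (residue-toℕ t j))

  module _ (w : Vec (Fin t) s) where

    private
      H : Fin t → ℤ
      H k = height w (toℕ k)

      -- The first gap congruent to j. When it is written as t Q + j, the nonnegative beads of its
      -- class are the t q + j with q < Q.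
      g : Fin t → ℤ
      g j = H (κ (+ toℕ j))

      quotient : ∀ j → ∃ λ Q → Q ℕ.≤ 2 ℕ.* s × g j ≡ T * + Q + + toℕ j
      quotient j = go (height-bounds w (κ (+ toℕ j)))
                      (≈-split (≈-trans (≈-reflexive (level-κ w K (κ-≈ (+ toℕ j))))
                                        (≈-trans (level-≈ w K) (≈-sym (κ-≈ (+ toℕ j))))))
        where
        K = + toℕ (κ (+ toℕ j))
        go : (∃ λ h → g j ≡ + h × h ℕ.≤ window) →
             ((∃ λ k → g j ≡ + toℕ j + + k * T) ⊎ (∃ λ k → g j ≡ + toℕ j - + suc k * T)) → _
        go (h , g≡ , h≤) (inj₁ (k , eq)) = k , ℕ.*-cancelʳ-≤ k (2 ℕ.* s) t (ℕ.≤-trans (ℕ.m≤n+m _ (toℕ j))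
              (subst (ℕ._≤ window) (ℤ.+-injective (trans (sym g≡) (trans eq (trans (cong (_+_ (+ toℕ j)) (sym (ℤ.pos-* k t)))
                (sym (ℤ.pos-+ (toℕ j) (k ℕ.* t))))))) h≤)) ,
          trans eq (trans (ℤ.+-comm (+ toℕ j) (+ k * T)) (cong (_+ + toℕ j) (ℤ.*-comm (+ k) T)))
        -- A negative quotient would make the height negative, because j < t.
        go (h , g≡ , h≤) (inj₂ (k , eq)) = contradiction (begin
            + (h ℕ.+ suc k ℕ.* t)       ≡⟨ ℤ.pos-+ h (suc k ℕ.* t) ⟩
            + h + + (suc k ℕ.* t)       ≡⟨ cong₂ _+_ (trans (sym g≡) eq) (ℤ.pos-* (suc k) t) ⟩
            + toℕ j - + suc k * T + + suc k * T ≡⟨ ring (+ toℕ j) (+ suc k * T) ⟩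
            + toℕ j ∎)
          (λ e → ℕ.<⇒≱ (toℕ<n j) (ℕ.≤-trans (ℕ.≤-trans (ℕ.m≤m+n t (k ℕ.* t)) (ℕ.m≤n+m _ h)) (ℕ.≤-reflexive (ℤ.+-injective e))))
          where
          ring : ∀ j μ → j - μ + μ ≡ j
          ring = solve-∀

      Q : Fin t → ℕ
      Q j = proj₁ (quotient j)

      g≡ : ∀ j → g j ≡ T * + Q j + + toℕ j
      g≡ j = proj₂ (proj₂ (quotient j))

      bead⇔ : ∀ j q → ⟦ under? w (+ (t ℕ.* q ℕ.+ toℕ j)) ⟧ ≡ ⟦ q ℕ.<? Q j ⟧
      bead⇔ j q = ⟦⟧-cong (under? w (+ (t ℕ.* q ℕ.+ toℕ j))) (q ℕ.<? Q j)
        (λ lt → ℕ.*-cancelˡ-< t q (Q j) (ℕ.+-cancelʳ-< (toℕ j) _ _ (ℤ.drop‿+<+ (subst (+ (t ℕ.* q ℕ.+ toℕ j) <_) lev lt))))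
        (λ lt → subst (+ (t ℕ.* q ℕ.+ toℕ j) <_) (sym lev) (+<+ (ℕ.+-monoˡ-< (toℕ j) (ℕ.*-monoʳ-< t lt))))
        where
        lev : height w (toℕ (κ (+ (t ℕ.* q ℕ.+ toℕ j)))) ≡ + (t ℕ.* Q j ℕ.+ toℕ j)
        lev = trans (cong H (κ-cong {y = + toℕ j} (modulo (+ q) (trans (ℤ.pos-+ (t ℕ.* q) (toℕ j))
                (trans (cong (_+ + toℕ j) (ℤ.pos-* t q)) (ring T (+ q) (+ toℕ j)))))))
              (trans (g≡ j) (sym (trans (ℤ.pos-+ (t ℕ.* Q j) (toℕ j)) (cong (_+ + toℕ j) (ℤ.pos-* t (Q j))))))
          where
          ring : ∀ t q j → t * q + j ≡ j + q * t
          ring = solve-∀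

      class-sum : ∀ (f : ℕ → ℤ) → sum {window} (λ i → ⟦ under? w (+ toℕ i) ⟧ * f (toℕ i)) ≡
                        sum (λ j → sum {Q j} (λ q → f (t ℕ.* toℕ q ℕ.+ toℕ j)))
      class-sum f = trans (sum-classes (2 ℕ.* s) t (λ X → ⟦ under? w (+ X) ⟧ * f X)) (sum-cong-≗ {t} λ j →
        trans (sum-cong-≗ {2 ℕ.* s} λ q → cong (_* f (t ℕ.* toℕ q ℕ.+ toℕ j)) (bead⇔ j (toℕ q)))
              (sum-truncate (λ q → f (t ℕ.* q ℕ.+ toℕ j)) (proj₁ (proj₂ (quotient j)))))

      ν = + charge w
      M = sum {window} (λ i → ⟦ under? w (+ toℕ i) ⟧ * + toℕ i)

      n≡ : T * ν ≡ sum g - S₁ t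
      n≡ = begin
        T * ν
          ≡⟨ cong (_*_ T) (R.beads≡ w) ⟩
        T * sum {window} (λ i → ⟦ under? w (+ toℕ i) ⟧)
          ≡⟨ cong (_*_ T) (sum-cong-≗ {window} (λ i → sym (ℤ.*-identityʳ ⟦ under? w (+ toℕ i) ⟧))) ⟩
        T * sum {window} (λ i → ⟦ under? w (+ toℕ i) ⟧ * 1ℤ)
          ≡⟨ cong (_*_ T) (class-sum (λ _ → 1ℤ)) ⟩
        T * sum (λ j → sum {Q j} (λ _ → 1ℤ))
          ≡⟨ *-distribˡ-sum {t} T (λ j → sum {Q j} (λ _ → 1ℤ)) ⟩
        sum (λ j → T * sum {Q j} (λ _ → 1ℤ))
          ≡⟨ sum-cong-≗ {t} (λ j → trans (cong (_*_ T) (sum-const (Q j) 1ℤ))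
               (trans (ring T (+ Q j) (+ toℕ j)) (cong (_- + toℕ j) (sym (g≡ j))))) ⟩
        sum (λ j → g j - + toℕ j)
          ≡⟨ sum-- g (λ j → + toℕ j) ⟩
        sum g - S₁ t ∎
        where
        ring : ∀ t q j → t * (q * 1ℤ) ≡ t * q + j - j
        ring = solve-∀

      M≡ : T * (+ 2 * M) ≡ sum (λ j → g j * g j) - S₂ t - T * (sum g - S₁ t)
      M≡ = begin
        T * (+ 2 * M)
          ≡⟨ cong (λ z → T * (+ 2 * z)) (class-sum (λ X → + X)) ⟩
        T * (+ 2 * sum (λ j → μ j))
          ≡⟨ sym (ℤ.*-assoc T (+ 2) (sum μ)) ⟩
        T * + 2 * sum (λ j → μ j)
          ≡⟨ *-distribˡ-sum {t} (T * + 2) μ ⟩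
        sum (λ j → T * + 2 * μ j)
          ≡⟨ sum-cong-≗ {t} per-class ⟩
        sum (λ j → g j * g j - + toℕ j * + toℕ j - T * (g j - + toℕ j))
          ≡⟨ sum-- (λ j → g j * g j - + toℕ j * + toℕ j) (λ j → T * (g j - + toℕ j)) ⟩
        sum (λ j → g j * g j - + toℕ j * + toℕ j) - sum (λ j → T * (g j - + toℕ j))
          ≡⟨ cong₂ _-_ (sum-- (λ j → g j * g j) (λ j → + toℕ j * + toℕ j))
               (trans (sym (*-distribˡ-sum {t} T (λ j → g j - + toℕ j))) (cong (_*_ T) (sum-- g (λ j → + toℕ j)))) ⟩
        sum (λ j → g j * g j) - S₂ t - T * (sum g - S₁ t) ∎
        where
        μ : Fin t → ℤ
        μ j = sum {Q j} (λ q → + (t ℕ.* toℕ q ℕ.+ toℕ j))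
        per-class : ∀ j → T * + 2 * μ j ≡ g j * g j - + toℕ j * + toℕ j - T * (g j - + toℕ j)
        per-class j = begin
          T * + 2 * μ j
            ≡⟨ cong (_*_ (T * + 2)) (trans (sum-cong-≗ {Q j} (λ q → trans (ℤ.pos-+ (t ℕ.* toℕ q) (toℕ j))
                 (cong (_+ + toℕ j) (ℤ.pos-* t (toℕ q))))) (sum-affine (Q j) T (+ toℕ j))) ⟩
          T * + 2 * (T * S₁ (Q j) + + Q j * + toℕ j)
            ≡⟨ ring₁ T (S₁ (Q j)) (+ Q j) (+ toℕ j) ⟩
          T * T * (+ 2 * S₁ (Q j)) + + 2 * T * + Q j * + toℕ j
            ≡⟨ cong (λ z → T * T * z + + 2 * T * + Q j * + toℕ j) (2S₁ (Q j)) ⟩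
          T * T * (+ Q j * (+ Q j - 1ℤ)) + + 2 * T * + Q j * + toℕ j
            ≡⟨ ring₂ T (+ Q j) (+ toℕ j) ⟩
          (T * + Q j + + toℕ j) * (T * + Q j + + toℕ j) - + toℕ j * + toℕ j - T * (T * + Q j + + toℕ j - + toℕ j)
            ≡⟨ cong (λ z → z * z - + toℕ j * + toℕ j - T * (z - + toℕ j)) (sym (g≡ j)) ⟩
          g j * g j - + toℕ j * + toℕ j - T * (g j - + toℕ j) ∎
          where
          ring₁ : ∀ t S q j → t * + 2 * (t * S + q * j) ≡ t * t * (+ 2 * S) + + 2 * t * q * j
          ring₁ = solve-∀
          ring₂ : ∀ t q j → t * t * (q * (q - 1ℤ)) + + 2 * t * q * j ≡
                            (t * q + j) * (t * q + j) - j * j - t * (t * q + j - j)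
          ring₂ = solve-∀

      size-g : + 2 * T * T * + size (wordPartition w) ≡
               T * sum (λ j → g j * g j) - sum g * sum g - (T * S₂ t - S₁ t * S₁ t)
      size-g = begin
        + 2 * T * T * + size (wordPartition w)
          ≡⟨ ring₁ T (+ size (wordPartition w)) ⟩
        T * T * (+ 2 * + size (wordPartition w))
          ≡⟨ cong (_*_ (T * T)) (R.size≡ w) ⟩
        T * T * (+ 2 * M - ν * (ν - 1ℤ))
          ≡⟨ ring₂ T M ν ⟩
        T * (T * (+ 2 * M)) - (T * ν) * (T * ν) + T * (T * ν)
          ≡⟨ cong₂ (λ a b → T * a - b * b + T * b) M≡ n≡ ⟩
        T * (ΣG² - S₂ t - T * (ΣG - S₁ t)) - (ΣG - S₁ t) * (ΣG - S₁ t) + T * (ΣG - S₁ t)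
          ≡⟨ ring₃ T ΣG² ΣG (S₁ t) (S₂ t) ⟩
        -- All terms beyond the desired ones, including those stemming from the charge, combine into
        -- a multiple of 2 S₁ - t (t - 1), which is zero.
        T * ΣG² - ΣG * ΣG - (T * S₂ t - S₁ t * S₁ t) + (ΣG - S₁ t) * (+ 2 * S₁ t - T * (T - 1ℤ))
          ≡⟨ cong (λ z → T * ΣG² - ΣG * ΣG - (T * S₂ t - S₁ t * S₁ t) + (ΣG - S₁ t) * (z - T * (T - 1ℤ))) (2S₁ t) ⟩
        T * ΣG² - ΣG * ΣG - (T * S₂ t - S₁ t * S₁ t) + (ΣG - S₁ t) * (T * (T - 1ℤ) - T * (T - 1ℤ))
          ≡⟨ ring₄ (T * ΣG² - ΣG * ΣG - (T * S₂ t - S₁ t * S₁ t)) (ΣG - S₁ t) (T * (T - 1ℤ)) ⟩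
        T * ΣG² - ΣG * ΣG - (T * S₂ t - S₁ t * S₁ t) ∎
        where
        ΣG² = sum (λ j → g j * g j)
        ΣG = sum g
        ring₁ : ∀ t z → + 2 * t * t * z ≡ t * t * (+ 2 * z)
        ring₁ = solve-∀
        ring₂ : ∀ t μ ν → t * t * (+ 2 * μ - ν * (ν - 1ℤ)) ≡ t * (t * (+ 2 * μ)) - (t * ν) * (t * ν) + t * (t * ν)
        ring₂ = solve-∀
        ring₃ : ∀ t g₂ g j j₂ → t * (g₂ - j₂ - t * (g - j)) - (g - j) * (g - j) + t * (g - j) ≡
                t * g₂ - g * g - (t * j₂ - j * j) + (g - j) * (+ 2 * j - t * (t - 1ℤ))
        ring₃ = solve-∀
        ring₄ : ∀ x y z → x + y * (z - z) ≡ x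
        ring₄ = solve-∀

    size-height : + 2 * T * T * + size (wordPartition w) ≡
      T * sum {t} (λ k → height w (toℕ k) * height w (toℕ k)) -
      sum {t} (λ k → height w (toℕ k)) * sum {t} (λ k → height w (toℕ k)) - (T * S₂ t - S₁ t * S₁ t)
    size-height = trans size-g (sym (cong₂ (λ a b → T * a - b * b - (T * S₂ t - S₁ t * S₁ t))
      (sum-permute (λ k → H k * H k) classPermutation) (sum-permute H classPermutation)))

-- Moments of additive statistics of random words

additive : ∀ {t n} → (Fin t → ℤ) → Vec (Fin t) n → ℤ
additive ξ w = sum (λ i → ξ (lookup w i))

-- The letters of a uniformly random word are independent, so the variance of a
-- centred additive statistic is n times that of one letter.
second-moment : ∀ t n (ξ : Fin t → ℤ) → sum ξ ≡ 0ℤ →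
  + t * ∑ʷ t n (λ w → additive ξ w * additive ξ w) ≡ + n * + (t ℕ.^ n) * sum (λ j → ξ j * ξ j)
second-moment t zero ξ centred = ring (+ t)
  where
  ring : ∀ t → t * (0ℤ + 0ℤ) ≡ 0ℤ
  ring = solve-∀
second-moment t (suc n) ξ centred = begin
  T * ∑ʷ t (suc n) (λ w → additive ξ w * additive ξ w)
    ≡⟨ cong (_*_ T) (∑ʷ-suc t n (λ w → additive ξ w * additive ξ w)) ⟩
  T * sum {t} (λ j → ∑ʷ t n (λ w → (ξ j + additive ξ w) * (ξ j + additive ξ w)))
    ≡⟨ cong (_*_ T) (sum-cong-≗ {t} expand) ⟩
  T * sum {t} (λ j → M * (ξ j * ξ j) + ξ j * (+ 2 * E₁) + E₂)
    ≡⟨ cong (_*_ T) (trans (∑-distrib-+ {t} (λ j → M * (ξ j * ξ j) + ξ j * (+ 2 * E₁)) (λ _ → E₂))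
         (cong₂ _+_ (∑-distrib-+ {t} (λ j → M * (ξ j * ξ j)) (λ j → ξ j * (+ 2 * E₁))) (sum-const t E₂))) ⟩
  T * (sum {t} (λ j → M * (ξ j * ξ j)) + sum {t} (λ j → ξ j * (+ 2 * E₁)) + T * E₂)
    -- The mixed term carries the factor Σ ξ, which vanishes.
    ≡⟨ cong₂ (λ a b → T * (a + b + T * E₂)) (sym (*-distribˡ-sum {t} M (λ j → ξ j * ξ j)))
         (trans (sym (*-distribʳ-sum {t} (+ 2 * E₁) ξ)) (trans (cong (_* (+ 2 * E₁)) centred) (ℤ.*-zeroˡ (+ 2 * E₁)))) ⟩
  T * (M * D + 0ℤ + T * E₂)
    ≡⟨ cong (λ z → T * (M * D + 0ℤ + z)) (second-moment t n ξ centred) ⟩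
  T * (M * D + 0ℤ + + n * M * D)
    ≡⟨ ring T M D (+ n) ⟩
  (1ℤ + + n) * (T * M) * D
    ≡⟨ cong₂ (λ a b → a * b * D) (sym (ℤ.pos-+ 1 n)) (sym (ℤ.pos-* t (t ℕ.^ n))) ⟩
  + suc n * + (t ℕ.^ suc n) * D ∎
  where
  open ≡-Reasoning
  T = + t
  M = + (t ℕ.^ n)
  D = sum (λ j → ξ j * ξ j)
  E₁ = ∑ʷ t n (additive ξ)
  E₂ = ∑ʷ t n (λ w → additive ξ w * additive ξ w)
  ring : ∀ t n d m → t * (n * d + 0ℤ + m * n * d) ≡ (1ℤ + m) * (t * n) * d
  ring = solve-∀
  square : ∀ x y → (x + y) * (x + y) ≡ x * x + + 2 * x * y + y * y
  square = solve-∀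
  expand : ∀ j → ∑ʷ t n (λ w → (ξ j + additive ξ w) * (ξ j + additive ξ w)) ≡
                 M * (ξ j * ξ j) + ξ j * (+ 2 * E₁) + E₂
  expand j = begin
    sum {t ℕ.^ n} (λ a → (ξ j + X a) * (ξ j + X a))
      ≡⟨ sum-cong-≗ {t ℕ.^ n} (λ a → square (ξ j) (X a)) ⟩
    sum {t ℕ.^ n} (λ a → ξ j * ξ j + + 2 * ξ j * X a + X a * X a)
      ≡⟨ trans (∑-distrib-+ {t ℕ.^ n} (λ a → ξ j * ξ j + + 2 * ξ j * X a) (λ a → X a * X a))
           (cong (_+ E₂) (∑-distrib-+ {t ℕ.^ n} (λ _ → ξ j * ξ j) (λ a → + 2 * ξ j * X a))) ⟩
    sum {t ℕ.^ n} (λ _ → ξ j * ξ j) + sum {t ℕ.^ n} (λ a → + 2 * ξ j * X a) + E₂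
      ≡⟨ cong₂ (λ a b → a + b + E₂) (sum-const (t ℕ.^ n) (ξ j * ξ j)) (sym (*-distribˡ-sum {t ℕ.^ n} (+ 2 * ξ j) X)) ⟩
    M * (ξ j * ξ j) + + 2 * ξ j * E₁ + E₂
      ≡⟨ cong (λ z → M * (ξ j * ξ j) + z + E₂) (comm (ξ j) E₁) ⟩
    M * (ξ j * ξ j) + ξ j * (+ 2 * E₁) + E₂ ∎
    where
    X : Fin (t ℕ.^ n) → ℤ
    X a = additive ξ (word t n a)
    comm : ∀ x e → + 2 * x * e ≡ x * (+ 2 * e)
    comm = solve-∀

count-≥ : ∀ {n} (k : Fin n) → sum (λ (l : Fin n) → ⟦ toℕ k ℕ.≤? toℕ l ⟧) ≡ + n - + toℕ k
count-≥ {n} k = begin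
  sum {n} (λ l → ⟦ toℕ k ℕ.≤? toℕ l ⟧)
    ≡⟨ sum-cong-≗ {n} complement ⟩
  sum {n} (λ l → 1ℤ - ⟦ toℕ l ℕ.<? toℕ k ⟧ * 1ℤ)
    ≡⟨ sum-- {n} (λ _ → 1ℤ) (λ l → ⟦ toℕ l ℕ.<? toℕ k ⟧ * 1ℤ) ⟩
  sum {n} (λ _ → 1ℤ) - sum {n} (λ l → ⟦ toℕ l ℕ.<? toℕ k ⟧ * 1ℤ)
    ≡⟨ cong₂ _-_ (sum-const n 1ℤ) (trans (sum-truncate (λ _ → 1ℤ) (ℕ.<⇒≤ (toℕ<n k))) (sum-const (toℕ k) 1ℤ)) ⟩
  + n * 1ℤ - + toℕ k * 1ℤ
    ≡⟨ cong₂ _-_ (ℤ.*-identityʳ (+ n)) (ℤ.*-identityʳ (+ toℕ k)) ⟩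
  + n - + toℕ k ∎
  where
  open ≡-Reasoning
  complement : ∀ l → ⟦ toℕ k ℕ.≤? toℕ l ⟧ ≡ 1ℤ - ⟦ toℕ l ℕ.<? toℕ k ⟧ * 1ℤ
  complement l with toℕ l ℕ.<? toℕ k
  ... | yes l<k = ⟦⟧-no (toℕ k ℕ.≤? toℕ l) (ℕ.<⇒≱ l<k)
  ... | no l≮k  = ⟦⟧-yes (toℕ k ℕ.≤? toℕ l) (ℕ.≮⇒≥ l≮k)

count-≤ : ∀ {n} (l : Fin n) → sum (λ (k : Fin n) → ⟦ toℕ k ℕ.≤? toℕ l ⟧) ≡ 1ℤ + + toℕ l
count-≤ {n} l = begin
  sum {n} (λ k → ⟦ toℕ k ℕ.≤? toℕ l ⟧)
    ≡⟨ sum-cong-≗ {n} (λ k → trans (⟦⟧-cong (toℕ k ℕ.≤? toℕ l) (toℕ k ℕ.<? suc (toℕ l)) s≤s (λ { (s≤s le) → le }))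
                                   (sym (ℤ.*-identityʳ _))) ⟩
  sum {n} (λ k → ⟦ toℕ k ℕ.<? suc (toℕ l) ⟧ * 1ℤ)
    ≡⟨ sum-truncate (λ _ → 1ℤ) (toℕ<n l) ⟩
  sum {suc (toℕ l)} (λ _ → 1ℤ)
    ≡⟨ trans (sum-const (suc (toℕ l)) 1ℤ) (ℤ.*-identityʳ _) ⟩
  + suc (toℕ l)
    ≡⟨ ℤ.pos-+ 1 (toℕ l) ⟩
  1ℤ + + toℕ l ∎
  where open ≡-Reasoning

module Averages (s t : ℕ) .{{_ : ℕ.NonZero s}} .{{_ : ℕ.NonZero t}} (u : ℤ) (us≈1 : u * + s ≈[ t ] 1ℤ) where

  open Letters s t u us≈1
  open Heights s t u us≈1
  open Sizes s t u us≈1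
  open ≡-Reasoning

  private
    S = + s
    T = + t
    M = + (t ℕ.^ s)

  -- The contribution k + t [k ≤ l] of a letter l to the height at k, minus its mean t: of the t
  -- letters, t - k are at least k.
  ξ : Fin t → Fin t → ℤ
  ξ k l = + toℕ k + ⟦ toℕ k ℕ.≤? toℕ l ⟧ * T - T

  η : Fin t → ℤ
  η l = sum (λ k → ξ k l)

  private
    sum-ξ-shape : ∀ {n} (a b : Fin n → ℤ) → sum (λ i → a i + b i * T - T) ≡ sum a + sum b * T - + n * T
    sum-ξ-shape {n} a b = trans (sum-- {n} (λ i → a i + b i * T) (λ _ → T))
      (cong₂ _-_ (trans (∑-distrib-+ {n} a (λ i → b i * T)) (cong (_+_ (sum a)) (sym (*-distribʳ-sum {n} T b))))
                 (sum-const n T))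

  height-ξ : ∀ w k → height w (toℕ k) ≡ additive (ξ k) w + S * T
  height-ξ w k = sym (trans (cong (_+ S * T) (trans (sum-ξ-shape {s} (λ _ → + toℕ k) (λ i → ⟦ toℕ k ℕ.≤? toℕ (lookup w i) ⟧))
      (cong (λ z → z + atLeast w (toℕ k) * T - S * T) (trans (sum-const s (+ toℕ k)) (ℤ.*-comm S (+ toℕ k))))))
    (ring (+ toℕ k * S + atLeast w (toℕ k) * T) (S * T)))
    where
    ring : ∀ x y → x - y + y ≡ x
    ring = solve-∀

  ξ-centred : ∀ k → sum (ξ k) ≡ 0ℤ
  ξ-centred k = trans (sum-ξ-shape {t} (λ _ → + toℕ k) (λ l → ⟦ toℕ k ℕ.≤? toℕ l ⟧))
    (trans (cong₂ (λ a b → a + b * T - T * T) (sum-const t (+ toℕ k)) (count-≥ k)) (ring T (+ toℕ k)))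
    where
    ring : ∀ t k → t * k + (t - k) * t - t * t ≡ 0ℤ
    ring = solve-∀

  η≡ : ∀ l → η l ≡ T * + toℕ l - S₁ t
  η≡ l = trans (sum-ξ-shape {t} (λ k → + toℕ k) (λ k → ⟦ toℕ k ℕ.≤? toℕ l ⟧))
    (trans (cong (λ z → S₁ t + z * T - T * T) (count-≤ l))
    (trans (ring₁ (S₁ t) (+ toℕ l) T) (trans (cong (λ z → T * + toℕ l - S₁ t + (z - T * (T - 1ℤ))) (2S₁ t)) (ring₂ (T * + toℕ l - S₁ t) (T * (T - 1ℤ))))))
    where
    ring₁ : ∀ j l t → j + (1ℤ + l) * t - t * t ≡ t * l - j + (+ 2 * j - t * (t - 1ℤ))
    ring₁ = solve-∀
    ring₂ : ∀ x y → x + (y - y) ≡ x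
    ring₂ = solve-∀

  η-centred : sum η ≡ 0ℤ
  η-centred = trans (∑-comm {t} {t} (λ l k → ξ k l)) (sum-zero {t} (λ k → sum (ξ k)) ξ-centred)

  -- `ξ k` takes the value k on the t - k letters from k on, and k - t on the k smaller ones.
  ∑-ξ² : ∀ k → sum (λ l → ξ k l * ξ k l) ≡ T * (T * + toℕ k - + toℕ k * + toℕ k)
  ∑-ξ² k = begin
    sum {t} (λ l → ξ k l * ξ k l)
      ≡⟨ sum-cong-≗ {t} (λ l → square (toℕ k ℕ.≤? toℕ l)) ⟩
    sum {t} (λ l → (K - T) * (K - T) + ⟦ toℕ k ℕ.≤? toℕ l ⟧ * (+ 2 * T * (K - T) + T * T))
      ≡⟨ ∑-distrib-+ {t} (λ _ → (K - T) * (K - T)) (λ l → ⟦ toℕ k ℕ.≤? toℕ l ⟧ * (+ 2 * T * (K - T) + T * T)) ⟩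
    sum {t} (λ _ → (K - T) * (K - T)) + sum {t} (λ l → ⟦ toℕ k ℕ.≤? toℕ l ⟧ * (+ 2 * T * (K - T) + T * T))
      ≡⟨ cong₂ _+_ (sum-const t ((K - T) * (K - T)))
           (trans (sym (*-distribʳ-sum {t} (+ 2 * T * (K - T) + T * T) (λ l → ⟦ toℕ k ℕ.≤? toℕ l ⟧)))
                  (cong (_* (+ 2 * T * (K - T) + T * T)) (count-≥ k))) ⟩
    T * ((K - T) * (K - T)) + (T - K) * (+ 2 * T * (K - T) + T * T)
      ≡⟨ ring T K ⟩
    T * (T * K - K * K) ∎
    where
    K = + toℕ k
    square : ∀ {P : Set} (d : Dec P) → (K + ⟦ d ⟧ * T - T) * (K + ⟦ d ⟧ * T - T) ≡
             (K - T) * (K - T) + ⟦ d ⟧ * (+ 2 * T * (K - T) + T * T)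
    square (yes _) = ring₁ K T
      where
      ring₁ : ∀ k t → (k + 1ℤ * t - t) * (k + 1ℤ * t - t) ≡ (k - t) * (k - t) + 1ℤ * (+ 2 * t * (k - t) + t * t)
      ring₁ = solve-∀
    square (no _) = ring₀ K T
      where
      ring₀ : ∀ k t → (k + 0ℤ * t - t) * (k + 0ℤ * t - t) ≡ (k - t) * (k - t) + 0ℤ * (+ 2 * t * (k - t) + t * t)
      ring₀ = solve-∀
    ring : ∀ t k → t * ((k - t) * (k - t)) + (t - k) * (+ 2 * t * (k - t) + t * t) ≡ t * (t * k - k * k)
    ring = solve-∀

  ∑∑-ξ² : sum (λ k → sum (λ l → ξ k l * ξ k l)) ≡ T * (T * S₁ t - S₂ t)
  ∑∑-ξ² = begin
    sum {t} (λ k → sum {t} (λ l → ξ k l * ξ k l))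
      ≡⟨ sum-cong-≗ {t} ∑-ξ² ⟩
    sum {t} (λ k → T * (T * + toℕ k - + toℕ k * + toℕ k))
      ≡⟨ sym (*-distribˡ-sum {t} T (λ k → T * + toℕ k - + toℕ k * + toℕ k)) ⟩
    T * sum {t} (λ k → T * + toℕ k - + toℕ k * + toℕ k)
      ≡⟨ cong (_*_ T) (trans (sum-- {t} (λ k → T * + toℕ k) (λ k → + toℕ k * + toℕ k))
           (cong (_- S₂ t) (sym (*-distribˡ-sum {t} T (λ k → + toℕ k))))) ⟩
    T * (T * S₁ t - S₂ t) ∎

  ∑-η² : sum (λ l → η l * η l) ≡ T * T * S₂ t - T * S₁ t * S₁ t
  ∑-η² = begin
    sum {t} (λ l → η l * η l)
      ≡⟨ sum-cong-≗ {t} (λ l → trans (cong (λ z → z * z) (η≡ l)) (ring₁ T (+ toℕ l) (S₁ t))) ⟩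
    sum {t} (λ l → T * T * (+ toℕ l * + toℕ l) - (+ 2 * T * S₁ t * + toℕ l + - (S₁ t * S₁ t)))
      ≡⟨ sum-- {t} (λ l → T * T * (+ toℕ l * + toℕ l)) (λ l → + 2 * T * S₁ t * + toℕ l + - (S₁ t * S₁ t)) ⟩
    sum {t} (λ l → T * T * (+ toℕ l * + toℕ l)) - sum {t} (λ l → + 2 * T * S₁ t * + toℕ l + - (S₁ t * S₁ t))
      ≡⟨ cong₂ _-_ (sym (*-distribˡ-sum {t} (T * T) (λ l → + toℕ l * + toℕ l))) (sum-affine t (+ 2 * T * S₁ t) (- (S₁ t * S₁ t))) ⟩
    T * T * S₂ t - (+ 2 * T * S₁ t * S₁ t + T * - (S₁ t * S₁ t))
      ≡⟨ ring₂ T (S₁ t) (S₂ t) ⟩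
    T * T * S₂ t - T * S₁ t * S₁ t ∎
    where
    ring₁ : ∀ t l j → (t * l - j) * (t * l - j) ≡ t * t * (l * l) - (+ 2 * t * j * l + - (j * j))
    ring₁ = solve-∀
    ring₂ : ∀ t j j₂ → t * t * j₂ - (+ 2 * t * j * j + t * - (j * j)) ≡ t * t * j₂ - t * j * j
    ring₂ = solve-∀

  -- Centring lowers every height by s t, and t Σ b² - (Σ b)² is invariant under a common
  -- translation of the b.
  size-ξ : ∀ w → + 2 * T * T * + size (wordPartition w) ≡
    T * sum (λ k → additive (ξ k) w * additive (ξ k) w) - additive η w * additive η w - (T * S₂ t - S₁ t * S₁ t)
  size-ξ w = begin
    + 2 * T * T * + size (wordPartition w)
      ≡⟨ size-height w ⟩
    T * sum {t} (λ k → H k * H k) - sum H * sum H - C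
      ≡⟨ cong₂ (λ a b → T * a - b * b - C)
           (trans (sum-cong-≗ {t} (λ k → trans (cong (λ z → z * z) (height-ξ w k)) (ring₁ (c k) (S * T)))) squares)
           (trans (sum-cong-≗ {t} (height-ξ w)) (trans (∑-distrib-+ {t} c (λ _ → S * T)) (cong₂ _+_ ∑c≡ (sum-const t (S * T))))) ⟩
    T * (sum {t} (λ k → c k * c k) + + 2 * (S * T) * A + T * (S * T * (S * T))) - (A + T * (S * T)) * (A + T * (S * T)) - C
      ≡⟨ ring₂ T (S * T) A (sum {t} (λ k → c k * c k)) C ⟩
    T * sum {t} (λ k → c k * c k) - A * A - C ∎
    where
    H : Fin t → ℤ
    H k = height w (toℕ k)
    c : Fin t → ℤ
    c k = additive (ξ k) w
    A = additive η w
    C = T * S₂ t - S₁ t * S₁ t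
    ∑c≡ : sum c ≡ A
    ∑c≡ = ∑-comm {t} {s} (λ k i → ξ k (lookup w i))
    ring₁ : ∀ c x → (c + x) * (c + x) ≡ c * c + + 2 * x * c + x * x
    ring₁ = solve-∀
    ring₂ : ∀ t x a q z → t * (q + + 2 * x * a + t * (x * x)) - (a + t * x) * (a + t * x) - z ≡ t * q - a * a - z
    ring₂ = solve-∀
    squares : sum {t} (λ k → c k * c k + + 2 * (S * T) * c k + S * T * (S * T)) ≡
              sum {t} (λ k → c k * c k) + + 2 * (S * T) * A + T * (S * T * (S * T))
    squares = trans (∑-distrib-+ {t} (λ k → c k * c k + + 2 * (S * T) * c k) (λ _ → S * T * (S * T)))
      (cong₂ _+_ (trans (∑-distrib-+ {t} (λ k → c k * c k) (λ k → + 2 * (S * T) * c k))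
          (cong (_+_ (sum {t} (λ k → c k * c k))) (trans (sym (*-distribˡ-sum {t} (+ 2 * (S * T)) c)) (cong (_*_ (+ 2 * (S * T))) ∑c≡))))
        (sum-const t (S * T * (S * T))))

  -- Proved after multiplication by t³, of which two factors come from the size formula and one from
  -- `second-moment`. The 24 is the 2 of the size formula times 12, which clears the denominators 4
  -- of S₁² and 6 of S₂.
  total-size : + 24 * ∑ʷ t s (λ w → + size (wordPartition w)) ≡ M * ((S - 1ℤ) * (T * T - 1ℤ))
  total-size = ℤ.*-cancelˡ-≡ (T * T * T) _ _ {{nonZero³ t}} (begin
    T * T * T * (+ 24 * Σsize)
      ≡⟨ ring₁ T Σsize ⟩
    + 12 * (T * (+ 2 * T * T * Σsize))
      ≡⟨ cong (λ z → + 12 * (T * z)) (trans (*-distribˡ-sum {t ℕ.^ s} (+ 2 * T * T) (λ a → + size (wordPartition (W a))))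
           (sum-cong-≗ {t ℕ.^ s} (λ a → size-ξ (W a)))) ⟩
    + 12 * (T * sum {t ℕ.^ s} (λ a → T * sum {t} (λ k → c k a * c k a) - A a * A a - C))
      ≡⟨ cong (λ z → + 12 * (T * z)) (trans (sum-- {t ℕ.^ s} (λ a → T * sum {t} (λ k → c k a * c k a) - A a * A a) (λ _ → C))
           (cong₂ _-_ (trans (sum-- {t ℕ.^ s} (λ a → T * sum {t} (λ k → c k a * c k a)) (λ a → A a * A a))
              (cong (_- Eη) (sym (*-distribˡ-sum {t ℕ.^ s} T (λ a → sum {t} (λ k → c k a * c k a)))))) (sum-const (t ℕ.^ s) C))) ⟩
    + 12 * (T * (T * sum {t ℕ.^ s} (λ a → sum {t} (λ k → c k a * c k a)) - Eη - M * C))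
      ≡⟨ cong (λ z → + 12 * (T * (T * z - Eη - M * C))) (∑-comm {t ℕ.^ s} {t} (λ a k → c k a * c k a)) ⟩
    + 12 * (T * (T * sum {t} Eξ - Eη - M * C))
      ≡⟨ ring₂ T (sum {t} Eξ) Eη (M * C) ⟩
    + 12 * (T * (T * sum {t} Eξ) - T * Eη - T * (M * C))
      ≡⟨ cong₂ (λ a b → + 12 * (T * a - b - T * (M * C)))
           (trans (*-distribˡ-sum {t} T Eξ) (trans (sum-cong-≗ {t} (λ k → second-moment t s (ξ k) (ξ-centred k)))
             (trans (sym (*-distribˡ-sum {t} (S * M) (λ k → sum {t} (λ l → ξ k l * ξ k l)))) (cong (_*_ (S * M)) ∑∑-ξ²))))
           (trans (second-moment t s η η-centred) (cong (_*_ (S * M)) ∑-η²)) ⟩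
    + 12 * (T * (S * M * (T * (T * S₁ t - S₂ t))) - S * M * (T * T * S₂ t - T * S₁ t * S₁ t) - T * (M * C))
      ≡⟨ ring₃ T S M (S₁ t) (S₂ t) ⟩
    M * (S * (+ 6 * (T * T * T) * (+ 2 * S₁ t) - + 4 * (T * T) * (+ 6 * S₂ t) + + 3 * T * (+ 2 * S₁ t) * (+ 2 * S₁ t))
         - (+ 2 * (T * T) * (+ 6 * S₂ t) - + 3 * T * (+ 2 * S₁ t) * (+ 2 * S₁ t)))
      ≡⟨ cong₂ (λ x y → M * (S * (+ 6 * (T * T * T) * x - + 4 * (T * T) * y + + 3 * T * x * x)
                            - (+ 2 * (T * T) * y - + 3 * T * x * x))) (2S₁ t) (6S₂ t) ⟩
    M * (S * (+ 6 * (T * T * T) * X - + 4 * (T * T) * Y + + 3 * T * X * X) - (+ 2 * (T * T) * Y - + 3 * T * X * X))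
      ≡⟨ ring₄ T S M ⟩
    T * T * T * (M * ((S - 1ℤ) * (T * T - 1ℤ))) ∎)
    where
    nonZero³ : ∀ n .{{_ : ℕ.NonZero n}} → ℤNonZero (+ n * + n * + n)
    nonZero³ (suc n) = _
    W = word t s
    Σsize = ∑ʷ t s (λ w → + size (wordPartition w))
    c : Fin t → Fin (t ℕ.^ s) → ℤ
    c k a = additive (ξ k) (W a)
    A : Fin (t ℕ.^ s) → ℤ
    A a = additive η (W a)
    C = T * S₂ t - S₁ t * S₁ t
    Eη = sum {t ℕ.^ s} (λ a → A a * A a)
    Eξ : Fin t → ℤ
    Eξ k = sum {t ℕ.^ s} (λ a → c k a * c k a)
    X = T * (T - 1ℤ)
    Y = T * (T - 1ℤ) * (+ 2 * T - 1ℤ)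
    ring₁ : ∀ t z → t * t * t * (+ 24 * z) ≡ + 12 * (t * (+ 2 * t * t * z))
    ring₁ = solve-∀
    ring₂ : ∀ t x y z → + 12 * (t * (t * x - y - z)) ≡ + 12 * (t * (t * x) - t * y - t * z)
    ring₂ = solve-∀
    ring₃ : ∀ t s n j j₂ → + 12 * (t * (s * n * (t * (t * j - j₂))) - s * n * (t * t * j₂ - t * j * j) - t * (n * (t * j₂ - j * j))) ≡
      n * (s * (+ 6 * (t * t * t) * (+ 2 * j) - + 4 * (t * t) * (+ 6 * j₂) + + 3 * t * (+ 2 * j) * (+ 2 * j))
           - (+ 2 * (t * t) * (+ 6 * j₂) - + 3 * t * (+ 2 * j) * (+ 2 * j)))
    ring₃ = solve-∀
    ring₄ : ∀ t s n →
      n * (s * (+ 6 * (t * t * t) * (t * (t - 1ℤ)) - + 4 * (t * t) * (t * (t - 1ℤ) * (+ 2 * t - 1ℤ)) + + 3 * t * (t * (t - 1ℤ)) * (t * (t - 1ℤ)))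
           - (+ 2 * (t * t) * (t * (t - 1ℤ) * (+ 2 * t - 1ℤ)) - + 3 * t * (t * (t - 1ℤ)) * (t * (t - 1ℤ))))
      ≡ t * t * t * (n * ((s - 1ℤ) * (t * t - 1ℤ)))
    ring₄ = solve-∀

-- Finite sets encoded by words

rank-select′ : ∀ {n} {R : Fin n → Set} {R? : ∀ i → Dec (R i)} (S : Selection R?) → let open Selection S in
               ∀ {k i} r → select k ≡ i → rank i r ≡ k
rank-select′ S {k} r refl = Selection.rank-select S k r

-- A setoid whose classes correspond to the words with a decidable property is finite. Both the
-- cores and the stabilizers are enumerated in this way.
module Encoding (S : Setoid 0ℓ 0ℓ) {m n : ℕ} {R : Vec (Fin m) n → Set} (R? : ∀ v → Dec (R v))
  (encode : Setoid.Carrier S → Vec (Fin m) n)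
  (encode-cong : ∀ {x y} → Setoid._≈_ S x y → encode x ≡ encode y)
  (valid : ∀ x → R (encode x))
  (decode : ∀ v → R v → Setoid.Carrier S)
  (decode-encode : ∀ x r → Setoid._≈_ S (decode (encode x) r) x)
  (encode-decode : ∀ v r → encode (decode v r) ≡ v) where

  private
    module S = Setoid S
    W = word m n
    sel = selection (R? ∘ W)
    open Selection sel

    to : Fin count → S.Carrier
    to k = decode (W (select k)) (selected k)

    from : S.Carrier → Fin count
    from x = rank (index (encode x)) (subst R (sym (word-index (encode x))) (valid x))

    decode-≈ : ∀ x v r → v ≡ encode x → decode v r S.≈ x
    decode-≈ x v r refl = decode-encode x r

    to-from : ∀ x → to (from x) S.≈ x
    to-from x = decode-≈ x _ _ (trans (cong W (select-rank (index (encode x)) _)) (word-index (encode x)))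

    from-to : ∀ k → from (to k) ≡ k
    from-to k = rank-select′ sel _ (trans (sym (index-word m n (select k)))
      (sym (cong index (encode-decode (W (select k)) (selected k)))))

    from-cong : ∀ {x y} → x S.≈ y → from x ≡ from y
    from-cong {x} {y} x≈y = rank-select′ sel _
      (trans (select-rank (index (encode y)) _) (cong index (encode-cong (S.sym x≈y))))

  finite : Finite S
  finite = record
    { card = count
    ; enumeration = record
      { to = to ; from = from
      ; to-cong = λ { refl → S.refl }
      ; from-cong = from-cong
      ; inverse = (λ {x} k≡ → S.trans (S.reflexive (cong to k≡)) (to-from x))
                , (λ {k} x≈ → trans (from-cong x≈) (from-to k)) } }

  card≡ : + Finite.card finite ≡ ∑ʷ m n (λ v → ⟦ R? v ⟧)
  card≡ = count≡

-- Stabilizers as letter-preserving permutations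

module _ {s t : ℕ} (f : G s t) where

  open G f

  private
    add : ∀ x k s → x + (1ℤ + k) * s ≡ x + k * s + s
    add = solve-∀

    shift-ℕ : ∀ k x → to (x + + k * + s) ≡ to x + + k * + s
    shift-ℕ zero    x = trans (cong to (ℤ.+-identityʳ x)) (sym (ℤ.+-identityʳ (to x)))
    shift-ℕ (suc k) x = begin
      to (x + + suc k * + s)        ≡⟨ cong to (trans (cong (λ z → x + z * + s) (ℤ.pos-+ 1 k)) (add x (+ k) (+ s))) ⟩
      to (x + + k * + s + + s)      ≡⟨ shift (x + + k * + s) ⟩
      to (x + + k * + s) + + s      ≡⟨ cong (_+ + s) (shift-ℕ k x) ⟩
      to x + + k * + s + + s        ≡⟨ sym (trans (cong (λ z → to x + z * + s) (ℤ.pos-+ 1 k)) (add (to x) (+ k) (+ s))) ⟩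
      to x + + suc k * + s          ∎
      where open ≡-Reasoning

  -- Hence f is determined by its values on one representative of each class modulo s.
  to-shift : ∀ q x → to (x + q * + s) ≡ to x + q * + s
  to-shift (+ k)    x = shift-ℕ k x
  to-shift -[1+ k ] x = begin
    to y                               ≡⟨ ring₁ (to y) (+ suc k * + s) ⟩
    to y + K - K                       ≡⟨ cong (_- K) (sym (shift-ℕ (suc k) y)) ⟩
    to (y + K) - K                     ≡⟨ cong (λ z → to z - K) (trans (cong (λ z → x + z + K) (sym (ℤ.neg-distribˡ-* (+ suc k) (+ s)))) (ring₂ x K)) ⟩
    to x - K                           ≡⟨ cong (_+_ (to x)) (ℤ.neg-distribˡ-* (+ suc k) (+ s)) ⟩
    to x + -[1+ k ] * + s              ∎
    where
    open ≡-Reasoning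
    y = x + -[1+ k ] * + s
    K = + suc k * + s
    ring₁ : ∀ y k → y ≡ y + k - k
    ring₁ = solve-∀
    ring₂ : ∀ x k → x + - k + k ≡ x
    ring₂ = solve-∀

  to-injective : ∀ {x y} → to x ≡ to y → x ≡ y
  to-injective {x} {y} eq = trans (sym (Inverse.strictlyInverseʳ perm x)) (trans (cong from eq) (Inverse.strictlyInverseʳ perm y))

module Stabilizers (s t : ℕ) .{{_ : ℕ.NonZero s}} .{{_ : ℕ.NonZero t}} (u : ℤ) (us≈1 : u * + s ≈[ t ] 1ℤ)
                   (p : Partition) (core : Core s p) where

  open Letters s t u us≈1

  private
    B = betaSet p
    closed = core⇒closed p core
    c = coreWord p

    a : Fin s → ℤ
    a = sElement p

    a-gap : ∀ i → IsGap s B (a i)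
    a-gap i = gap-isGap p s (+ toℕ i)

    sSet⇒gap : ∀ {m} → sSet s p m → IsGap s B m
    sSet⇒gap ((x , b , refl) , m∉B) = m∉B , subst B (sym (ring x (+ s))) b
      where
      ring : ∀ x s → x + s - s ≡ x
      ring = solve-∀

    a∈sSet : ∀ i → sSet s p (a i)
    a∈sSet i = (a i - + s , proj₂ (a-gap i) , ring (a i) (+ s)) , proj₁ (a-gap i)
      where
      ring : ∀ x s → x - s + s ≡ x
      ring = solve-∀

    sSet⇒a : ∀ {m} → sSet s p m → a (residue s m) ≡ m
    sSet⇒a m∈S = sElement≡ closed (sSet⇒gap m∈S)

    res-a : ∀ i → residue s (a i) ≡ i
    res-a = residue-sElement p

    res-≈ : ∀ m → m ≈[ s ] a (residue s m)
    res-≈ m = residue-≈⁻ s (sym (res-a (residue s m)))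

    lookup-c : ∀ i → lookup c i ≡ κ (a i - + s)
    lookup-c = lookup∘tabulate _

    same-letter⇒≈ : ∀ {i j} → lookup c i ≡ lookup c j → a i ≈[ t ] a j
    same-letter⇒≈ {i} {j} eq = ≈-trans (≈-reflexive (ring (a i) (+ s))) (≈-trans
      (≈-+ (κ-injective {a i - + s} {a j - + s} (trans (sym (lookup-c i)) (trans eq (lookup-c j)))) ≈-refl) (≈-reflexive (sym (ring (a j) (+ s)))))
      where
      ring : ∀ x s → x ≡ x - s + s
      ring = solve-∀

    Stabilizer = Stab s t (p , core)
    open Setoid Stabilizer using () renaming (Carrier to Elem; _≈_ to _≈ˢ_)

    -- A stabilizing f permutes the s-set, which has one element `a i` in each class modulo s; the
    -- permutation of the indices is recorded as a word.
    encode : Elem → Vec (Fin s) s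
    encode (f , _) = tabulate λ i → residue s (G.to f (a i))

    lookup-encode : ∀ x i → lookup (encode x) i ≡ residue s (G.to (proj₁ x) (a i))
    lookup-encode x = lookup∘tabulate _

    to-a : ∀ x i → a (lookup (encode x) i) ≡ G.to (proj₁ x) (a i)
    to-a x@(f , _ , fS⊆S) i = trans (cong a (lookup-encode x i)) (sSet⇒a (fS⊆S (a i , a∈sSet i , refl)))

    valid : ∀ x → Matching c c (encode x)
    valid x@(f , _) = distinct , λ i → trans (lookup-c (σ i)) (trans
      (κ-cong (≈-- (≈-trans (≈-reflexive (to-a x i)) (∣-≈ (G.congruent f (a i)))) (≈-refl {x = + s}))) (sym (lookup-c i)))
      where
      σ = lookup (encode x)
      distinct : ∀ i j → σ i ≡ σ j → i ≡ j
      distinct i j eq = trans (sym (res-a i)) (trans (cong (residue s)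
        (to-injective f (trans (sym (to-a x i)) (trans (cong a eq) (to-a x j))))) (res-a j))

    module Decode (v : Vec (Fin s) s) (matching : Matching c c v) where

      π : Permutation′ s
      π = distinct⇒permutation v (proj₁ matching)

      -- The class of m modulo s is translated as a whole, so that its element `a i` of the s-set
      -- goes to `a (φ i)`.
      move : (Fin s → Fin s) → ℤ → ℤ
      move φ m = a (φ (residue s m)) + (m - a (residue s m))

      residue-move : ∀ φ m → residue s (move φ m) ≡ φ (residue s m)
      residue-move φ m = trans (residue-cong s (≈-trans (≈-+ (≈-refl {x = a (φ (residue s m))}) (≈-- (res-≈ m) ≈-refl))
        (≈-reflexive (ring (a (φ (residue s m))) (a (residue s m)))))) (res-a (φ (residue s m)))
        where
        ring : ∀ x y → x + (y - y) ≡ x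
        ring = solve-∀

      move-move : ∀ φ ψ → (∀ i → φ (ψ i) ≡ i) → ∀ m → move φ (move ψ m) ≡ m
      move-move φ ψ inv m = begin
        a (φ (residue s y)) + (y - a (residue s y))
          ≡⟨ cong (λ i → a (φ i) + (y - a i)) (residue-move ψ m) ⟩
        a (φ (ψ i)) + (a (ψ i) + (m - a i) - a (ψ i))
          ≡⟨ cong (λ z → a z + (a (ψ i) + (m - a i) - a (ψ i))) (inv i) ⟩
        a i + (a (ψ i) + (m - a i) - a (ψ i))
          ≡⟨ ring (a i) (a (ψ i)) m ⟩
        m ∎
        where
        open ≡-Reasoning
        i = residue s m
        y = move ψ m
        ring : ∀ x y m → x + (y + (m - x) - y) ≡ m
        ring = solve-∀

      move-a : ∀ φ i → move φ (a i) ≡ a (φ i)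
      move-a φ i = trans (cong (λ j → a (φ j) + (a i - a j)) (res-a i)) (ring (a (φ i)) (a i))
        where
        ring : ∀ x y → x + (y - y) ≡ x
        ring = solve-∀

      shift-move : ∀ φ m → move φ (m + + s) ≡ move φ m + + s
      shift-move φ m = trans
        (cong (λ j → a (φ j) + (m + + s - a j)) (residue-cong s (modulo 1ℤ (cong (_+_ m) (sym (ℤ.*-identityˡ (+ s)))))))
        (ring (a (φ (residue s m))) m (+ s) (a (residue s m)))
        where
        ring : ∀ x m s y → x + (m + s - y) ≡ x + (m - y) + s
        ring = solve-∀

      -- The displacements `a (lookup v i) - a i` add up to zero since v is a permutation, so the
      -- sum is the same as for the identity.
      balanced-move : sum {s} (λ i → move (lookup v) (+ toℕ i)) ≡ + (s C 2)
      balanced-move = begin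
        sum {s} (λ i → move (lookup v) (+ toℕ i))
          ≡⟨ sum-cong-≗ {s} (λ i → cong (λ j → a (lookup v j) + (+ toℕ i - a j)) (residue-toℕ s i)) ⟩
        sum {s} (λ i → a (lookup v i) + (+ toℕ i - a i))
          ≡⟨ ∑-distrib-+ {s} (λ i → a (lookup v i)) (λ i → + toℕ i - a i) ⟩
        sum {s} (λ i → a (lookup v i)) + sum {s} (λ i → + toℕ i - a i)
          ≡⟨ cong₂ _+_ (sym (sum-permute a π)) (sum-- {s} (λ i → + toℕ i) a) ⟩
        sum a + (sum {s} (λ i → + toℕ i) - sum a)
          ≡⟨ ring (sum a) (sum {s} (λ i → + toℕ i)) ⟩
        sum {s} (λ i → + toℕ i)
          ≡⟨ ∑toℕ s ⟩
        + (s C 2) ∎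
        where
        open ≡-Reasoning
        ring : ∀ x y → x + (y - x) ≡ y
        ring = solve-∀

      element : G s t
      element = record
        { perm = mk↔ₛ′ (move (lookup v)) (move (π ⟨$⟩ˡ_))
            (move-move (lookup v) (π ⟨$⟩ˡ_) (λ i → inverseʳ π))
            (move-move (π ⟨$⟩ˡ_) (lookup v) (λ i → inverseˡ π))
        ; shift = shift-move (lookup v)
        ; balanced = balanced-move
        -- Every m is displaced as the element `a i` of its class is, and equal letters make this
        -- displacement divisible by t.
        ; congruent = λ m → ≈-∣ (≈-trans (≈-+ (same-letter⇒≈ (proj₂ matching (residue s m))) (≈-refl {x = m - a (residue s m)}))
            (≈-reflexive (ring (a (residue s m)) m)))
        }
        where
        ring : ∀ x m → x + (m - x) ≡ m
        ring = solve-∀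

      stabilizes : element · (p , core) ↦ (p , core)
      stabilizes = forth , back
        where
        forth : ∀ {m} → sSet s p m → image (move (lookup v)) (sSet s p) m
        forth {m} m∈S = a (π ⟨$⟩ˡ residue s m) , a∈sSet _ ,
          trans (move-a (lookup v) (π ⟨$⟩ˡ residue s m)) (trans (cong a (inverseʳ π)) (sSet⇒a m∈S))
        back : ∀ {m} → image (move (lookup v)) (sSet s p) m → sSet s p m
        back (x , x∈S , refl) = subst (sSet s p)
          (sym (trans (cong (move (lookup v)) (sym (sSet⇒a x∈S))) (move-a (lookup v) (residue s x)))) (a∈sSet _)

    decode : ∀ v → Matching c c v → Elem
    decode v r = Decode.element v r , Decode.stabilizes v r

    decode-encode : ∀ x r → decode (encode x) r ≈ˢ x
    decode-encode x@(f , _) r m with res-≈ m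
    ... | modulo q eq = begin
      a (lookup (encode x) i) + (m - a i)  ≡⟨ cong₂ (λ y z → y + (z - a i)) (to-a x i) eq ⟩
      to (a i) + (a i + q * + s - a i)     ≡⟨ ring (to (a i)) (a i) (q * + s) ⟩
      to (a i) + q * + s                   ≡⟨ sym (to-shift f q (a i)) ⟩
      to (a i + q * + s)                   ≡⟨ cong to (sym eq) ⟩
      to m                                 ∎
      where
      open ≡-Reasoning
      open G f using (to)
      i = residue s m
      ring : ∀ f x q → f + (x + q - x) ≡ f + q
      ring = solve-∀

    encode-decode : ∀ v r → encode (decode v r) ≡ v
    encode-decode v r = trans (tabulate-cong λ i → trans (cong (residue s) (Decode.move-a v r (lookup v) i)) (res-a (lookup v i)))
                              (tabulate∘lookup v)

    module E = Encoding Stabilizer (matching? c c) encode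
      (λ x≗y → tabulate-cong λ i → cong (residue s) (x≗y (a i))) valid decode decode-encode encode-decode

  stabilizer-finite : Finite (Stab s t (p , core))
  stabilizer-finite = E.finite

  stabilizer-card : + Finite.card stabilizer-finite ≡ matchings (coreWord p) (coreWord p)
  stabilizer-card = E.card≡

-- The two sums may differ in length; both are padded with zero parts to the sum of the two bounds.
size-cong : ∀ p q → (∀ i → part p i ≡ part q i) → size p ≡ size q
size-cong p q p≗q = begin
  size p                                            ≡⟨ pad (part p) (bound p) (bound q) (vanishing p) ⟩
  Sumℕ.sum {bound p ℕ.+ bound q} (part p ∘ toℕ)     ≡⟨ Sumℕ.sum-cong-≗ {bound p ℕ.+ bound q} (p≗q ∘ toℕ) ⟩
  Sumℕ.sum {bound p ℕ.+ bound q} (part q ∘ toℕ)     ≡⟨ cong (λ n → Sumℕ.sum {n} (part q ∘ toℕ)) (ℕ.+-comm (bound p) (bound q)) ⟩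
  Sumℕ.sum {bound q ℕ.+ bound p} (part q ∘ toℕ)     ≡⟨ sym (pad (part q) (bound q) (bound p) (vanishing q)) ⟩
  size q                                            ∎
  where
  open ≡-Reasoning
  pad : ∀ (f : ℕ → ℕ) m n → (∀ i → m ℕ.≤ i → f i ≡ 0) → Sumℕ.sum {m} (f ∘ toℕ) ≡ Sumℕ.sum {m ℕ.+ n} (f ∘ toℕ)
  pad f zero    n f≡0 = sym (trans (Sumℕ.sum-cong-≗ {n} (λ i → f≡0 (toℕ i) z≤n)) (Sumℕ.sum-replicate-zero n))
  pad f (suc m) n f≡0 = cong (ℕ._+_ (f 0)) (pad (f ∘ suc) m n (λ i m≤i → f≡0 (suc i) (s≤s m≤i)))

-- Counting the words that yield a given core

module Orbits (s t : ℕ) .{{_ : ℕ.NonZero s}} .{{_ : ℕ.NonZero t}} (u : ℤ) (us≈1 : u * + s ≈[ t ] 1ℤ) where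

  open Letters s t u us≈1
  open Heights s t u us≈1
  open Rotations s t u us≈1
  open Averages s t u us≈1

  private
    closed-s : ∀ (x : BiCore s t) → Closed s (betaSet (proj₁ x))
    closed-s (p , cs , _) = core⇒closed p cs

    closed-t : ∀ (x : BiCore s t) → Closed t (betaSet (proj₁ x))
    closed-t (p , _ , ct) = core⇒closed p ct

    encode : BiCore s t → Vec (Fin t) s
    encode (p , _) = coreWord p

    content-rotate-0 : ∀ w j → content (rotate (residue t 0ℤ) w) j ≡ content w j
    content-rotate-0 w j = begin
      content (rotate r w) j
        ≡⟨ cong (content (rotate r w)) (sym (trans (residue-cong t j+r≈j) (residue-toℕ t j))) ⟩
      content (rotate r w) (residue t (+ toℕ j + + toℕ r))
        ≡⟨ content-rotate r w (+ toℕ j) ⟩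
      content w (residue t (+ toℕ j))
        ≡⟨ cong (content w) (residue-toℕ t j) ⟩
      content w j ∎
      where
      open ≡-Reasoning
      r = residue t 0ℤ
      j+r≈j : + toℕ j + + toℕ r ≈[ t ] + toℕ j
      j+r≈j = ≈-trans (≈-+ (≈-refl {x = + toℕ j}) (≈-sym (residue-≈ t 0ℤ))) (≈-reflexive (ℤ.+-identityʳ _))

    -- The rotation by 0 matches the content of the word with itself, so `content-rotate⇒≗` returns
    -- the core one started from.
    recover : ∀ x i → part (proj₁ x) i ≡ part (wordPartition (encode x)) i
    recover x = content-rotate⇒≗ (closed-s x) (closed-t x) (encode x) (residue t 0ℤ) (content-rotate-0 (encode x))

    -- Many words may yield the same core. The core's own `coreWord` is taken as representative,
    -- which makes the cores a decidable subset of the words.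
    Canonical : Vec (Fin t) s → Set
    Canonical v = coreWord (wordPartition v) ≡ v

    module E = Encoding (BiCore-setoid s t) {R = Canonical} (λ v → ≡-dec _≟_ _ _) encode
      (λ {x} x≗y → coreWord-cong (closed-s x) x≗y)
      (λ x → sym (coreWord-cong (closed-s x) (recover x)))
      (λ v _ → wordCore v) (λ x _ i → sym (recover x i)) (λ _ r → r)

  abstract
    cores : Finite (BiCore-setoid s t)
    cores = E.finite

    stabs : (x : BiCore s t) → Finite (Stab s t (asCore x))
    stabs (p , cs , _) = Stabilizers.stabilizer-finite s t u us≈1 p cs

    stabs-card : ∀ x → + Finite.card (stabs x) ≡ matchings (coreWord (proj₁ x)) (coreWord (proj₁ x))
    stabs-card (p , cs , _) = Stabilizers.stabilizer-card s t u us≈1 p cs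

  open Finite cores using (card; element; enumeration)
  private
    module Enum = Inverse enumeration

  wordClass : Vec (Fin t) s → Fin card
  wordClass w = Enum.from (wordCore w)

  stabCard : Fin card → ℤ
  stabCard i = + Finite.card (stabs (element i))

  fibre : Fin card → ℤ
  fibre i = ∑ʷ t s (λ w → ⟦ wordClass w ≟ i ⟧)

  private
    rotate-matchings : ∀ r (c : Vec (Fin t) s) → matchings (rotate r c) (rotate r c) ≡ matchings c c
    rotate-matchings r c = sum-cong-≗ {s ℕ.^ s} λ a → let σ = word s s a in
      ⟦⟧-cong (matching? (rotate r c) (rotate r c) σ) (matching? c c σ)
        (λ (inj , col) → inj , λ k → turn-injective (trans (sym (lookup-rotate (lookup σ k))) (trans (col k) (lookup-rotate k))))
        (λ (inj , col) → inj , λ k → trans (lookup-rotate (lookup σ k)) (trans (cong turn (col k)) (sym (lookup-rotate k))))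
      where
      turn : Fin t → Fin t
      turn j = residue t (+ toℕ j + + toℕ r)
      lookup-rotate : ∀ i → lookup (rotate r c) i ≡ turn (lookup c i)
      lookup-rotate i = lookup-map i turn c
      ring : ∀ x r → x ≡ x + r - r
      ring = solve-∀
      turn-injective : ∀ {i j} → turn i ≡ turn j → i ≡ j
      turn-injective {i} {j} eq = toℕ-≈⇒≡ t (≈-trans (≈-reflexive (ring (+ toℕ i) (+ toℕ r)))
        (≈-trans (≈-- (residue-≈⁻ t eq) (≈-refl {x = + toℕ r})) (≈-reflexive (sym (ring (+ toℕ j) (+ toℕ r))))))

    wordClass⇒≗ : ∀ {w i} → wordClass w ≡ i → ∀ j → part (proj₁ (element i)) j ≡ part (wordPartition w) j
    wordClass⇒≗ {w} refl = Enum.strictlyInverseˡ (wordCore w)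

    ≗⇒wordClass : ∀ {w i} → (∀ j → part (proj₁ (element i)) j ≡ part (wordPartition w) j) → wordClass w ≡ i
    ≗⇒wordClass {w} {i} x≗w = trans (Enum.from-cong {wordCore w} {element i} (λ j → sym (x≗w j))) (Enum.strictlyInverseʳ i)

    -- A nonzero term forces equal contents, hence w yields the core and r = κ(ν). For this r the
    -- contents do agree, so w may be replaced by the rotated word itself, and rotating both words
    -- leaves the matchings unchanged.
    rotations-matching : ∀ i w (d : Dec (wordClass w ≡ i)) →
      sum (λ r → matchings (rotate r (encode (element i))) w) ≡ ⟦ d ⟧ * stabCard i
    rotations-matching i w (no w≢i) = sum-zero {t} (λ r → matchings (rotate r c) w) λ r →
      matchings-off-content (rotate r c) w
        (λ same → w≢i (≗⇒wordClass {w} {i} (content-rotate⇒≗ (closed-s x) (closed-t x) w r same)))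
      where
      x = element i
      c = encode x
    rotations-matching i w (yes w≡i) = begin
      sum {t} (λ r → matchings (rotate r c) w)
        ≡⟨ sum-single {t} (λ r → matchings (rotate r c) w) r₀ (λ r r≢ → matchings-off-content (rotate r c) w
             (λ same → r≢ (content-rotate⇒κ (closed-s x) (closed-t x) w r same))) ⟩
      matchings (rotate r₀ c) w
        ≡⟨ matchings-content (rotate r₀ c) w (rotate r₀ c)
             (λ j → sym (≗⇒content-rotate (closed-s x) (closed-t x) w (wordClass⇒≗ {w} {i} w≡i) j)) ⟩
      matchings (rotate r₀ c) (rotate r₀ c)
        ≡⟨ rotate-matchings r₀ c ⟩
      matchings c c
        ≡⟨ sym (stabs-card x) ⟩
      stabCard i
        ≡⟨ sym (ℤ.*-identityˡ (stabCard i)) ⟩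
      1ℤ * stabCard i ∎
      where
      open ≡-Reasoning
      x = element i
      c = encode x
      r₀ = κ (+ charge w)

  τ : ℤ
  τ = + t * permutations s

  -- Orbit–stabilizer: the matchings of the rotations of the word of a core with a word w are
  -- a torsor under the stabilizer if w yields this core, and there are none otherwise.
  fibre-stab : ∀ i → fibre i * stabCard i ≡ τ
  fibre-stab i = begin
    fibre i * stabCard i
      ≡⟨ *-distribʳ-sum {t ℕ.^ s} (stabCard i) (λ a → ⟦ wordClass (word t s a) ≟ i ⟧) ⟩
    ∑ʷ t s (λ w → ⟦ wordClass w ≟ i ⟧ * stabCard i)
      ≡⟨ sum-cong-≗ {t ℕ.^ s} (λ a → sym (rotations-matching i (word t s a) (wordClass (word t s a) ≟ i))) ⟩
    ∑ʷ t s (λ w → sum {t} (λ r → matchings (rotate r c) w))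
      ≡⟨ ∑-comm {t ℕ.^ s} {t} (λ a r → matchings (rotate r c) (word t s a)) ⟩
    sum {t} (λ r → ∑ʷ t s (matchings (rotate r c)))
      ≡⟨ sum-cong-≗ {t} (λ r → ∑-matchings (rotate r c)) ⟩
    sum {t} (λ _ → permutations s)
      ≡⟨ sum-const t (permutations s) ⟩
    τ ∎
    where
    open ≡-Reasoning
    c = encode (element i)

  -- The words are sorted by the core they yield. `F` has to respect equality of parts because
  -- `wordCore w` and its listed representative agree only up to it.
  ∑-fibre : (F : BiCore s t → ℤ) → (∀ x y → (∀ i → part (proj₁ x) i ≡ part (proj₁ y) i) → F x ≡ F y) →
            sum (λ i → fibre i * F (element i)) ≡ ∑ʷ t s (F ∘ wordCore)
  ∑-fibre F F-cong = begin
    sum {card} (λ i → fibre i * F (element i))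
      ≡⟨ sum-cong-≗ {card} (λ i → *-distribʳ-sum {t ℕ.^ s} (F (element i)) (λ a → ⟦ wordClass (W a) ≟ i ⟧)) ⟩
    sum {card} (λ i → sum {t ℕ.^ s} (λ a → ⟦ wordClass (W a) ≟ i ⟧ * F (element i)))
      ≡⟨ ∑-comm {card} {t ℕ.^ s} (λ i a → ⟦ wordClass (W a) ≟ i ⟧ * F (element i)) ⟩
    sum {t ℕ.^ s} (λ a → sum {card} (λ i → ⟦ wordClass (W a) ≟ i ⟧ * F (element i)))
      ≡⟨ sum-cong-≗ {t ℕ.^ s} (λ a → pick (W a)) ⟩
    sum {t ℕ.^ s} (λ a → F (wordCore (W a))) ∎
    where
    open ≡-Reasoning
    W = word t s
    pick : ∀ w → sum {card} (λ i → ⟦ wordClass w ≟ i ⟧ * F (element i)) ≡ F (wordCore w)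
    pick w = trans (sum-single {card} (λ i → ⟦ wordClass w ≟ i ⟧ * F (element i)) (wordClass w) (λ i i≢ →
          trans (cong (_* F (element i)) (⟦⟧-no (wordClass w ≟ i) (i≢ ∘ sym))) (ℤ.*-zeroˡ (F (element i)))))
        (trans (cong (_* F (element (wordClass w))) (⟦⟧-yes (wordClass w ≟ wordClass w) refl))
        (trans (ℤ.*-identityˡ (F (element (wordClass w)))) (F-cong _ _ (Enum.strictlyInverseˡ (wordCore w)))))

  ∑-fibre-1 : sum fibre ≡ + (t ℕ.^ s)
  ∑-fibre-1 = trans (sum-cong-≗ {card} (λ i → sym (ℤ.*-identityʳ (fibre i))))
    (trans (∑-fibre (λ _ → 1ℤ) (λ _ _ _ → refl)) (trans (∑ʷ-const t s 1ℤ) (ℤ.*-identityʳ _)))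

  ∑-fibre-size : + 24 * sum (λ i → fibre i * + size (proj₁ (element i))) ≡
                 + (t ℕ.^ s) * ((+ s - 1ℤ) * (+ t * + t - 1ℤ))
  ∑-fibre-size = trans (cong (_*_ (+ 24)) (∑-fibre (λ x → + size (proj₁ x))
    (λ (p , _) (q , _) p≗q → cong +_ (size-cong p q p≗q)))) total-size

-- Passing to the rationals

ι : ℤ → ℚ
ι z = z / 1

private
  toℚᵘ-/ : ∀ z n → toℚᵘ (z / suc n) ℚᵘ.≃ ℚᵘ.mkℚᵘ z n
  toℚᵘ-/ z n = ℚ.toℚᵘ-fromℚᵘ (ℚᵘ.mkℚᵘ z n)

-- Checked on unnormalised rationals, where an equality is a cross-multiplied identity of integers.
ι-+ : ∀ a b → ι (a + b) ≡ ι a ℚ.+ ι b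
ι-+ a b = ℚ.toℚᵘ-injective (begin
  toℚᵘ (ι (a + b))                        ≈⟨ toℚᵘ-/ (a + b) 0 ⟩
  ℚᵘ.mkℚᵘ (a + b) 0                       ≈⟨ ℚᵘ.*≡* (ring a b) ⟩
  ℚᵘ.mkℚᵘ a 0 ℚᵘ.+ ℚᵘ.mkℚᵘ b 0            ≈⟨ ℚᵘ.+-cong (toℚᵘ-/ a 0) (toℚᵘ-/ b 0) ⟨
  toℚᵘ (ι a) ℚᵘ.+ toℚᵘ (ι b)              ≈⟨ ℚ.toℚᵘ-homo-+ (ι a) (ι b) ⟨
  toℚᵘ (ι a ℚ.+ ι b)                      ∎)
  where
  open ℚᵘ.≃-Reasoning
  ring : ∀ a b → (a + b) * 1ℤ ≡ (a * 1ℤ + b * 1ℤ) * 1ℤ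
  ring = solve-∀

ι-* : ∀ a b → ι (a * b) ≡ ι a ℚ.* ι b
ι-* a b = ℚ.toℚᵘ-injective (begin
  toℚᵘ (ι (a * b))                        ≈⟨ toℚᵘ-/ (a * b) 0 ⟩
  ℚᵘ.mkℚᵘ a 0 ℚᵘ.* ℚᵘ.mkℚᵘ b 0            ≈⟨ ℚᵘ.*-cong (toℚᵘ-/ a 0) (toℚᵘ-/ b 0) ⟨
  toℚᵘ (ι a) ℚᵘ.* toℚᵘ (ι b)              ≈⟨ ℚ.toℚᵘ-homo-* (ι a) (ι b) ⟨
  toℚᵘ (ι a ℚ.* ι b)                      ∎)
  where open ℚᵘ.≃-Reasoning

/-*-cancel : ∀ z n .{{_ : NonZero n}} → (z / n) ℚ.* ι (+ n) ≡ ι z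
/-*-cancel z (suc n) = ℚ.toℚᵘ-injective (begin
  toℚᵘ ((z / suc n) ℚ.* ι (+ suc n))                ≈⟨ ℚ.toℚᵘ-homo-* (z / suc n) (ι (+ suc n)) ⟩
  toℚᵘ (z / suc n) ℚᵘ.* toℚᵘ (ι (+ suc n))          ≈⟨ ℚᵘ.*-cong (toℚᵘ-/ z n) (toℚᵘ-/ (+ suc n) 0) ⟩
  ℚᵘ.mkℚᵘ z n ℚᵘ.* ℚᵘ.mkℚᵘ (+ suc n) 0              ≈⟨ ℚᵘ.*≡* (trans (ring z (+ suc n)) (cong (λ m → z * + m) (sym (ℕ.*-identityʳ (suc n))))) ⟩
  ℚᵘ.mkℚᵘ z 0                                       ≈⟨ toℚᵘ-/ z 0 ⟨
  toℚᵘ (ι z)                                        ∎)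
  where
  open ℚᵘ.≃-Reasoning
  ring : ∀ z n → z * n * 1ℤ ≡ z * n
  ring = solve-∀

module ℚSum = SemiringSum (CommutativeRing.semiring ℚ.+-*-commutativeRing)

ι-sum : ∀ {n} (f : Fin n → ℤ) → ℚSum.sum (ι ∘ f) ≡ ι (sum f)
ι-sum {zero}  f = refl
ι-sum {suc n} f = trans (cong (ℚ._+_ (ι (f zero))) (ι-sum (f ∘ suc))) (sym (ι-+ (f zero) (sum (f ∘ suc))))

Bézout-inverse : ∀ {s t} → Coprime s t → ∃ λ u → u * + s ≈[ t ] 1ℤ
Bézout-inverse {s} {t} coprime with coprime-Bézout coprime
... | Bézout.+- x y eq = + x , modulo (+ y) (trans (sym (ℤ.pos-* x s)) (trans (cong +_ (sym eq))
        (trans (ℤ.pos-+ 1 (y ℕ.* t)) (cong (_+_ 1ℤ) (ℤ.pos-* y t)))))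
-- Here 1 + x s = y t, so -x is the inverse.
... | Bézout.-+ x y eq = - + x , modulo (- + y) (begin
    - + x * + s                    ≡⟨ ring₁ (+ x) (+ s) ⟩
    1ℤ - (1ℤ + + x * + s)          ≡⟨ cong (λ z → 1ℤ - (1ℤ + z)) (sym (ℤ.pos-* x s)) ⟩
    1ℤ - (1ℤ + + (x ℕ.* s))        ≡⟨ cong (λ z → 1ℤ - z) (trans (sym (ℤ.pos-+ 1 (x ℕ.* s))) (trans (cong +_ eq) (ℤ.pos-* y t))) ⟩
    1ℤ - + y * + t                 ≡⟨ cong (_+_ 1ℤ) (ℤ.neg-distribˡ-* (+ y) (+ t)) ⟩
    1ℤ + - + y * + t               ∎)
  where
  open ≡-Reasoning
  ring₁ : ∀ x s → - x * s ≡ 1ℤ - (1ℤ + x * s)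
  ring₁ = solve-∀

module Ratio (s t : ℕ) .{{_ : ℕ.NonZero s}} .{{_ : ℕ.NonZero t}} (u : ℤ) (us≈1 : u * + s ≈[ t ] 1ℤ) where

  open Orbits s t u us≈1
  open Finite cores using (card; element)
  open ≡-Reasoning

  private
    X M A : ℤ
    X = (+ s - + 1) * ((+ t) ^ 2 - + 1)
    M = + (t ℕ.^ s)
    A = sum (λ i → fibre i * + size (proj₁ (element i)))

    w : Fin card → ℚ
    w i = weight cores stabs (element i)

    -- τ is the common value of `fibre i * stabCard i`, so multiplying by it turns the weight 1 /
    -- |Stab| into a number of words.
    w-τ : ∀ i → w i ℚ.* ι τ ≡ ι (fibre i)
    w-τ i = begin
      w i ℚ.* ι τ                             ≡⟨ cong (λ z → w i ℚ.* ι z) (trans (sym (fibre-stab i)) (ℤ.*-comm (fibre i) (stabCard i))) ⟩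
      w i ℚ.* ι (stabCard i * fibre i)        ≡⟨ cong (ℚ._*_ (w i)) (ι-* (stabCard i) (fibre i)) ⟩
      w i ℚ.* (ι (stabCard i) ℚ.* ι (fibre i)) ≡⟨ sym (ℚ.*-assoc (w i) (ι (stabCard i)) (ι (fibre i))) ⟩
      w i ℚ.* ι (stabCard i) ℚ.* ι (fibre i)
        ≡⟨ cong (ℚ._* ι (fibre i)) (/-*-cancel (+ 1) k {{Finite.inhabited⇒nonZero (stabs x) (id∈Stab (asCore x))}}) ⟩
      1ℚ ℚ.* ι (fibre i)                      ≡⟨ ℚ.*-identityˡ (ι (fibre i)) ⟩
      ι (fibre i)                             ∎
      where
      x = element i
      k = Finite.card (stabs x)

    p q R : ℚ
    p = totalWeightedSize cores stabs
    q = totalWeight cores stabs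
    R = X / 24

    q-τ : q ℚ.* ι τ ≡ ι M
    q-τ = begin
      q ℚ.* ι τ                          ≡⟨ ℚSum.*-distribʳ-sum {card} (ι τ) w ⟩
      ℚSum.sum {card} (λ i → w i ℚ.* ι τ) ≡⟨ ℚSum.sum-cong-≗ {card} w-τ ⟩
      ℚSum.sum {card} (ι ∘ fibre)        ≡⟨ ι-sum fibre ⟩
      ι (sum fibre)                      ≡⟨ cong ι ∑-fibre-1 ⟩
      ι M                                ∎

    p-τ : p ℚ.* ι τ ≡ ι A
    p-τ = begin
      p ℚ.* ι τ
        ≡⟨ ℚSum.*-distribʳ-sum {card} (ι τ) (λ i → w i ℚ.* ι (size′ i)) ⟩
      ℚSum.sum {card} (λ i → w i ℚ.* ι (size′ i) ℚ.* ι τ)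
        ≡⟨ ℚSum.sum-cong-≗ {card} term ⟩
      ℚSum.sum {card} (λ i → ι (fibre i * size′ i))
        ≡⟨ ι-sum (λ i → fibre i * size′ i) ⟩
      ι A ∎
      where
      size′ : Fin card → ℤ
      size′ i = + size (proj₁ (element i))
      term : ∀ i → w i ℚ.* ι (size′ i) ℚ.* ι τ ≡ ι (fibre i * size′ i)
      term i = begin
        w i ℚ.* ι (size′ i) ℚ.* ι τ     ≡⟨ ℚ.*-assoc (w i) (ι (size′ i)) (ι τ) ⟩
        w i ℚ.* (ι (size′ i) ℚ.* ι τ)   ≡⟨ cong (ℚ._*_ (w i)) (ℚ.*-comm (ι (size′ i)) (ι τ)) ⟩
        w i ℚ.* (ι τ ℚ.* ι (size′ i))   ≡⟨ sym (ℚ.*-assoc (w i) (ι τ) (ι (size′ i))) ⟩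
        w i ℚ.* ι τ ℚ.* ι (size′ i)     ≡⟨ cong (ℚ._* ι (size′ i)) (w-τ i) ⟩
        ι (fibre i) ℚ.* ι (size′ i)     ≡⟨ sym (ι-* (fibre i) (size′ i)) ⟩
        ι (fibre i * size′ i)           ∎

    cancel : ∀ n .{{_ : NonZero n}} {a b} → a ℚ.* ι (+ n) ≡ b ℚ.* ι (+ n) → a ≡ b
    cancel n {a} {b} eq = trans (sym (undo a)) (trans (cong (ℚ._* (+ 1 / n)) eq) (undo b))
      where
      undo : ∀ a → a ℚ.* ι (+ n) ℚ.* (+ 1 / n) ≡ a
      undo a = trans (ℚ.*-assoc a (ι (+ n)) (+ 1 / n)) (trans
        (cong (ℚ._*_ a) (trans (ℚ.*-comm (ι (+ n)) (+ 1 / n)) (/-*-cancel (+ 1) n))) (ℚ.*-identityʳ a))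

    A≡ : ι A ≡ R ℚ.* ι M
    A≡ = cancel 24 (begin
      ι A ℚ.* ι (+ 24)           ≡⟨ sym (ι-* A (+ 24)) ⟩
      ι (A * + 24)               ≡⟨ cong ι (trans (ℤ.*-comm A (+ 24)) (trans ∑-fibre-size (ring M (+ s) (+ t)))) ⟩
      ι (X * M)                  ≡⟨ ι-* X M ⟩
      ι X ℚ.* ι M                ≡⟨ cong (ℚ._* ι M) (sym (/-*-cancel X 24)) ⟩
      R ℚ.* ι (+ 24) ℚ.* ι M     ≡⟨ ℚ.*-assoc R (ι (+ 24)) (ι M) ⟩
      R ℚ.* (ι (+ 24) ℚ.* ι M)   ≡⟨ cong (ℚ._*_ R) (ℚ.*-comm (ι (+ 24)) (ι M)) ⟩
      R ℚ.* (ι M ℚ.* ι (+ 24))   ≡⟨ sym (ℚ.*-assoc R (ι M) (ι (+ 24))) ⟩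
      R ℚ.* ι M ℚ.* ι (+ 24)     ∎)
      where
      ring : ∀ n s t → n * ((s - 1ℤ) * (t * t - 1ℤ)) ≡ (s - 1ℤ) * (t * (t * 1ℤ) - 1ℤ) * n
      ring = solve-∀

    -- Division by τ is avoided: p M = p q τ = (p τ) q = R M q, and it is the power M of t, visibly
    -- nonzero, that is cancelled.
    p≡ : p ≡ R ℚ.* q
    p≡ = cancel (t ℕ.^ s) {{ℕ.m^n≢0 t s}} (begin
      p ℚ.* ι M                  ≡⟨ cong (ℚ._*_ p) (sym q-τ) ⟩
      p ℚ.* (q ℚ.* ι τ)          ≡⟨ cong (ℚ._*_ p) (ℚ.*-comm q (ι τ)) ⟩
      p ℚ.* (ι τ ℚ.* q)          ≡⟨ sym (ℚ.*-assoc p (ι τ) q) ⟩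
      p ℚ.* ι τ ℚ.* q            ≡⟨ cong (ℚ._* q) (trans p-τ A≡) ⟩
      R ℚ.* ι M ℚ.* q            ≡⟨ ℚ.*-assoc R (ι M) q ⟩
      R ℚ.* (ι M ℚ.* q)          ≡⟨ cong (ℚ._*_ R) (ℚ.*-comm (ι M) q) ⟩
      R ℚ.* (q ℚ.* ι M)          ≡⟨ sym (ℚ.*-assoc R q (ι M)) ⟩
      R ℚ.* q ℚ.* ι M            ∎)

  ratio : (totalWeightedSize cores stabs ÷ totalWeight cores stabs) {{totalWeight≢0 cores stabs}} ≡ X / 24
  ratio = begin
    p ℚ.* 1/q            ≡⟨ cong (ℚ._* 1/q) p≡ ⟩
    R ℚ.* q ℚ.* 1/q      ≡⟨ ℚ.*-assoc R q 1/q ⟩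
    R ℚ.* (q ℚ.* 1/q)    ≡⟨ cong (ℚ._*_ R) (ℚ.*-inverseʳ q {{totalWeight≢0 cores stabs}}) ⟩
    R ℚ.* 1ℚ             ≡⟨ ℚ.*-identityʳ R ⟩
    R                    ∎
    where 1/q = (ℚ.1/ q) {{totalWeight≢0 cores stabs}}

theorem1p3 : ∀ s t .{{_ : NonZero s}} .{{_ : NonZero t}} → Coprime s t →
    Σ[ cores ∈ Finite (BiCore-setoid s t) ]
    Σ[ stabs ∈ ((x : BiCore s t) → Finite (Stab s t (asCore x))) ]
    (totalWeightedSize cores stabs ÷ totalWeight cores stabs) {{totalWeight≢0 cores stabs}}
    ≡ ((+ s - + 1) * ((+ t) ^ 2 - + 1)) / 24
theorem1p3 s t coprime = Orbits.cores s t u us≈1 , Orbits.stabs s t u us≈1 , Ratio.ratio s t u us≈1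
  where
  u = proj₁ (Bézout-inverse coprime)
  us≈1 = proj₂ (Bézout-inverse coprime)
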